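{- Let $k$ be an integer with $k \ge 2$, and let $G$ be a graph with at least one component isomorphic to $P_3$. Then $G$ is a cograph minimal $(\infty,k)$-polar obstruction if and only if $G \cong P_3 + H$ where one of the following holds: (1) $H \cong P_3 + (k-1)K_2$; (2) $H \cong (k-2)K_2 + (K_1 \oplus 2K_2)$; (3) for some integer $j \in \{1,\dots,k-1\}$, $H \cong (k-j-1)K_2 + H_j$, where $H_j$ is a connected cograph minimal $(1,j)$-polar obstruction that is not a cograph minimal $(1,\infty)$-polar obstruction; (4) $k \ge 3$ and $H$ is any cograph minimal $(1,\infty)$-polar obstruction.
   Context: All graphs are finite and simple. A cograph is a graph with no induced subgraph isomorphic to $P_4$. $G+H$ denotes disjoint union, $G \oplus H$ the join (disjoint union plus all edges between $G$ and $H$), $nG$ the disjoint union of $n$ copies of $G$ ($0G$ is the empty graph); $K_n$, $P_n$ denote the complete graph and path on $n$ vertices. A cluster is a disjoint union of complete graphs. For $s,k \in \mathbb{Z}_{\ge 0}\cup\{\infty\}$, an $(s,k)$-polar partition of $G$ is a partition $(A,B)$ of $V(G)$ (parts may be empty) such that $G[A]$ is a complete multipartite graph with at most $s$ parts and $G[B]$ is a cluster with at most $k$ components; $\infty$ means unbounded. $G$ is $(s,k)$-polar if it has such a partition. A cograph minimal $(s,k)$-polar obstruction is a cograph that is not $(s,k)$-polar but all of whose proper induced subgraphs are $(s,k)$-polar. -}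

module Defs where

open import Data.Nat using (ℕ; zero; suc; _+_; _<_; _≤_; _∸_)
open import Data.Fin using (Fin; splitAt; toℕ; zero; suc)
open import Data.Bool using (Bool; true; false; T; not; _∨_)
open import Data.Bool.Properties using (∨-comm)
open import Data.Sum using (_⊎_; inj₁; inj₂)
open import Data.Product using (Σ; Σ-syntax; _×_; _,_)
open import Data.Unit using (⊤)
open import Relation.Binary.PropositionalEquality using (_≡_; _≢_; refl)
open import Relation.Nullary using (¬_)
open import Function using (_⇔_)
open import Function.Definitions using (Injective)

record Graph : Set where
  field
    n      : ℕ
    adj    : Fin n → Fin n → Bool
    sym    : ∀ u v → adj u v ≡ adj v u
    irrefl : ∀ u → adj u u ≡ false

open Graph public

V : Graph → Set
V G = Fin (n G)

record _≅_ (G H : Graph) : Set where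
  field
    to      : V G → V H
    from    : V H → V G
    to-from : ∀ y → to (from y) ≡ y
    from-to : ∀ x → from (to x) ≡ x
    pres    : ∀ u v → adj H (to u) (to v) ≡ adj G u v

-- Induced subgraph on the image of a map f (injective in all uses)

induce : (G : Graph) {m : ℕ} → (Fin m → V G) → Graph
induce G {m} f = record
  { n = m
  ; adj = λ i j → adj G (f i) (f j)
  ; sym = λ i j → sym G (f i) (f j)
  ; irrefl = λ i → irrefl G (f i)
  }

private
  sumAdj : {p q : ℕ} → Bool → (Fin p → Fin p → Bool) → (Fin q → Fin q → Bool)
         → Fin p ⊎ Fin q → Fin p ⊎ Fin q → Bool
  sumAdj b a c (inj₁ x) (inj₁ y) = a x y
  sumAdj b a c (inj₂ x) (inj₂ y) = c x y
  sumAdj b a c (inj₁ x) (inj₂ y) = b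
  sumAdj b a c (inj₂ x) (inj₁ y) = b

  sumSym : {p q : ℕ} (b : Bool) (a : Fin p → Fin p → Bool) (c : Fin q → Fin q → Bool)
         → (∀ x y → a x y ≡ a y x) → (∀ x y → c x y ≡ c y x)
         → ∀ u v → sumAdj b a c u v ≡ sumAdj b a c v u
  sumSym b a c sa sc (inj₁ x) (inj₁ y) = sa x y
  sumSym b a c sa sc (inj₂ x) (inj₂ y) = sc x y
  sumSym b a c sa sc (inj₁ x) (inj₂ y) = refl
  sumSym b a c sa sc (inj₂ x) (inj₁ y) = refl

  sumIrr : {p q : ℕ} (b : Bool) (a : Fin p → Fin p → Bool) (c : Fin q → Fin q → Bool)
         → (∀ x → a x x ≡ false) → (∀ x → c x x ≡ false)
         → ∀ u → sumAdj b a c u u ≡ false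
  sumIrr b a c ia ic (inj₁ x) = ia x
  sumIrr b a c ia ic (inj₂ x) = ic x

  combine : Bool → Graph → Graph → Graph
  combine b G H = record
    { n = n G + n H
    ; adj = λ u v → sumAdj b (adj G) (adj H) (splitAt (n G) u) (splitAt (n G) v)
    ; sym = λ u v → sumSym b (adj G) (adj H) (sym G) (sym H) (splitAt (n G) u) (splitAt (n G) v)
    ; irrefl = λ u → sumIrr b (adj G) (adj H) (irrefl G) (irrefl H) (splitAt (n G) u)
    }

infixl 6 _+ᴳ_
infixl 7 _⊕_

_+ᴳ_ : Graph → Graph → Graph
_+ᴳ_ = combine false

_⊕_ : Graph → Graph → Graph
_⊕_ = combine true

emptyG : Graph
emptyG = record { n = 0 ; adj = λ () ; sym = λ () ; irrefl = λ () }

copies : ℕ → Graph → Graph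
copies zero    G = emptyG
copies (suc k) G = G +ᴳ copies k G

private
  eqF : {p : ℕ} → Fin p → Fin p → Bool
  eqF zero    zero    = true
  eqF zero    (suc _) = false
  eqF (suc _) zero    = false
  eqF (suc x) (suc y) = eqF x y

  eqF-sym : {p : ℕ} (x y : Fin p) → eqF x y ≡ eqF y x
  eqF-sym zero    zero    = refl
  eqF-sym zero    (suc _) = refl
  eqF-sym (suc _) zero    = refl
  eqF-sym (suc x) (suc y) = eqF-sym x y

  eqF-refl : {p : ℕ} (x : Fin p) → eqF x x ≡ true
  eqF-refl zero    = refl
  eqF-refl (suc x) = eqF-refl x

  notK : {p : ℕ} (x y : Fin p) → not (eqF x y) ≡ not (eqF y x)
  notK x y rewrite eqF-sym x y = refl

  notKr : {p : ℕ} (x : Fin p) → not (eqF x x) ≡ false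
  notKr x rewrite eqF-refl x = refl

  succ? : ℕ → ℕ → Bool
  succ? zero    (suc zero)    = true
  succ? zero    _             = false
  succ? (suc a) zero          = false
  succ? (suc a) (suc b)       = succ? a b

  succ?-irr : ∀ a → succ? a a ≡ false
  succ?-irr zero    = refl
  succ?-irr (suc a) = succ?-irr a

  pathAdj : {p : ℕ} → Fin p → Fin p → Bool
  pathAdj i j = succ? (toℕ i) (toℕ j) ∨ succ? (toℕ j) (toℕ i)

  pathSym : {p : ℕ} (i j : Fin p) → pathAdj i j ≡ pathAdj j i
  pathSym i j = ∨-comm (succ? (toℕ i) (toℕ j)) (succ? (toℕ j) (toℕ i))

  pathIrr : {p : ℕ} (i : Fin p) → pathAdj i i ≡ false
  pathIrr i rewrite succ?-irr (toℕ i) = refl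

K : ℕ → Graph
K p = record { n = p ; adj = λ i j → not (eqF i j) ; sym = notK ; irrefl = notKr }

P : ℕ → Graph
P p = record { n = p ; adj = pathAdj ; sym = pathSym ; irrefl = pathIrr }

HasInduced : Graph → Graph → Set
HasInduced G H = Σ[ f ∈ (V H → V G) ] (Injective _≡_ _≡_ f × (induce G f ≅ H))

Cograph : Graph → Set
Cograph G = ¬ HasInduced G (P 4)

data Reach (G : Graph) : V G → V G → Set where
  here : ∀ {u} → Reach G u u
  step : ∀ {u w v} → adj G u w ≡ true → Reach G w v → Reach G u v

Connected : Graph → Set
Connected G = ∀ u v → Reach G u v

-- G has a connected component isomorphic to the connected graph H:
-- an induced copy of H with no edges leaving it.
HasComponentIso : Graph → Graph → Set
HasComponentIso G H =
  Σ[ f ∈ (V H → V G) ] (Injective _≡_ _≡_ f × (induce G f ≅ H) ×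
    (∀ v i → (∀ j → f j ≢ v) → adj G v (f i) ≡ false))

data Bound : Set where
  fin : ℕ → Bound
  ∞   : Bound

Within : Bound → ℕ → Set
Within (fin s) c = c < s
Within ∞       c = ⊤

-- the vertices u with inA u ≡ true induce a complete multipartite graph
-- with at most s parts: the parts are the (nonempty) colour classes of c,
-- two distinct vertices being adjacent iff they lie in different parts
CompleteMultipartiteOn : (G : Graph) → (V G → Bool) → Bound → Set
CompleteMultipartiteOn G inA s =
  Σ[ c ∈ (V G → ℕ) ]
    ((∀ u → inA u ≡ true → Within s (c u)) ×
     (∀ u v → inA u ≡ true → inA v ≡ true → u ≢ v →
        (T (adj G u v) ⇔ (c u ≢ c v))))

-- the vertices u with inB u ≡ true induce a cluster with at most k
-- components: the components are the (nonempty) colour classes of c,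
-- two distinct vertices being adjacent iff they lie in the same component
ClusterOn : (G : Graph) → (V G → Bool) → Bound → Set
ClusterOn G inB k =
  Σ[ c ∈ (V G → ℕ) ]
    ((∀ u → inB u ≡ true → Within k (c u)) ×
     (∀ u v → inB u ≡ true → inB v ≡ true → u ≢ v →
        (T (adj G u v) ⇔ (c u ≡ c v))))

Polar : Graph → Bound → Bound → Set
Polar G s k =
  Σ[ side ∈ (V G → Bool) ]
    (CompleteMultipartiteOn G side s × ClusterOn G (λ u → not (side u)) k)

CographMinObs : Bound → Bound → Graph → Set
CographMinObs s k G =
  Cograph G × ¬ Polar G s k ×
  (∀ (m : ℕ) (f : Fin m → V G) → Injective _≡_ _≡_ f → m < n G →
     Polar (induce G f) s k)

{-# OPTIONS --safe #-}
module Submission where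

-- P₃ + H is (∞,k)-polar iff H is (1,k-1)-polar or a cluster with at most k components: a multipartite side with
-- an edge lies in one component; if it is independent, P₃ takes up one of the k cliques.
--
-- If every H - v is (1,k-1)-polar, deleting a leaf of P₃ makes H (∞,k-1)-polar, so all components of H but one
-- are complete, and then equal to K₂ by minimality.  The remaining component is a join of two cographs; such a
-- join is split, or an independent set joined to a cluster (giving (3)), or contains one of four graphs, which
-- are the minimal (1,∞)-polar obstructions (giving (4)).
--
-- Otherwise some H - v is a cluster of k non-trivial cliques.  If v is mixed on a clique, P₄-freeness gives (1);
-- if not, v is complete to exactly two cliques, which gives (2).

-- The cliques of the second case are non-trivial because a clique with at most one vertex could be
-- moved to the independent side, which leads back to the first case. The bound `k ≥ 3` in (4) has a
-- finite origin: each of the four graphs has a vertex whose deletion does not make it split, so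
-- none of them is minimal for a single clique, whereas all their vertex deletions are (1,2)-polar.
-- For the converse the delicate deletion is that of the centre of P₃. It leaves two isolated
-- vertices beside H. Both may go to A if H is (1,k)-polar, or become two cliques if H is
-- (∞,k-2)-polar; (1), (2) and (3) use the former, (4) the latter. Cotrees make the structure theory
-- algorithmic: each recognition test is a recursion that returns either a partition or an explicit
-- copy of a forbidden graph, so the completeness of the list of four graphs is read off from the
-- cases of the recursion.

open import Defs
open import Data.Bool using (Bool; true; false; T; not; if_then_else_; _∧_; _∨_)
import Data.Bool.Properties as Bool
open import Data.Empty using (⊥; ⊥-elim)
open import Data.Fin using (Fin; zero; suc; splitAt; _↑ˡ_; _↑ʳ_; punchIn; punchOut; toℕ; fromℕ<)
open import Data.Fin.Patterns using (0F; 1F; 2F; 3F)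
import Data.Fin.Properties as Fin
open import Data.Nat using (ℕ; zero; suc; _≡ᵇ_; _<ᵇ_; _+_; _*_; _≤_; _<_; _∸_; z≤n; s≤s; s≤s⁻¹)
import Data.Nat.Properties as ℕ
open import Data.Product using (Σ; Σ-syntax; ∃; _×_; _,_; proj₁; proj₂)
import Data.Sum
open import Data.Sum using (_⊎_; inj₁; inj₂; [_,_]′)
open import Data.Vec using (Vec; []; _∷_; lookup; tabulate)
open import Data.Vec.Properties using (lookup∘tabulate)
open import Data.List using (List; []; _∷_)
open import Data.Unit using (⊤; tt)
open import Function using (_⇔_; mk⇔; Equivalence; _∘_; id)
open import Function.Definitions using (Injective)
open import Relation.Binary.PropositionalEquality using (_≡_; _≢_; refl; cong; cong₂; subst; subst₂; trans) renaming (sym to ≡-sym)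
open import Relation.Nullary.Decidable using (does; _⊎-dec_; _→-dec_; _×-dec_; ¬?; toWitness)
open import Relation.Nullary using (¬_; Dec; yes; no; contradiction)
open import Relation.Binary.Definitions using (tri<; tri≈; tri>)

-- Polar partitions as vertex labellings

-- A c: in part c of the complete multipartite side; B d: in clique d of the cluster side.
data State : Set where
  A B : ℕ → State

Compat : State → State → Bool → Set
Compat (A c) (A c′) b = (b ≡ true → c ≢ c′) × (b ≡ false → c ≡ c′)
Compat (B d) (B d′) b = (b ≡ true → d ≡ d′) × (b ≡ false → d ≢ d′)
Compat (A _) (B _)  b = ⊤
Compat (B _) (A _)  b = ⊤

Bounded : Bound → Bound → State → Set
Bounded s k (A c) = Within s c
Bounded s k (B d) = Within k d

Compatible : (G : Graph) → (V G → Set) → (V G → State) → Set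
Compatible G S st = ∀ u v → S u → S v → u ≢ v → Compat (st u) (st v) (adj G u v)

-- Polarity of the subgraph induced on S.
record Pol (G : Graph) (S : V G → Set) (s k : Bound) : Set where
  constructor pol
  field
    st  : V G → State
    bnd : ∀ u → S u → Bounded s k (st u)
    cmp : Compatible G S st

open Pol

All : {X : Set} → X → Set
All _ = ⊤

Off : {X : Set} → X → X → Set
Off v u = u ≢ v

true≢false : {b : Bool} → b ≡ true → b ≡ false → ⊥
true≢false refl ()

bool-cases : (b : Bool) → b ≡ true ⊎ b ≡ false
bool-cases true  = inj₁ refl
bool-cases false = inj₂ refl

≡true⇒T : {b : Bool} → b ≡ true → T b
≡true⇒T refl = tt

T⇒≡true : {b : Bool} → T b → b ≡ true
T⇒≡true {true} _ = refl

adj⇒≢ : (G : Graph) {u v : V G} → adj G u v ≡ true → u ≢ v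
adj⇒≢ G {u} e refl = true≢false e (irrefl G u)

compat-sym : ∀ s t {b} → Compat s t b → Compat t s b
compat-sym (A _) (A _) (p , q) = (λ e f → p e (≡-sym f)) , (λ e → ≡-sym (q e))
compat-sym (B _) (B _) (p , q) = (λ e → ≡-sym (p e)) , (λ e f → q e (≡-sym f))
compat-sym (A _) (B _) _ = tt
compat-sym (B _) (A _) _ = tt

Polar⇒Pol : ∀ {G s k} → Polar G s k → Pol G All s k
Polar⇒Pol {G} {s} {k} (side , (c , boundA , multi) , (d , boundB , clust)) = pol state bound compat
  where
  toState : Bool → V G → State
  toState true  u = A (c u)
  toState false u = B (d u)
  state : V G → State
  state u = toState (side u) u
  bound : ∀ u → ⊤ → Bounded s k (state u)
  bound u _ with side u in eq
  ... | true  = boundA u eq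
  ... | false = boundB u (cong not eq)
  compat : Compatible G All state
  compat u v _ _ u≢v with side u in eu | side v in ev
  ... | true | true = (λ e → Equivalence.to (multi u v eu ev u≢v) (≡true⇒T e)) , nonadj
    where
    nonadj : adj G u v ≡ false → c u ≡ c v
    nonadj e with c u ℕ.≟ c v
    ... | yes p = p
    ... | no ¬p = ⊥-elim (true≢false (T⇒≡true (Equivalence.from (multi u v eu ev u≢v) ¬p)) e)
  ... | false | false = (λ e → Equivalence.to equiv (≡true⇒T e)) ,
      (λ e p → true≢false (T⇒≡true (Equivalence.from equiv p)) e)
    where equiv = clust u v (cong not eu) (cong not ev) u≢v
  ... | true | false = tt
  ... | false | true = tt

Pol⇒Polar : ∀ {G s k} → Pol G All s k → Polar G s k
Pol⇒Polar {G} {s} {k} (pol st bnd cmp) =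
  (λ u → isA (st u)) , (colour , boundA , multi) , (colour , boundB , clust)
  where
  isA : State → Bool
  isA (A _) = true
  isA (B _) = false
  col : State → ℕ
  col (A c) = c
  col (B d) = d
  colour : V G → ℕ
  colour u = col (st u)
  boundA : ∀ u → isA (st u) ≡ true → Within s (colour u)
  boundA u e with st u | bnd u tt
  ... | A c | b = b
  ... | B d | _ = contradiction e λ ()
  boundB : ∀ u → not (isA (st u)) ≡ true → Within k (colour u)
  boundB u e with st u | bnd u tt
  ... | B d | b = b
  ... | A c | _ = contradiction e λ ()
  multi : ∀ u v → isA (st u) ≡ true → isA (st v) ≡ true → u ≢ v → T (adj G u v) ⇔ (colour u ≢ colour v)
  multi u v eu ev u≢v with st u | st v | cmp u v tt tt u≢v
  ... | A c | A c′ | p , q = mk⇔ (λ t → p (T⇒≡true t)) from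
    where
    from : c ≢ c′ → T (adj G u v)
    from c≢c′ with bool-cases (adj G u v)
    ... | inj₁ e = ≡true⇒T e
    ... | inj₂ e = ⊥-elim (c≢c′ (q e))
  ... | A _ | B _ | _ = contradiction ev λ ()
  ... | B _ | _   | _ = contradiction eu λ ()
  clust : ∀ u v → not (isA (st u)) ≡ true → not (isA (st v)) ≡ true → u ≢ v → T (adj G u v) ⇔ (colour u ≡ colour v)
  clust u v eu ev u≢v with st u | st v | cmp u v tt tt u≢v
  ... | B d | B d′ | p , q = mk⇔ (λ t → p (T⇒≡true t)) from
    where
    from : d ≡ d′ → T (adj G u v)
    from d≡d′ with bool-cases (adj G u v)
    ... | inj₁ e = ≡true⇒T e
    ... | inj₂ e = ⊥-elim (q e d≡d′)
  ... | B _ | A _ | _ = contradiction ev λ ()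
  ... | A _ | _   | _ = contradiction eu λ ()

-- Induced embeddings, heredity and isomorphisms

infix 4 _↪_

record _↪_ (F G : Graph) : Set where
  constructor emb
  field
    fn   : V F → V G
    inj  : ∀ {i j} → fn i ≡ fn j → i ≡ j
    adj-pres : ∀ i j → adj G (fn i) (fn j) ≡ adj F i j

open _↪_

↪-trans : ∀ {F G H} → F ↪ G → G ↪ H → F ↪ H
↪-trans e f = emb (fn f ∘ fn e) (inj e ∘ inj f) (λ i j → trans (adj-pres f _ _) (adj-pres e i j))

-- Heredity of polarity. The predicates mark the surviving vertices, so a deletion never renumbers
-- the others.
pull : ∀ {F G s k} {R : V F → Set} {S : V G → Set} (e : F ↪ G) →
       (∀ i → R i → S (fn e i)) → Pol G S s k → Pol F R s k
pull e R⇒S p = pol (st p ∘ fn e) (λ u r → bnd p _ (R⇒S u r))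
  λ u v ru rv u≢v → subst (Compat _ _) (adj-pres e u v) (cmp p _ _ (R⇒S u ru) (R⇒S v rv) (u≢v ∘ inj e))

restrict : ∀ {G s k} {R S : V G → Set} → (∀ i → R i → S i) → Pol G S s k → Pol G R s k
restrict f p = pol (st p) (λ u r → bnd p u (f u r)) (λ u v ru rv → cmp p u v (f u ru) (f v rv))

relax : ∀ {G s k s′ k′} {S : V G → Set} → (∀ {c} → Within s c → Within s′ c) →
        (∀ {d} → Within k d → Within k′ d) → Pol G S s k → Pol G S s′ k′
relax {s = s} {k} {s′} {k′} f g p = pol (st p) (λ u su → widen (st p u) (bnd p u su)) (cmp p)
  where
  widen : ∀ x → Bounded s k x → Bounded s′ k′ x
  widen (A _) = f
  widen (B _) = g

module _ {G : Graph} {S : V G → Set} {s k : Bound} (p : Pol G S s k) where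

  bnd-A : ∀ {u c} → S u → st p u ≡ A c → Within s c
  bnd-A su e = subst (Bounded s k) e (bnd p _ su)

  bnd-B : ∀ {u d} → S u → st p u ≡ B d → Within k d
  bnd-B su e = subst (Bounded s k) e (bnd p _ su)

  module _ {u v} (su : S u) (sv : S v) (u≢v : u ≢ v) where

    cmp-AA : ∀ {c c′} → st p u ≡ A c → st p v ≡ A c′ → Compat (A c) (A c′) (adj G u v)
    cmp-AA eu ev = subst₂ (λ x y → Compat x y (adj G u v)) eu ev (cmp p u v su sv u≢v)

    cmp-BB : ∀ {d d′} → st p u ≡ B d → st p v ≡ B d′ → Compat (B d) (B d′) (adj G u v)
    cmp-BB eu ev = subst₂ (λ x y → Compat x y (adj G u v)) eu ev (cmp p u v su sv u≢v)

relaxʳ : ∀ {G s k k′} {S : V G → Set} → k ≤ k′ → Pol G S s (fin k) → Pol G S s (fin k′)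
relaxʳ k≤k′ = relax id (λ d<k → ℕ.<-≤-trans d<k k≤k′)

relax∞ : ∀ {G s k} {S : V G → Set} → Pol G S s (fin k) → Pol G S s ∞
relax∞ = relax id (λ _ → tt)

≅⇒↪ : ∀ {G H} → G ≅ H → G ↪ H
≅⇒↪ i = emb to (λ {x} {y} e → trans (≡-sym (from-to x)) (trans (cong from e) (from-to y))) pres
  where open _≅_ i

≅-refl : ∀ {G} → G ≅ G
≅-refl = record { to = id ; from = id ; to-from = λ _ → refl ; from-to = λ _ → refl ; pres = λ _ _ → refl }

≅-sym : ∀ {G H} → G ≅ H → H ≅ G
≅-sym {G} {H} i = record { to = from ; from = to ; to-from = from-to ; from-to = to-from
  ; pres = λ u v → trans (≡-sym (pres (from u) (from v))) (cong₂ (adj H) (to-from u) (to-from v)) }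
  where open _≅_ i

≅-trans : ∀ {F G H} → F ≅ G → G ≅ H → F ≅ H
≅-trans i j = record { to = J.to ∘ I.to ; from = I.from ∘ J.from
  ; to-from = λ y → trans (cong J.to (I.to-from _)) (J.to-from y)
  ; from-to = λ x → trans (cong I.from (J.from-to _)) (I.from-to x)
  ; pres = λ u v → trans (J.pres _ _) (I.pres u v) }
  where module I = _≅_ i
        module J = _≅_ j

≅-card : ∀ {F G} → F ≅ G → n F ≡ n G
≅-card i = ℕ.≤-antisym (Fin.injective⇒≤ (inj (≅⇒↪ i))) (Fin.injective⇒≤ (inj (≅⇒↪ (≅-sym i))))

↪-onto⇒≅ : ∀ {F G} (e : F ↪ G) → (∀ v → ∃ λ i → fn e i ≡ v) → F ≅ G
↪-onto⇒≅ e onto = record { to = fn e ; from = proj₁ ∘ onto ; to-from = proj₂ ∘ onto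
  ; from-to = λ x → inj e (proj₂ (onto (fn e x))) ; pres = adj-pres e }

Missed : ∀ {m l} → (Fin m → Fin l) → Set
Missed {l = l} f = Σ[ v ∈ Fin l ] (∀ i → f i ≢ v)

onto-or-missed : ∀ {m l} (f : Fin m → Fin l) → (∀ v → ∃ λ i → f i ≡ v) ⊎ Missed f
onto-or-missed f with Fin.all? (λ v → Fin.any? (λ i → f i Fin.≟ v))
... | yes onto = inj₁ onto
... | no ¬onto with Fin.¬∀⟶∃¬ _ _ (λ v → Fin.any? (λ i → f i Fin.≟ v)) ¬onto
...   | v , ¬hit = inj₂ (v , λ i e → ¬hit (i , e))

<⇒missed : ∀ {m l} (f : Fin m → Fin l) → m < l → Missed f
<⇒missed f m<l with onto-or-missed f
... | inj₂ missed = missed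
... | inj₁ onto = ⊥-elim (ℕ.<⇒≱ m<l (Fin.injective⇒≤ {f = proj₁ ∘ onto}
        λ {x} {y} e → trans (≡-sym (proj₂ (onto x))) (trans (cong f e) (proj₂ (onto y)))))

missed⇒< : ∀ {m l} (f : Fin m → Fin l) → Injective _≡_ _≡_ f → Missed f → m < l
missed⇒< {l = suc l} f f-inj (v , v∉f) = s≤s (Fin.injective⇒≤ {f = λ i → punchOut (v∉f i ∘ ≡-sym)}
  λ {x} {y} e → f-inj (Fin.punchOut-injective (v∉f x ∘ ≡-sym) (v∉f y ∘ ≡-sym) e))

-- Reduces an isomorphism between assembled graphs to one embedding and a vertex count.
↪-card⇒≅ : ∀ {F G} → F ↪ G → n G ≤ n F → F ≅ G
↪-card⇒≅ e le with onto-or-missed (fn e)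
... | inj₁ onto   = ↪-onto⇒≅ e onto
... | inj₂ missed = ⊥-elim (ℕ.<⇒≱ (missed⇒< (fn e) (inj e) missed) le)

-- All adjacencies of an induced path a - b - c - d; distinctness is automatic.
NoP4 : Graph → Set
NoP4 G = ∀ a b c d → adj G a b ≡ true → adj G b c ≡ true → adj G c d ≡ true →
         adj G a c ≡ false → adj G a d ≡ false → adj G b d ≡ false → ⊥

Cograph⇒NoP4 : ∀ {G} → Cograph G → NoP4 G
Cograph⇒NoP4 {G} cog a b c d ab bc cd ac ad bd = cog (f , f-inj , ↪-onto⇒≅ idEmb (λ v → v , refl))
  where
  f : Fin 4 → V G
  f 0F = a
  f 1F = b
  f 2F = c
  f 3F = d
  flip-adj : ∀ {u v x} → adj G u v ≡ x → adj G v u ≡ x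
  flip-adj {u} {v} e = trans (sym G v u) e
  idEmb : induce G f ↪ P 4
  idEmb = emb id id λ
    { 0F 0F → ≡-sym (irrefl G a) ; 0F 1F → ≡-sym ab ; 0F 2F → ≡-sym ac ; 0F 3F → ≡-sym ad
    ; 1F 0F → ≡-sym (flip-adj ab) ; 1F 1F → ≡-sym (irrefl G b) ; 1F 2F → ≡-sym bc ; 1F 3F → ≡-sym bd
    ; 2F 0F → ≡-sym (flip-adj ac) ; 2F 1F → ≡-sym (flip-adj bc) ; 2F 2F → ≡-sym (irrefl G c) ; 2F 3F → ≡-sym cd
    ; 3F 0F → ≡-sym (flip-adj ad) ; 3F 1F → ≡-sym (flip-adj bd) ; 3F 2F → ≡-sym (flip-adj cd) ; 3F 3F → ≡-sym (irrefl G d) }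
  f-inj : Injective _≡_ _≡_ f
  f-inj {0F} {0F} _ = refl
  f-inj {1F} {1F} _ = refl
  f-inj {2F} {2F} _ = refl
  f-inj {3F} {3F} _ = refl
  f-inj {0F} {1F} e = ⊥-elim (adj⇒≢ G ab e)
  f-inj {1F} {0F} e = ⊥-elim (adj⇒≢ G ab (≡-sym e))
  f-inj {1F} {2F} e = ⊥-elim (adj⇒≢ G bc e)
  f-inj {2F} {1F} e = ⊥-elim (adj⇒≢ G bc (≡-sym e))
  f-inj {2F} {3F} e = ⊥-elim (adj⇒≢ G cd e)
  f-inj {3F} {2F} e = ⊥-elim (adj⇒≢ G cd (≡-sym e))
  -- If two non-consecutive vertices coincided, an edge of the path would coincide with one of its
  -- non-edges.
  f-inj {0F} {2F} refl = ⊥-elim (true≢false cd ad)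
  f-inj {2F} {0F} refl = ⊥-elim (true≢false cd ad)
  f-inj {1F} {3F} refl = ⊥-elim (true≢false ab ad)
  f-inj {3F} {1F} refl = ⊥-elim (true≢false ab ad)
  f-inj {0F} {3F} refl = ⊥-elim (true≢false (flip-adj ab) bd)
  f-inj {3F} {0F} refl = ⊥-elim (true≢false (flip-adj ab) bd)

NoP4⇒Cograph : ∀ {G} → NoP4 G → Cograph G
NoP4⇒Cograph {G} noP4 (f , f-inj , i) = noP4 (g 0F) (g 1F) (g 2F) (g 3F)
  (ps 0F 1F) (ps 1F 2F) (ps 2F 3F) (ps 0F 2F) (ps 0F 3F) (ps 1F 3F)
  where
  g = f ∘ _≅_.from i
  ps : ∀ u v → adj G (g u) (g v) ≡ adj (P 4) u v
  ps u v = _≅_.pres (≅-sym i) u v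

NoP4-↪ : ∀ {F G} → F ↪ G → NoP4 G → NoP4 F
NoP4-↪ {F} {G} e noP4 a b c d ab bc cd ac ad bd =
  noP4 (fn e a) (fn e b) (fn e c) (fn e d) (up ab) (up bc) (up cd) (up ac) (up ad) (up bd)
  where
  up : ∀ {x u v} → adj F u v ≡ x → adj G (fn e u) (fn e v) ≡ x
  up {u = u} {v} = trans (adj-pres e u v)

-- Single deletions stand for all proper induced subgraphs: each of those misses a vertex, and
-- polarity is hereditary.
record MinObs (s k : Bound) (G : Graph) : Set where
  constructor minObs
  field
    noP4  : NoP4 G
    ¬pol  : ¬ Pol G All s k
    offᵛ  : ∀ v → Pol G (Off v) s k

open MinObs

to-MinObs : ∀ {s k G} → CographMinObs s k G → MinObs s k G
to-MinObs {s} {k} {G} (cog , ¬polar , proper) = minObs (Cograph⇒NoP4 {G} cog) (¬polar ∘ Pol⇒Polar) (off G proper)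
  where
  off : ∀ H → (∀ (m : ℕ) (f : Fin m → V H) → Injective _≡_ _≡_ f → m < n H → Polar (induce H f) s k) →
        ∀ v → Pol H (Off v) s k
  off H@(record { n = suc m }) proper v = pol state bound compat
    where
    p : Pol (induce H (punchIn v)) All s k
    p = Polar⇒Pol {induce H (punchIn v)} (proper m (punchIn v) (Fin.punchIn-injective v _ _) ℕ.≤-refl)
    state : V H → State
    state u with v Fin.≟ u
    -- A placeholder: `Off v` demands nothing at `v`.
    ... | yes _  = A 0
    ... | no v≢u = st p (punchOut v≢u)
    bound : ∀ u → u ≢ v → Bounded s k (state u)
    bound u u≢v with v Fin.≟ u
    ... | yes v≡u = ⊥-elim (u≢v (≡-sym v≡u))
    ... | no v≢u  = bnd p (punchOut v≢u) tt
    compat : Compatible H (Off v) state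
    compat u w u≢v w≢v u≢w with v Fin.≟ u | v Fin.≟ w
    ... | yes v≡u | _       = ⊥-elim (u≢v (≡-sym v≡u))
    ... | no _    | yes v≡w = ⊥-elim (w≢v (≡-sym v≡w))
    ... | no v≢u  | no v≢w  =
      subst (Compat _ _) (cong₂ (adj H) (Fin.punchIn-punchOut v≢u) (Fin.punchIn-punchOut v≢w))
        (cmp p (punchOut v≢u) (punchOut v≢w) tt tt (u≢w ∘ Fin.punchOut-injective v≢u v≢w))

from-MinObs : ∀ {s k G} → MinObs s k G → CographMinObs s k G
from-MinObs {s} {k} {G} (minObs noP4 ¬pol off) = NoP4⇒Cograph {G} noP4 , ¬pol ∘ Polar⇒Pol , proper
  where
  proper : ∀ (m : ℕ) (f : Fin m → V G) → Injective _≡_ _≡_ f → m < n G → Polar (induce G f) s k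
  proper m f f-inj m<n with <⇒missed f m<n
  ... | v , v∉f = Pol⇒Polar (pull {F = induce G f} {G} (emb f f-inj (λ _ _ → refl)) (λ i _ → v∉f i) (off v))

MinObs-≅ : ∀ {s k G H} → G ≅ H → MinObs s k G → MinObs s k H
MinObs-≅ i (minObs noP4 ¬pol off) = minObs (NoP4-↪ h↪g noP4) (¬pol ∘ pull (≅⇒↪ i) (λ _ _ → tt))
  (λ v → pull h↪g (λ u u≢v → u≢v ∘ inj h↪g) (off (fn h↪g v)))
  where h↪g = ≅⇒↪ (≅-sym i)

-- Disjoint unions

data SumView (m l : ℕ) : Fin (m + l) → Set where
  left  : ∀ x → SumView m l (x ↑ˡ l)
  right : ∀ y → SumView m l (m ↑ʳ y)

sumView : ∀ m {l} u → SumView m l u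
sumView m {l} u with splitAt m u in eq
... | inj₁ x = subst (SumView m l) (Fin.splitAt⁻¹-↑ˡ eq) (left x)
... | inj₂ y = subst (SumView m l) (Fin.splitAt⁻¹-↑ʳ eq) (right y)

↑ˡ≢↑ʳ : ∀ {m l} (x : Fin m) (y : Fin l) → x ↑ˡ l ≢ m ↑ʳ y
↑ˡ≢↑ʳ {m} {l} x y e with trans (≡-sym (Fin.splitAt-↑ˡ m x l)) (trans (cong (splitAt m) e) (Fin.splitAt-↑ʳ m l y))
... | ()

record CombinedAdj (b : Bool) (F H J : Graph) (inl : V F → V J) (inr : V H → V J) : Set where
  field
    ll : ∀ x y → adj J (inl x) (inl y) ≡ adj F x y
    lr : ∀ x y → adj J (inl x) (inr y) ≡ b
    rl : ∀ x y → adj J (inr x) (inl y) ≡ b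
    rr : ∀ x y → adj J (inr x) (inr y) ≡ adj H x y

module _ {F H : Graph} where

  +-adj : CombinedAdj false F H (F +ᴳ H) (_↑ˡ n H) (n F ↑ʳ_)
  +-adj = record { ll = ll ; lr = lr ; rl = rl ; rr = rr }
    where
    ll : ∀ x y → adj (F +ᴳ H) (x ↑ˡ n H) (y ↑ˡ n H) ≡ adj F x y
    ll x y rewrite Fin.splitAt-↑ˡ (n F) x (n H) | Fin.splitAt-↑ˡ (n F) y (n H) = refl
    lr : ∀ x y → adj (F +ᴳ H) (x ↑ˡ n H) (n F ↑ʳ y) ≡ false
    lr x y rewrite Fin.splitAt-↑ˡ (n F) x (n H) | Fin.splitAt-↑ʳ (n F) (n H) y = refl
    rl : ∀ x y → adj (F +ᴳ H) (n F ↑ʳ x) (y ↑ˡ n H) ≡ false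
    rl x y rewrite Fin.splitAt-↑ʳ (n F) (n H) x | Fin.splitAt-↑ˡ (n F) y (n H) = refl
    rr : ∀ x y → adj (F +ᴳ H) (n F ↑ʳ x) (n F ↑ʳ y) ≡ adj H x y
    rr x y rewrite Fin.splitAt-↑ʳ (n F) (n H) x | Fin.splitAt-↑ʳ (n F) (n H) y = refl

  ⊕-adj : CombinedAdj true F H (F ⊕ H) (_↑ˡ n H) (n F ↑ʳ_)
  ⊕-adj = record { ll = ll ; lr = lr ; rl = rl ; rr = rr }
    where
    ll : ∀ x y → adj (F ⊕ H) (x ↑ˡ n H) (y ↑ˡ n H) ≡ adj F x y
    ll x y rewrite Fin.splitAt-↑ˡ (n F) x (n H) | Fin.splitAt-↑ˡ (n F) y (n H) = refl
    lr : ∀ x y → adj (F ⊕ H) (x ↑ˡ n H) (n F ↑ʳ y) ≡ true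
    lr x y rewrite Fin.splitAt-↑ˡ (n F) x (n H) | Fin.splitAt-↑ʳ (n F) (n H) y = refl
    rl : ∀ x y → adj (F ⊕ H) (n F ↑ʳ x) (y ↑ˡ n H) ≡ true
    rl x y rewrite Fin.splitAt-↑ʳ (n F) (n H) x | Fin.splitAt-↑ˡ (n F) y (n H) = refl
    rr : ∀ x y → adj (F ⊕ H) (n F ↑ʳ x) (n F ↑ʳ y) ≡ adj H x y
    rr x y rewrite Fin.splitAt-↑ʳ (n F) (n H) x | Fin.splitAt-↑ʳ (n F) (n H) y = refl

  inl : F ↪ F +ᴳ H
  inl = emb (_↑ˡ n H) (Fin.↑ˡ-injective (n H) _ _) (CombinedAdj.ll +-adj)

  inr : H ↪ F +ᴳ H
  inr = emb (n F ↑ʳ_) (Fin.↑ʳ-injective (n F) _ _) (CombinedAdj.rr +-adj)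

  module _ {G : Graph} (e : F ↪ G) (f : H ↪ G) where

    copair : Fin (n F + n H) → V G
    copair u = [ fn e , fn f ]′ (splitAt (n F) u)

    copair-ˡ : ∀ x → copair (x ↑ˡ n H) ≡ fn e x
    copair-ˡ x rewrite Fin.splitAt-↑ˡ (n F) x (n H) = refl

    copair-ʳ : ∀ y → copair (n F ↑ʳ y) ≡ fn f y
    copair-ʳ y rewrite Fin.splitAt-↑ʳ (n F) (n H) y = refl

    copair-elim : (Q : V G → Set) → (∀ x → Q (fn e x)) → (∀ y → Q (fn f y)) → ∀ u → Q (copair u)
    copair-elim Q ql qr u with splitAt (n F) u
    ... | inj₁ x = ql x
    ... | inj₂ y = qr y

    copair-inj : (∀ x y → fn e x ≢ fn f y) → ∀ {u v} → copair u ≡ copair v → u ≡ v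
    copair-inj disjoint {u} {v} eq with sumView (n F) u | sumView (n F) v
    ... | left x  | left y  = cong (_↑ˡ n H) (inj e (trans (≡-sym (copair-ˡ x)) (trans eq (copair-ˡ y))))
    ... | right x | right y = cong (n F ↑ʳ_) (inj f (trans (≡-sym (copair-ʳ x)) (trans eq (copair-ʳ y))))
    ... | left x  | right y = ⊥-elim (disjoint x y (trans (≡-sym (copair-ˡ x)) (trans eq (copair-ʳ y))))
    ... | right x | left y  = ⊥-elim (disjoint y x (trans (≡-sym (copair-ˡ y)) (trans (≡-sym eq) (copair-ʳ x))))

    copair-pres : ∀ {b} (a : Fin (n F + n H) → Fin (n F + n H) → Bool) →
      (∀ x y → a (x ↑ˡ n H) (y ↑ˡ n H) ≡ adj F x y) → (∀ x y → a (x ↑ˡ n H) (n F ↑ʳ y) ≡ b) →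
      (∀ x y → a (n F ↑ʳ x) (y ↑ˡ n H) ≡ b) → (∀ x y → a (n F ↑ʳ x) (n F ↑ʳ y) ≡ adj H x y) →
      (∀ x y → adj G (fn e x) (fn f y) ≡ b) → ∀ u v → adj G (copair u) (copair v) ≡ a u v
    copair-pres a ll lr rl rr cross u v with sumView (n F) u | sumView (n F) v
    ... | left x  | left y  = trans (cong₂ (adj G) (copair-ˡ x) (copair-ˡ y)) (trans (adj-pres e x y) (≡-sym (ll x y)))
    ... | right x | right y = trans (cong₂ (adj G) (copair-ʳ x) (copair-ʳ y)) (trans (adj-pres f x y) (≡-sym (rr x y)))
    ... | left x  | right y = trans (cong₂ (adj G) (copair-ˡ x) (copair-ʳ y)) (trans (cross x y) (≡-sym (lr x y)))
    ... | right x | left y  = trans (cong₂ (adj G) (copair-ʳ x) (copair-ˡ y))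
                                (trans (sym G _ _) (trans (cross y x) (≡-sym (rl x y))))

    +-emb : (∀ x y → fn e x ≢ fn f y) → (∀ x y → adj G (fn e x) (fn f y) ≡ false) → F +ᴳ H ↪ G
    +-emb disjoint cross = emb copair (copair-inj disjoint) (copair-pres (adj (F +ᴳ H)) ll lr rl rr cross)
      where open CombinedAdj +-adj

    ⊕-emb : (∀ x y → adj G (fn e x) (fn f y) ≡ true) → F ⊕ H ↪ G
    ⊕-emb cross = emb copair (copair-inj λ x y → adj⇒≢ G (cross x y)) (copair-pres (adj (F ⊕ H)) ll lr rl rr cross)
      where open CombinedAdj ⊕-adj

  NoP4-+ : NoP4 F → NoP4 H → NoP4 (F +ᴳ H)
  NoP4-+ nF nH a b c d ab bc cd ac ad bd
    with sumView (n F) a | sumView (n F) b | sumView (n F) c | sumView (n F) d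
  ... | left a  | left b  | left c  | left d  = nF a b c d (down ab) (down bc) (down cd) (down ac) (down ad) (down bd)
    where down : ∀ {x y z} → adj (F +ᴳ H) (x ↑ˡ n H) (y ↑ˡ n H) ≡ z → adj F x y ≡ z
          down {x} {y} = trans (≡-sym (adj-pres inl x y))
  ... | right a | right b | right c | right d = nH a b c d (down ab) (down bc) (down cd) (down ac) (down ad) (down bd)
    where down : ∀ {x y z} → adj (F +ᴳ H) (n F ↑ʳ x) (n F ↑ʳ y) ≡ z → adj H x y ≡ z
          down {x} {y} = trans (≡-sym (adj-pres inr x y))
  ... | left a  | right b | _ | _ = true≢false ab (CombinedAdj.lr +-adj a b)
  ... | right a | left b  | _ | _ = true≢false ab (CombinedAdj.rl +-adj a b)
  ... | _ | left b  | right c | _ = true≢false bc (CombinedAdj.lr +-adj b c)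
  ... | _ | right b | left c  | _ = true≢false bc (CombinedAdj.rl +-adj b c)
  ... | _ | _ | left c  | right d = true≢false cd (CombinedAdj.lr +-adj c d)
  ... | _ | _ | right c | left d  = true≢false cd (CombinedAdj.rl +-adj c d)

  Pol-+ : ∀ {s k} {S : V (F +ᴳ H) → Set} (stF : V F → State) (stH : V H → State) →
    (∀ x → S (x ↑ˡ n H) → Bounded s k (stF x)) → (∀ y → S (n F ↑ʳ y) → Bounded s k (stH y)) →
    Compatible F (λ x → S (x ↑ˡ n H)) stF → Compatible H (λ y → S (n F ↑ʳ y)) stH →
    (∀ x y → S (x ↑ˡ n H) → S (n F ↑ʳ y) → Compat (stF x) (stH y) false) → Pol (F +ᴳ H) S s k
  Pol-+ {s} {k} {S} stF stH bF bH cF cH cross = pol state bound compat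
    where
    open CombinedAdj (+-adj)
    state : V (F +ᴳ H) → State
    state u = [ stF , stH ]′ (splitAt (n F) u)
    stˡ : ∀ x → state (x ↑ˡ n H) ≡ stF x
    stˡ x rewrite Fin.splitAt-↑ˡ (n F) x (n H) = refl
    stʳ : ∀ y → state (n F ↑ʳ y) ≡ stH y
    stʳ y rewrite Fin.splitAt-↑ʳ (n F) (n H) y = refl
    bound : ∀ u → S u → Bounded s k (state u)
    bound u su with sumView (n F) u
    ... | left x  = subst (Bounded s k) (≡-sym (stˡ x)) (bF x su)
    ... | right y = subst (Bounded s k) (≡-sym (stʳ y)) (bH y su)
    compat : Compatible (F +ᴳ H) S state
    compat u v su sv u≢v with sumView (n F) u | sumView (n F) v
    ... | left x  | left y  rewrite stˡ x | stˡ y | ll x y = cF x y su sv (u≢v ∘ cong (_↑ˡ n H))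
    ... | right x | right y rewrite stʳ x | stʳ y | rr x y = cH x y su sv (u≢v ∘ cong (n F ↑ʳ_))
    ... | left x  | right y rewrite stˡ x | stʳ y | lr x y = cross x y su sv
    ... | right x | left y  rewrite stʳ x | stˡ y | rl x y = compat-sym (stF y) (stH x) (cross y x sv su)

-- Frees clique 0 for a component added on the left. Parts keep their names, since non-adjacent
-- vertices of A have to share a part.
shift : State → State
shift (A c) = A c
shift (B d) = B (suc d)

compat-shift : ∀ x y {b} → Compat x y b → Compat (shift x) (shift y) b
compat-shift (A _) (A _) p = p
compat-shift (B _) (B _) (p , q) = (λ e → cong suc (p e)) , (λ e f → q e (ℕ.suc-injective f))
compat-shift (A _) (B _) _ = tt
compat-shift (B _) (A _) _ = tt

bounded-shift : ∀ {s k} x → Bounded s (fin k) x → Bounded s (fin (suc k)) (shift x)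
bounded-shift (A _) p = p
bounded-shift (B _) p = s≤s p

B0-shift : ∀ x → Compat (B 0) (shift x) false
B0-shift (A _) = tt
B0-shift (B _) = (λ ()) , (λ _ ())

Bounded-relaxˡ : ∀ {s k} x → (Within s 0) → Bounded (fin 1) k x → Bounded s k x
Bounded-relaxˡ (A zero) w _ = w
Bounded-relaxˡ (A (suc _)) _ (s≤s ())
Bounded-relaxˡ (B _) _ p = p

A0-thin : ∀ {k} x → Bounded (fin 1) k x → Compat (A 0) x false
A0-thin (A zero) _ = (λ ()) , (λ _ → refl)
A0-thin (A (suc _)) (s≤s ())
A0-thin (B _) _ = tt

module _ {F H : Graph} {S : V (F +ᴳ H) → Set} where

  addClique : ∀ {s t} → Compatible F (λ x → S (x ↑ˡ n H)) (λ _ → B 0) →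
              Pol H (λ y → S (n F ↑ʳ y)) s (fin t) → Pol (F +ᴳ H) S s (fin (suc t))
  addClique cF p = Pol-+ (λ _ → B 0) (shift ∘ st p) (λ _ _ → s≤s z≤n)
    (λ y sy → bounded-shift (st p y) (bnd p y sy)) cF
    (λ u v su sv u≢v → compat-shift (st p u) (st p v) (cmp p u v su sv u≢v))
    (λ _ y _ _ → B0-shift (st p y))

  -- The A-vertices of `H` are non-adjacent to the new ones and so must all lie in part 0; hence the
  -- single part required of `H`.
  addIndep : ∀ {s t} → Within s 0 → Compatible F (λ x → S (x ↑ˡ n H)) (λ _ → A 0) →
             Pol H (λ y → S (n F ↑ʳ y)) (fin 1) t → Pol (F +ᴳ H) S s t
  addIndep w cF p = Pol-+ (λ _ → A 0) (st p) (λ _ _ → w) (λ y sy → Bounded-relaxˡ (st p y) w (bnd p y sy))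
    cF (cmp p) (λ _ y _ sy → A0-thin (st p y) (bnd p y sy))

recolour : ℕ → ℕ → ℕ → ℕ
recolour i t d with d ℕ.≟ t
... | yes _ = i
... | no _  = d

recolour-bound : ∀ {i t d} → i < suc t → d ≢ i → d < suc t → recolour i t d < t
recolour-bound {i} {t} {d} i≤t d≢i d≤t with d ℕ.≟ t
... | yes refl = ℕ.≤∧≢⇒< (s≤s⁻¹ i≤t) (d≢i ∘ ≡-sym)
... | no d≢t   = ℕ.≤∧≢⇒< (s≤s⁻¹ d≤t) d≢t

recolour-inj : ∀ {i t d d′} → d ≢ i → d′ ≢ i → recolour i t d ≡ recolour i t d′ → d ≡ d′
recolour-inj {i} {t} {d} {d′} d≢i d′≢i e with d ℕ.≟ t | d′ ℕ.≟ t
... | yes p | yes q = trans p (≡-sym q)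
... | yes _ | no _  = ⊥-elim (d′≢i (≡-sym e))
... | no _  | yes _ = ⊥-elim (d≢i e)
... | no _  | no _  = e

module _ {G : Graph} {S : V G → Set} {s : Bound} where

  dropColour : ∀ {t i} (p : Pol G S s (fin (suc t))) → i < suc t →
               (∀ u d → S u → st p u ≡ B d → d ≢ i) → Pol G S s (fin t)
  dropColour {t} {i} p i≤t avoids = pol (λ u → rec (st p u)) bound compat
    where
    rec : State → State
    rec (A c) = A c
    rec (B d) = B (recolour i t d)
    bound : ∀ u → S u → Bounded s (fin t) (rec (st p u))
    bound u su with st p u in eq | bnd p u su
    ... | A _ | b = b
    ... | B d | b = recolour-bound i≤t (avoids u d su eq) b
    compat : Compatible G S (λ u → rec (st p u))
    compat u v su sv u≢v with st p u in eu | st p v in ev | cmp p u v su sv u≢v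
    ... | A _ | A _ | c = c
    ... | A _ | B _ | _ = tt
    ... | B _ | A _ | _ = tt
    ... | B d | B d′ | c , c′ = (λ e → cong (recolour i t) (c e)) ,
          (λ e f → c′ e (recolour-inj (avoids u d su eu) (avoids v d′ sv ev) f))

  merge-A : ∀ {k} (p : Pol G S s k) →
    (∀ {u v c c′} → S u → S v → st p u ≡ A c → st p v ≡ A c′ → adj G u v ≡ false) → Pol G S (fin 1) k
  merge-A {k} p indep = pol (λ u → flat (st p u)) bound compat
    where
    flat : State → State
    flat (A _) = A 0
    flat (B d) = B d
    bound : ∀ u → S u → Bounded (fin 1) k (flat (st p u))
    bound u su with st p u | bnd p u su
    ... | A _ | _ = s≤s z≤n
    ... | B _ | b = b
    compat : Compatible G S (λ u → flat (st p u))
    compat u v su sv u≢v with st p u in eu | st p v in ev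
    ... | A _ | A _ = (λ e → ⊥-elim (true≢false e (indep su sv eu ev))) , (λ _ → refl)
    ... | A _ | B _ = tt
    ... | B _ | A _ = tt
    ... | B _ | B _ = cmp-BB p su sv u≢v eu ev

  noA : ∀ {k} (p : Pol G S s k) → (∀ u c → S u → st p u ≢ A c) → Pol G S (fin 0) k
  noA {k} p none = pol (st p) bound (cmp p)
    where
    bound : ∀ u → S u → Bounded (fin 0) k (st p u)
    bound u su with st p u in eq | bnd p u su
    ... | A c | _ = ⊥-elim (none u c su eq)
    ... | B _ | b = b

-- What one summand of a disjoint union leaves to the other

module _ {F H : Graph} {S : V (F +ᴳ H) → Set} {s : Bound} {t : ℕ} (p : Pol (F +ᴳ H) S s (fin (suc t))) where

  private
    SH : V H → Set
    SH y = S (n F ↑ʳ y)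

    pH : Pol H SH s (fin (suc t))
    pH = pull inr (λ _ r → r) p

    across : ∀ x y → S (x ↑ˡ n H) → SH y → Compat (st p (x ↑ˡ n H)) (st p (n F ↑ʳ y)) false
    across x y sx sy = subst (Compat _ _) (CombinedAdj.lr (+-adj {F} {H}) x y) (cmp p _ _ sx sy (↑ˡ≢↑ʳ x y))

    avoid : ∀ x {i} → S (x ↑ˡ n H) → st p (x ↑ˡ n H) ≡ B i → ∀ y d → SH y → st p (n F ↑ʳ y) ≡ B d → d ≢ i
    avoid x sx ex y d sy ey e with st p (x ↑ˡ n H) | st p (n F ↑ʳ y) | across x y sx sy
    avoid x sx refl y d sy refl e | _ | _ | _ , q = q refl (≡-sym e)

    same : ∀ x {c₀} → S (x ↑ˡ n H) → st p (x ↑ˡ n H) ≡ A c₀ → ∀ y c → SH y → st p (n F ↑ʳ y) ≡ A c → c ≡ c₀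
    same x sx ex y c sy ey with st p (x ↑ˡ n H) | st p (n F ↑ʳ y) | across x y sx sy
    same x sx refl y c sy refl | _ | _ | _ , q = ≡-sym (q refl)

    colour-bound : ∀ x {i} → S (x ↑ˡ n H) → st p (x ↑ˡ n H) ≡ B i → i < suc t
    colour-bound x = bnd-B p

  sum-B : ∀ x {i} → S (x ↑ˡ n H) → st p (x ↑ˡ n H) ≡ B i → Pol H SH s (fin t)
  sum-B x sx ex = dropColour pH (colour-bound x sx ex) (avoid x sx ex)

  -- The A-vertex forces all A-vertices of `H` into its own part, so they are independent; the
  -- B-vertex uses up a clique.
  sum-AB : ∀ x y {c i} → S (x ↑ˡ n H) → st p (x ↑ˡ n H) ≡ A c → S (y ↑ˡ n H) → st p (y ↑ˡ n H) ≡ B i →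
           Pol H SH (fin 1) (fin t)
  sum-AB x y sx ex sy ey = dropColour (merge-A pH indep) (colour-bound y sy ey) avoids
    where
    indep : ∀ {u v c c′} → SH u → SH v → st pH u ≡ A c → st pH v ≡ A c′ → adj H u v ≡ false
    indep {u} {v} su sv eu ev with bool-cases (adj H u v)
    ... | inj₂ e = e
    ... | inj₁ e = ⊥-elim (proj₁ (cmp-AA pH su sv (adj⇒≢ H e) eu ev) e
            (trans (same x sx ex u _ su eu) (≡-sym (same x sx ex v _ sv ev))))
    avoids : ∀ u d → SH u → st (merge-A pH indep) u ≡ B d → d ≢ _
    avoids u d su eu with st p (n F ↑ʳ u) in eq
    avoids u d su refl | B .d = avoid y sy ey u d su eq

  -- Adjacent A-vertices lie in different parts, and an A-vertex of `H` would have to belong to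
  -- both.
  sum-AA : ∀ x y {c c′} → S (x ↑ˡ n H) → st p (x ↑ˡ n H) ≡ A c → S (y ↑ˡ n H) → st p (y ↑ˡ n H) ≡ A c′ →
           adj F x y ≡ true → Pol H SH (fin 0) (fin (suc t))
  sum-AA x y {c} {c′} sx ex sy ey xy = noA pH λ u _ su eu →
    distinct ex ey (cmp p _ _ sx sy x≢y) (trans (≡-sym (same x sx ex u _ su eu)) (same y sy ey u _ su eu))
    where
    x≢y : x ↑ˡ n H ≢ y ↑ˡ n H
    x≢y e = adj⇒≢ F xy (Fin.↑ˡ-injective (n H) _ _ e)
    distinct : ∀ {a b} → a ≡ A c → b ≡ A c′ → Compat a b (adj (F +ᴳ H) (x ↑ˡ n H) (y ↑ˡ n H)) → c ≢ c′
    distinct refl refl (q , _) = q (trans (CombinedAdj.ll (+-adj {F} {H}) x y) xy)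

K2-clique : ∀ {S : V (K 2) → Set} → Compatible (K 2) S (λ _ → B 0)
K2-clique 0F 0F _ _ u≢v = ⊥-elim (u≢v refl)
K2-clique 0F 1F _ _ _   = (λ _ → refl) , (λ ())
K2-clique 1F 0F _ _ _   = (λ _ → refl) , (λ ())
K2-clique 1F 1F _ _ u≢v = ⊥-elim (u≢v refl)

-- Nested to the right, so that each step of an induction on the number of K₂'s is a single disjoint
-- union with K₂.
plus2 : ℕ → Graph → Graph
plus2 zero    C = C
plus2 (suc m) C = K 2 +ᴳ plus2 m C

Thin : Bound → Set
Thin s = ∀ {c c′} → Within s c → Within s c′ → c ≡ c′

thin1 : Thin (fin 1)
thin1 (s≤s z≤n) (s≤s z≤n) = refl

thin0 : Thin (fin 0)
thin0 ()

module _ {F H : Graph} {S : V (F +ᴳ H) → Set} {s : Bound} {t : ℕ} {x y : V F} (xy : adj F x y ≡ true)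
         (sx : S (x ↑ˡ n H)) (sy : S (y ↑ˡ n H)) (p : Pol (F +ᴳ H) S s (fin (suc t))) where

  edge-split : Pol H (λ z → S (n F ↑ʳ z)) (fin 1) (fin t) ⊎ Pol H (λ z → S (n F ↑ʳ z)) (fin 0) (fin (suc t))
             ⊎ Pol H (λ z → S (n F ↑ʳ z)) s (fin t)
  edge-split with st p (x ↑ˡ n H) in ex | st p (y ↑ˡ n H) in ey
  ... | A _ | A _ = inj₂ (inj₁ (sum-AA p x y sx ex sy ey xy))
  ... | A _ | B _ = inj₁ (sum-AB p x y sx ex sy ey)
  ... | B _ | _   = inj₂ (inj₂ (sum-B p x sx ex))

  -- At most one part means that the edge has an end in B, which uses up a clique.
  edge-split-thin : Thin s → Pol H (λ z → S (n F ↑ʳ z)) s (fin t)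
  edge-split-thin thin with st p (x ↑ˡ n H) in ex | st p (y ↑ˡ n H) in ey
    | bnd p _ sx | bnd p _ sy | cmp p _ _ sx sy (λ e → adj⇒≢ F xy (Fin.↑ˡ-injective (n H) _ _ e))
  ... | B _ | _   | _ | _ | _ = sum-B p x sx ex
  ... | A _ | B _ | _ | _ | _ = sum-B p y sy ey
  ... | A c | A c′ | b | b′ | q , _ = ⊥-elim (q (trans (CombinedAdj.ll (+-adj {F} {H}) x y) xy) (thin b b′))

peel : ∀ {H s t} → Thin s → Pol (K 2 +ᴳ H) All s (fin (suc t)) → Pol H All s (fin t)
peel thin p = edge-split-thin {F = K 2} {x = 0F} {y = 1F} refl tt tt p thin

¬Pol-plus2 : ∀ {C s t} → Thin s → ¬ Pol C All s (fin t) → ∀ m → ¬ Pol (plus2 m C) All s (fin (m + t))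
¬Pol-plus2 thin ¬p zero    = ¬p
¬Pol-plus2 thin ¬p (suc m) = ¬Pol-plus2 thin ¬p m ∘ peel thin

module _ {H : Graph} {S : V (P 3 +ᴳ H) → Set} {t : ℕ} where

  private
    SH : V H → Set
    SH y = S (3 ↑ʳ y)

  -- P₃ is not a clique, so it meets A. Either two adjacent vertices of it are in A, or both sides
  -- are met.
  P3-split : (∀ x → S (x ↑ˡ n H)) → Pol (P 3 +ᴳ H) S ∞ (fin (suc t)) →
             Pol H SH (fin 1) (fin t) ⊎ Pol H SH (fin 0) (fin (suc t))
  P3-split s3 p with st p (0F ↑ˡ n H) in e0 | st p (1F ↑ˡ n H) in e1 | st p (2F ↑ˡ n H) in e2
    | cmp p _ _ (s3 0F) (s3 1F) (λ ()) | cmp p _ _ (s3 1F) (s3 2F) (λ ()) | cmp p _ _ (s3 0F) (s3 2F) (λ ())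
  ... | A _ | A _ | _   | _ | _ | _ = inj₂ (sum-AA p 0F 1F (s3 0F) e0 (s3 1F) e1 refl)
  ... | _   | A _ | A _ | _ | _ | _ = inj₂ (sum-AA p 1F 2F (s3 1F) e1 (s3 2F) e2 refl)
  ... | A _ | B _ | _   | _ | _ | _ = inj₁ (sum-AB p 0F 1F (s3 0F) e0 (s3 1F) e1)
  ... | B _ | A _ | B _ | _ | _ | _ = inj₁ (sum-AB p 1F 0F (s3 1F) e1 (s3 0F) e0)
  ... | B _ | B _ | A _ | _ | _ | _ = inj₁ (sum-AB p 2F 0F (s3 2F) e2 (s3 0F) e0)
  ... | B _ | B _ | B _ | q01 , _ | q12 , _ | _ , q02 = ⊥-elim (q02 refl (trans (q01 refl) (q12 refl)))

  -- An end of P₃ joins the single part of `H`; the remaining edge becomes a new clique.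
  P3-mono : Pol H SH (fin 1) (fin t) → Pol (P 3 +ᴳ H) S ∞ (fin (suc t))
  P3-mono p = Pol-+ {F = P 3} stF (shift ∘ st p) bF
    (λ y sy → Bounded-relaxˡ {∞} (shift (st p y)) tt (bounded-shift (st p y) (bnd p y sy))) cF
    (λ u v su sv u≢v → compat-shift (st p u) (st p v) (cmp p u v su sv u≢v)) cross
    where
    stF : Fin 3 → State
    stF 0F = A 0
    stF 1F = B 0
    stF 2F = B 0
    bF : ∀ x → S (x ↑ˡ n H) → Bounded ∞ (fin (suc t)) (stF x)
    bF 0F _ = tt
    bF 1F _ = s≤s z≤n
    bF 2F _ = s≤s z≤n
    cF : Compatible (P 3) (λ x → S (x ↑ˡ n H)) stF
    cF 0F 0F _ _ u≢v = ⊥-elim (u≢v refl)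
    cF 0F 1F _ _ _   = tt
    cF 0F 2F _ _ _   = tt
    cF 1F 0F _ _ _   = tt
    cF 1F 1F _ _ u≢v = ⊥-elim (u≢v refl)
    cF 1F 2F _ _ _   = (λ _ → refl) , (λ ())
    cF 2F 0F _ _ _   = tt
    cF 2F 1F _ _ _   = (λ _ → refl) , (λ ())
    cF 2F 2F _ _ u≢v = ⊥-elim (u≢v refl)
    A0-shift : ∀ y → SH y → Compat (A 0) (shift (st p y)) false
    A0-shift y sy = A0-thin {fin (suc t)} (shift (st p y)) (bounded-shift (st p y) (bnd p y sy))
    cross : ∀ x y → S (x ↑ˡ n H) → SH y → Compat (stF x) (shift (st p y)) false
    cross 0F y _ sy = A0-shift y sy
    cross 1F y _ _ = B0-shift (st p y)
    cross 2F y _ _ = B0-shift (st p y)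

  -- All of P₃ goes to A as a complete bipartite graph, and B is left to `H`.
  P3-cluster : Pol H SH (fin 0) (fin (suc t)) → Pol (P 3 +ᴳ H) S ∞ (fin (suc t))
  P3-cluster p = Pol-+ {F = P 3} stF (st p) bF bH cF (cmp p) cross
    where
    stF : Fin 3 → State
    stF 0F = A 0
    stF 1F = A 1
    stF 2F = A 0
    bF : ∀ x → S (x ↑ˡ n H) → Bounded ∞ (fin (suc t)) (stF x)
    bF 0F _ = tt
    bF 1F _ = tt
    bF 2F _ = tt
    bH : ∀ y → SH y → Bounded ∞ (fin (suc t)) (st p y)
    bH y sy with st p y | bnd p y sy
    ... | A _ | _ = tt
    ... | B _ | b = b
    cF : Compatible (P 3) (λ x → S (x ↑ˡ n H)) stF
    cF 0F 0F _ _ u≢v = ⊥-elim (u≢v refl)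
    cF 0F 1F _ _ _   = (λ _ ()) , (λ ())
    cF 0F 2F _ _ _   = (λ ()) , (λ _ → refl)
    cF 1F 0F _ _ _   = (λ _ ()) , (λ ())
    cF 1F 1F _ _ u≢v = ⊥-elim (u≢v refl)
    cF 1F 2F _ _ _   = (λ _ ()) , (λ ())
    cF 2F 0F _ _ _   = (λ ()) , (λ _ → refl)
    cF 2F 1F _ _ _   = (λ _ ()) , (λ ())
    cF 2F 2F _ _ u≢v = ⊥-elim (u≢v refl)
    A-B : ∀ c y → SH y → Compat (A c) (st p y) false
    A-B c y sy with st p y | bnd p y sy
    ... | A _ | ()
    ... | B _ | _ = tt
    cross : ∀ x y → S (x ↑ˡ n H) → SH y → Compat (stF x) (st p y) false
    cross 0F y _ sy = A-B 0 y sy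
    cross 1F y _ sy = A-B 1 y sy
    cross 2F y _ sy = A-B 0 y sy

-- What minimality of P₃ + H says about H, apart from the deletion of the centre of P₃.
record Core (t : ℕ) (H : Graph) : Set where
  constructor mkCore
  field
    coreNoP4 : NoP4 H
    ¬mono    : ¬ Pol H All (fin 1) (fin t)
    ¬cluster : ¬ Pol H All (fin 0) (fin (suc t))
    del      : ∀ v → Pol H (Off v) (fin 1) (fin t) ⊎ Pol H (Off v) (fin 0) (fin (suc t))
    multi    : Pol H All ∞ (fin t)

open Core

MinObs⇒Core : ∀ {t H} → MinObs ∞ (fin (suc t)) (P 3 +ᴳ H) → Core t H
MinObs⇒Core {t} {H} (minObs noP4 ¬pol off) = mkCore (NoP4-↪ {H} {P 3 +ᴳ H} inr noP4) ¬m ¬c del′ inf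
  where
  ¬m : ¬ Pol H All (fin 1) (fin t)
  ¬m p = ¬pol (P3-mono p)
  ¬c : ¬ Pol H All (fin 0) (fin (suc t))
  ¬c p = ¬pol (P3-cluster p)
  del′ : ∀ v → Pol H (Off v) (fin 1) (fin t) ⊎ Pol H (Off v) (fin 0) (fin (suc t))
  del′ v with P3-split {H} {Off (3 ↑ʳ v)} (λ x → ↑ˡ≢↑ʳ x v) (off (3 ↑ʳ v))
  ... | inj₁ p = inj₁ (restrict (λ u u≢v → u≢v ∘ Fin.↑ʳ-injective 3 _ _) p)
  ... | inj₂ p = inj₂ (restrict (λ u u≢v → u≢v ∘ Fin.↑ʳ-injective 3 _ _) p)
  inf : Pol H All ∞ (fin t)
  -- Deleting a leaf leaves the edge between the vertices 1 and 2. Two of the three outcomes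
  -- contradict `¬m` and `¬c`; the third is the claim.
  inf with edge-split {F = P 3} {H} {Off (0F ↑ˡ n H)} {x = 1F} {y = 2F} refl (λ ()) (λ ()) (off (0F ↑ˡ n H))
  ... | inj₁ p = ⊥-elim (¬m (restrict (λ u _ ()) p))
  ... | inj₂ (inj₁ p) = ⊥-elim (¬c (restrict (λ u _ ()) p))
  ... | inj₂ (inj₂ p) = restrict (λ u _ ()) p

-- Deciding polarity of small concrete graphs by exhaustive search

anyF : ∀ {m} → (Fin m → Bool) → Bool
anyF {zero}  p = false
anyF {suc m} p = p zero ∨ anyF (p ∘ suc)

allF : ∀ {m} → (Fin m → Bool) → Bool
allF {zero}  p = true
allF {suc m} p = p zero ∧ allF (p ∘ suc)

∧-true : ∀ {x y} → x ∧ y ≡ true → x ≡ true × y ≡ true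
∧-true {true} e = refl , e

∨-true : ∀ {x y} → x ∨ y ≡ true → x ≡ true ⊎ y ≡ true
∨-true {true}  _ = inj₁ refl
∨-true {false} e = inj₂ e

not-true : ∀ {x} → not x ≡ true → x ≡ false
not-true {false} _ = refl

anyF-sound : ∀ {m} (p : Fin m → Bool) → anyF p ≡ true → ∃ λ i → p i ≡ true
anyF-sound {suc m} p e with ∨-true {p zero} e
... | inj₁ e₀ = zero , e₀
... | inj₂ e′ with anyF-sound (p ∘ suc) e′
...   | i , eᵢ = suc i , eᵢ

allF-sound : ∀ {m} (p : Fin m → Bool) → allF p ≡ true → ∀ i → p i ≡ true
allF-sound {suc m} p e zero    = proj₁ (∧-true e)
allF-sound {suc m} p e (suc i) = allF-sound (p ∘ suc) (proj₂ (∧-true {p zero} e)) i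

_==_ : ∀ {m} → Fin m → Fin m → Bool
u == v = does (u Fin.≟ v)

==-false : ∀ {m} {u v : Fin m} → (u == v) ≡ false → u ≢ v
==-false {u = u} {v} e with u Fin.≟ v
... | no u≢v = u≢v
... | yes _  = contradiction e λ ()

≢⇒==-false : ∀ {m} {u v : Fin m} → u ≢ v → (u == v) ≡ false
≢⇒==-false {u = u} {v} u≢v with u Fin.≟ v
... | no _    = refl
... | yes u≡v = ⊥-elim (u≢v u≡v)

allVec : ∀ m → (Vec Bool m → Bool) → Bool
allVec zero    p = p []
allVec (suc m) p = allVec m (p ∘ (true ∷_)) ∧ allVec m (p ∘ (false ∷_))

allVec-sound : ∀ m p → allVec m p ≡ true → ∀ v → p v ≡ true
allVec-sound zero    p e []          = e
allVec-sound (suc m) p e (true ∷ v)  = allVec-sound m (p ∘ (true ∷_)) (proj₁ (∧-true e)) v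
allVec-sound (suc m) p e (false ∷ v) = allVec-sound m (p ∘ (false ∷_)) (proj₂ (∧-true {allVec m (p ∘ (true ∷_))} e)) v

module _ (F : Graph) where

  -- ok contains t + 1 pairwise non-adjacent vertices.
  manyIndep : ℕ → (V F → Bool) → Bool
  manyIndep zero    ok = anyF ok
  manyIndep (suc t) ok = anyF λ u → ok u ∧ manyIndep t (λ w → ok w ∧ (not (adj F u w) ∧ not (u == w)))

  tooMany : Bound → (V F → Bool) → Bool
  tooMany (fin t) ok = manyIndep t ok
  tooMany ∞       ok = false

  edgeIn : (V F → Bool) → Bool
  edgeIn ok = anyF λ u → ok u ∧ anyF λ v → ok v ∧ adj F u v

  P3In : (V F → Bool) → Bool
  P3In ok = anyF λ v → ok v ∧ anyF λ u → (ok u ∧ adj F u v) ∧ anyF λ w → (ok w ∧ adj F v w) ∧ (not (adj F u w) ∧ not (u == w))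

  -- Three reasons why a given choice of sides fails for one part: an edge in A, an induced P₃ in B,
  -- or too many pairwise non-adjacent vertices in B.
  obstructed : Bound → (V F → Bool) → Vec Bool (n F) → Bool
  obstructed t ok side = edgeIn inA ∨ (P3In inB ∨ tooMany t inB)
    where
    inA inB : V F → Bool
    inA u = ok u ∧ lookup side u
    inB u = ok u ∧ not (lookup side u)

  private
    AllB : {S : V F → Set} → (V F → State) → (V F → Bool) → Set
    AllB {S} st ok = ∀ u → ok u ≡ true → S u × ∃ λ d → st u ≡ B d

  -- Induction on the number of cliques: the chosen vertex occupies one, and the vertices
  -- non-adjacent to it avoid that colour, which is then dropped.
  manyIndep-sound : ∀ t {S s} (p : Pol F S s (fin t)) ok → AllB {S} (st p) ok → manyIndep t ok ≡ true → ⊥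
  manyIndep-sound zero p ok allB e with anyF-sound ok e
  ... | u , oku with allB u oku
  ...   | su , d , eq = ℕ.n≮0 (bnd-B p su eq)
  manyIndep-sound (suc t) {S} {s} p ok allB e
    with anyF-sound (λ u → ok u ∧ manyIndep t (λ w → ok w ∧ (not (adj F u w) ∧ not (u == w)))) e
  ... | u , eᵤ with ∧-true {ok u} eᵤ
  ...   | oku , many with allB u oku
  ...     | su , i , eqᵤ = manyIndep-sound t q ok′ allB′ many
    where
    ok′ : V F → Bool
    ok′ w = ok w ∧ (not (adj F u w) ∧ not (u == w))
    S′ : V F → Set
    S′ w = ok′ w ≡ true
    p′ : Pol F S′ s (fin (suc t))
    p′ = restrict (λ w e → proj₁ (allB w (proj₁ (∧-true e)))) p
    avoids : ∀ w d → S′ w → st p w ≡ B d → d ≢ i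
    avoids w d e′ eq refl with ∧-true {ok w} e′
    ... | okw , e″ with ∧-true {not (adj F u w)} e″
    ...   | na , u≠w =
      proj₂ (cmp-BB p su (proj₁ (allB w okw)) (==-false (not-true u≠w)) eqᵤ eq) (not-true na) refl
    q : Pol F S′ s (fin t)
    q = dropColour p′ (bnd-B p su eqᵤ) avoids
    allB′ : AllB {S′} (st q) ok′
    allB′ w e′ with st p w | allB w (proj₁ (∧-true {ok w} e′))
    ... | _ | _ , d , refl = e′ , _ , refl

  tooMany-sound : ∀ t {S s} (p : Pol F S s t) ok → AllB {S} (st p) ok → tooMany t ok ≡ true → ⊥
  tooMany-sound (fin t) = manyIndep-sound t

  -- With a single part only the sides matter, so it is enough to run through all Boolean vectors.
  refute : ∀ ok t → allVec (n F) (obstructed t ok) ≡ true → ¬ Pol F (λ u → ok u ≡ true) (fin 1) t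
  refute ok t e p = go (allVec-sound (n F) (obstructed t ok) e side)
    where
    isA : State → Bool
    isA (A _) = true
    isA (B _) = false
    side : Vec Bool (n F)
    side = tabulate (isA ∘ st p)
    inA inB : V F → Bool
    inA u = ok u ∧ lookup side u
    inB u = ok u ∧ not (lookup side u)
    getA : ∀ u → inA u ≡ true → ok u ≡ true × st p u ≡ A 0
    getA u e with ∧-true {ok u} e
    ... | oku , e′ with trans (≡-sym (lookup∘tabulate (isA ∘ st p) u)) e′ | bnd p u oku
    ...   | e″ | b with st p u
    getA u e | oku , e′ | e″ | s≤s z≤n | A .0 = oku , refl
    getB : ∀ u → inB u ≡ true → ok u ≡ true × ∃ λ d → st p u ≡ B d
    getB u e with ∧-true {ok u} e
    ... | oku , e′ with trans (≡-sym (lookup∘tabulate (isA ∘ st p) u)) (not-true e′)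
    ...   | e″ with st p u
    ...     | B d = oku , d , refl
    noEdge : edgeIn inA ≡ true → ⊥
    noEdge e with anyF-sound (λ u → inA u ∧ anyF λ v → inA v ∧ adj F u v) e
    ... | u , eᵤ with ∧-true {inA u} eᵤ
    ...   | au , e′ with anyF-sound (λ v → inA v ∧ adj F u v) e′
    ...     | v , eᵥ with ∧-true {inA v} eᵥ
    ...       | av , uv with getA u au | getA v av
    ...         | oku , su | okv , sv = proj₁ (cmp-AA p oku okv (adj⇒≢ F uv) su sv) uv refl
    noP3 : P3In inB ≡ true → ⊥
    noP3 e with anyF-sound (λ v → inB v ∧ anyF λ u → (inB u ∧ adj F u v) ∧
                  anyF λ w → (inB w ∧ adj F v w) ∧ (not (adj F u w) ∧ not (u == w))) e
    ... | v , eᵥ with ∧-true {inB v} eᵥ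
    ... | bv , e₁ with anyF-sound (λ u → (inB u ∧ adj F u v) ∧
                  anyF λ w → (inB w ∧ adj F v w) ∧ (not (adj F u w) ∧ not (u == w))) e₁
    ... | u , eᵤ with ∧-true {inB u ∧ adj F u v} eᵤ
    ... | bu-uv , e₂ with ∧-true {inB u} bu-uv | anyF-sound (λ w → (inB w ∧ adj F v w) ∧ (not (adj F u w) ∧ not (u == w))) e₂
    ... | bu , uv | w , e_w with ∧-true {inB w ∧ adj F v w} e_w
    ... | bw-vw , e₃ with ∧-true {inB w} bw-vw | ∧-true {not (adj F u w)} e₃
    ... | bw , vw | uw , u≠w with getB u bu | getB v bv | getB w bw
    ... | oku , _ , su | okv , _ , sv | okw , _ , sw =
      proj₂ (cmp-BB p oku okw (==-false (not-true u≠w)) su sw) (not-true uw)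
        (trans (proj₁ (cmp-BB p oku okv (adj⇒≢ F uv) su sv) uv) (proj₁ (cmp-BB p okv okw (adj⇒≢ F vw) sv sw) vw))
    go : obstructed t ok side ≡ true → ⊥
    go e with ∨-true {edgeIn inA} e
    ... | inj₁ e₁ = noEdge e₁
    ... | inj₂ e′ with ∨-true {P3In inB} e′
    ...   | inj₁ e₂ = noP3 e₂
    ...   | inj₂ e₃ = tooMany-sound t p inB getB e₃

¬Pol-All : ∀ F t → allVec (n F) (obstructed F t (λ _ → true)) ≡ true → ¬ Pol F All (fin 1) t
¬Pol-All F t e = refute F (λ _ → true) t e ∘ restrict (λ _ _ → tt)

off : ∀ {m} → Fin m → Fin m → Bool
off v u = not (u == v)

¬Pol-Off : ∀ F v t → allVec (n F) (obstructed F t (off v)) ≡ true → ¬ Pol F (Off v) (fin 1) t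
¬Pol-Off F v t e = refute F (off v) t e ∘ restrict (λ u e′ → ==-false (not-true e′))

withinᵇ : Bound → ℕ → Bool
withinᵇ (fin s) c = c <ᵇ s
withinᵇ ∞       c = true

boundedᵇ : Bound → Bound → State → Bool
boundedᵇ s k (A c) = withinᵇ s c
boundedᵇ s k (B d) = withinᵇ k d

compatᵇ : State → State → Bool → Bool
compatᵇ (A c) (A c′) b = if b then not (c ≡ᵇ c′) else (c ≡ᵇ c′)
compatᵇ (B d) (B d′) b = if b then (d ≡ᵇ d′) else not (d ≡ᵇ d′)
compatᵇ (A _) (B _)  b = true
compatᵇ (B _) (A _)  b = true

withinᵇ-sound : ∀ s {c} → withinᵇ s c ≡ true → Within s c
withinᵇ-sound (fin s) {c} e = ℕ.<ᵇ⇒< c s (≡true⇒T e)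
withinᵇ-sound ∞       _ = tt

boundedᵇ-sound : ∀ {s k} x → boundedᵇ s k x ≡ true → Bounded s k x
boundedᵇ-sound {s} (A c) e = withinᵇ-sound s e
boundedᵇ-sound {k = k} (B d) e = withinᵇ-sound k e

≡ᵇ-true : ∀ {c c′} → (c ≡ᵇ c′) ≡ true → c ≡ c′
≡ᵇ-true {c} {c′} e = ℕ.≡ᵇ⇒≡ c c′ (≡true⇒T e)

≡ᵇ-false : ∀ {c c′} → not (c ≡ᵇ c′) ≡ true → c ≢ c′
≡ᵇ-false {c} {c′} e p = true≢false (T⇒≡true (ℕ.≡⇒≡ᵇ c c′ p)) (not-true e)

compatᵇ-sound : ∀ x y b → compatᵇ x y b ≡ true → Compat x y b
compatᵇ-sound (A _) (A _) true  e = (λ _ → ≡ᵇ-false e) , (λ ())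
compatᵇ-sound (A _) (A _) false e = (λ ()) , (λ _ → ≡ᵇ-true e)
compatᵇ-sound (B _) (B _) true  e = (λ _ → ≡ᵇ-true e) , (λ ())
compatᵇ-sound (B _) (B _) false e = (λ ()) , (λ _ → ≡ᵇ-false e)
compatᵇ-sound (A _) (B _) _ _ = tt
compatᵇ-sound (B _) (A _) _ _ = tt

module _ (F : Graph) (s k : Bound) (ok : V F → Bool) where

  verify : Vec State (n F) → Bool
  verify st = allF λ u → not (ok u) ∨ (boundedᵇ s k (lookup st u) ∧
    allF λ v → not (ok v) ∨ ((u == v) ∨ compatᵇ (lookup st u) (lookup st v) (adj F u v)))

  verify-sound : ∀ st → verify st ≡ true → Pol F (λ u → ok u ≡ true) s k
  verify-sound st e = pol (lookup st) (λ u oku → boundedᵇ-sound (lookup st u) (proj₁ (∧-true (row u oku)))) compat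
    where
    skip : ∀ {x y} → x ≡ true → not x ∨ y ≡ true → y ≡ true
    skip refl e = e
    row : ∀ u → ok u ≡ true → _ ≡ true
    row u oku = skip oku (allF-sound _ e u)
    compat : Compatible F (λ u → ok u ≡ true) (lookup st)
    compat u v oku okv u≢v
      with ∨-true {u == v} (skip okv (allF-sound _ (proj₂ (∧-true {boundedᵇ s k (lookup st u)} (row u oku))) v))
    ... | inj₁ u=v = ⊥-elim (true≢false u=v (≢⇒==-false u≢v))
    ... | inj₂ c   = compatᵇ-sound (lookup st u) (lookup st v) _ c

anyL : {X : Set} → List X → (X → Bool) → Bool
anyL []       p = false
anyL (x ∷ xs) p = p x ∨ anyL xs p

anyL-sound : {X : Set} (xs : List X) (p : X → Bool) → anyL xs p ≡ true → ∃ λ x → p x ≡ true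
anyL-sound (x ∷ xs) p e with ∨-true {p x} e
... | inj₁ eₓ = x , eₓ
... | inj₂ e′ = anyL-sound xs p e′

anyState : List State → ∀ m → (Vec State m → Bool) → Bool
anyState xs zero    p = p []
anyState xs (suc m) p = anyL xs λ y → anyState xs m (p ∘ (y ∷_))

anyState-sound : ∀ xs m p → anyState xs m p ≡ true → ∃ λ v → p v ≡ true
anyState-sound xs zero    p e = [] , e
anyState-sound xs (suc m) p e with anyL-sound xs (λ y → anyState xs m (p ∘ (y ∷_))) e
... | y , e′ with anyState-sound xs m (p ∘ (y ∷_)) e′
...   | v , eᵥ = y ∷ v , eᵥ

Pol-All : ∀ F {s k} st → verify F s k (λ _ → true) st ≡ true → Pol F All s k
Pol-All F st e = restrict (λ _ _ → refl) (verify-sound F _ _ _ st e)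

search : ∀ F (s k : Bound) → List State → V F → Bool
search F s k xs v = anyState xs (n F) (verify F s k (off v))

Pol-Off : ∀ F {s k} xs v → search F s k xs v ≡ true → Pol F (Off v) s k
Pol-Off F xs v e with anyState-sound xs (n F) _ e
... | st , eᵥ = restrict (λ u u≢v → cong not (≢⇒==-false u≢v)) (verify-sound F _ _ _ st eᵥ)

-- The minimal (1,∞)-polar obstructions

-- Built from K₁ by + and ⊕ only, so that copies can be assembled along a cotree.
2K1 K2′ P3′ C4 2K2′ : Graph
2K1 = K 1 +ᴳ K 1
K2′  = K 1 ⊕ K 1
P3′ = K 1 ⊕ 2K1
C4  = 2K1 ⊕ 2K1
2K2′ = K2′ +ᴳ K2′

-- The four cograph minimal (1,∞)-polar obstructions; K₁ ⊕ C₄ and K₂ ⊕ 2K₂ occur in two bracketings.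
data Forbidden : Graph → Set where
  forb₁ : Forbidden (2K1 ⊕ P3′)
  forb₂ : Forbidden (K 1 ⊕ C4)
  forb₃ : Forbidden (K2′ ⊕ 2K2′)
  forb₄ : Forbidden (K 1 ⊕ (K 1 ⊕ 2K2′))
  forb₅ : Forbidden ((K 1 +ᴳ K2′) ⊕ (K 1 +ᴳ K2′))
  forb₆ : Forbidden (K 1 ⊕ (P3′ +ᴳ K2′))

-- `del₂` and `multi₁` give the deletion properties of P₃ + F as soon as two cliques are available
-- besides that of P₃; `nonsplit` shows that one would be too few, which is the origin of `k ≥ 3` in
-- (4).
record ForbiddenFacts (F : Graph) : Set where
  constructor facts
  field
    ¬monopolar : ¬ Pol F All (fin 1) ∞
    del₂       : ∀ v → Pol F (Off v) (fin 1) (fin 2)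
    multi₁     : Pol F All ∞ (fin 1)
    nonsplit   : ∃ λ v → ¬ Pol F (Off v) (fin 1) (fin 1)

check-facts : ∀ F st v → allVec (n F) (obstructed F ∞ (λ _ → true)) ≡ true →
  allF (search F (fin 1) (fin 2) (A 0 ∷ B 0 ∷ B 1 ∷ [])) ≡ true → verify F ∞ (fin 1) (λ _ → true) st ≡ true →
  allVec (n F) (obstructed F (fin 1) (off v)) ≡ true → ForbiddenFacts F
check-facts F st v e₁ e₂ e₃ e₄ = facts (¬Pol-All F ∞ e₁)
  (λ w → Pol-Off F (A 0 ∷ B 0 ∷ B 1 ∷ []) w (allF-sound _ e₂ w)) (Pol-All F st e₃) (v , ¬Pol-Off F v (fin 1) e₄)

-- The listed partitions have at most one edge in B. The listed vertex is chosen so that its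
-- deletion leaves a C₄ or a 2K₂, hence a graph that is not split.
forbidden-facts : ∀ {F} → Forbidden F → ForbiddenFacts F
forbidden-facts forb₁ = check-facts _ (A 0 ∷ A 0 ∷ A 1 ∷ A 2 ∷ A 2 ∷ []) 2F refl refl refl refl
forbidden-facts forb₂ = check-facts _ (A 0 ∷ A 1 ∷ A 1 ∷ A 2 ∷ A 2 ∷ []) 0F refl refl refl refl
forbidden-facts forb₃ = check-facts _ (A 0 ∷ A 1 ∷ A 2 ∷ A 3 ∷ B 0 ∷ B 0 ∷ []) 0F refl refl refl refl
forbidden-facts forb₄ = check-facts _ (A 0 ∷ A 1 ∷ A 2 ∷ A 3 ∷ B 0 ∷ B 0 ∷ []) 0F refl refl refl refl
forbidden-facts forb₅ = check-facts _ (A 0 ∷ A 0 ∷ B 0 ∷ A 1 ∷ A 1 ∷ B 0 ∷ []) 2F refl refl refl refl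
forbidden-facts forb₆ = check-facts _ (A 0 ∷ A 1 ∷ A 2 ∷ A 2 ∷ B 0 ∷ B 0 ∷ []) 0F refl refl refl refl

-- Cores of small graphs, and the effect of adding K₂ and P₃

noP4? : ∀ G → Dec (NoP4 G)
noP4? G = Fin.all? λ a → Fin.all? λ b → Fin.all? λ c → Fin.all? λ d →
  (adj G a b Bool.≟ true) →-dec ((adj G b c Bool.≟ true) →-dec ((adj G c d Bool.≟ true) →-dec
  ((adj G a c Bool.≟ false) →-dec ((adj G a d Bool.≟ false) →-dec ((adj G b d Bool.≟ false) →-dec no λ ())))))

P3-NoP4 : NoP4 (P 3)
P3-NoP4 = toWitness {a? = noP4? (P 3)} tt

K2-NoP4 : NoP4 (K 2)
K2-NoP4 = toWitness {a? = noP4? (K 2)} tt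

P3⇒¬cluster : ∀ {G k} {S : V G → Set} u v w → S u → S v → S w → adj G u v ≡ true → adj G v w ≡ true →
              adj G u w ≡ false → u ≢ w → ¬ Pol G S (fin 0) k
P3⇒¬cluster {G} u v w su sv sw uv vw uw u≢w p with st p u in eu | st p v in ev | st p w in ew
... | A _ | _   | _   = ⊥-elim (ℕ.n≮0 (bnd-A p su eu))
... | B _ | A _ | _   = ⊥-elim (ℕ.n≮0 (bnd-A p sv ev))
... | B _ | B _ | A _ = ⊥-elim (ℕ.n≮0 (bnd-A p sw ew))
... | B _ | B _ | B _ = proj₂ (cmp-BB p su sw u≢w eu ew) uw
  (trans (proj₁ (cmp-BB p su sv (adj⇒≢ G uv) eu ev) uv) (proj₁ (cmp-BB p sv sw (adj⇒≢ G vw) ev ew) vw))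

P3-del : ∀ v → Pol (P 3) (Off v) (fin 1) (fin 0) ⊎ Pol (P 3) (Off v) (fin 0) (fin 1)
P3-del 0F = inj₂ (Pol-Off (P 3) (B 0 ∷ []) 0F refl)
P3-del 1F = inj₁ (Pol-Off (P 3) (A 0 ∷ []) 1F refl)
P3-del 2F = inj₂ (Pol-Off (P 3) (B 0 ∷ []) 2F refl)

-- The seed of (1), from which `t` grows by adding K₂'s.
Core-P3 : Core 0 (P 3)
Core-P3 = mkCore P3-NoP4 (¬Pol-All (P 3) (fin 0) refl) (P3⇒¬cluster 0F 1F 2F tt tt tt refl refl refl λ ())
  P3-del (Pol-All (P 3) (A 0 ∷ A 1 ∷ A 0 ∷ []) refl)

butterfly : Graph
butterfly = K 1 ⊕ copies 2 (K 2)

butterfly-del : ∀ v → Pol butterfly (Off v) (fin 1) (fin 1) ⊎ Pol butterfly (Off v) (fin 0) (fin 2)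
butterfly-del zero = inj₂ (Pol-Off butterfly (B 0 ∷ B 1 ∷ []) 0F refl)
butterfly-del v@(suc w) = inj₁ (Pol-Off butterfly (A 0 ∷ B 0 ∷ []) v
  (allF-sound (search butterfly (fin 1) (fin 1) (A 0 ∷ B 0 ∷ []) ∘ suc) refl w))

-- The seed of (2). The cluster alternative occurs only for the deletion of the centre.
Core-butterfly : Core 1 butterfly
Core-butterfly = mkCore (toWitness {a? = noP4? butterfly} tt) (¬Pol-All butterfly (fin 1) refl)
  (P3⇒¬cluster 1F 0F 3F tt tt tt refl refl refl λ ()) butterfly-del
  (Pol-All butterfly (A 0 ∷ A 1 ∷ A 2 ∷ B 0 ∷ B 0 ∷ []) refl)

-- Each new K₂ takes one clique. When one of its vertices is deleted, the other becomes isolated and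
-- goes to A; this is where `H` must be (1,t+1)-polar.
Core-K2 : ∀ {t H} → Core t H → Pol H All (fin 1) (fin (suc t)) → Core (suc t) (K 2 +ᴳ H)
Core-K2 {t} {H} (mkCore noP4 ¬m ¬c del inf) p = mkCore (NoP4-+ {K 2} {H} K2-NoP4 noP4) (¬m ∘ peel thin1) (¬c ∘ peel thin0)
  del′ (addClique {F = K 2} K2-clique inf)
  where
  A0-off : ∀ x → Compatible (K 2) (λ y → y ↑ˡ n H ≢ x ↑ˡ n H) (λ _ → A 0)
  A0-off 0F 0F _  u≢ _ _ = ⊥-elim (u≢ refl)
  A0-off 0F _  0F _ v≢ _ = ⊥-elim (v≢ refl)
  A0-off 0F 1F 1F _ _ u≢v = ⊥-elim (u≢v refl)
  A0-off 1F 1F _  u≢ _ _ = ⊥-elim (u≢ refl)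
  A0-off 1F _  1F _ v≢ _ = ⊥-elim (v≢ refl)
  A0-off 1F 0F 0F _ _ u≢v = ⊥-elim (u≢v refl)
  del′ : ∀ v → Pol (K 2 +ᴳ H) (Off v) (fin 1) (fin (suc t)) ⊎ Pol (K 2 +ᴳ H) (Off v) (fin 0) (fin (suc (suc t)))
  del′ v with sumView 2 v
  ... | left x = inj₁ (addIndep {F = K 2} (s≤s z≤n) (A0-off x) (restrict (λ _ _ → tt) p))
  ... | right y with del y
  ...   | inj₁ q = inj₁ (addClique {F = K 2} K2-clique (restrict (λ u ne → ne ∘ cong (2 ↑ʳ_)) q))
  ...   | inj₂ q = inj₂ (addClique {F = K 2} K2-clique (restrict (λ u ne → ne ∘ cong (2 ↑ʳ_)) q))

Core-plus2 : ∀ {t C} → Core t C → Pol C All (fin 1) (fin (suc t)) → ∀ m →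
             Core (m + t) (plus2 m C) × Pol (plus2 m C) All (fin 1) (fin (suc (m + t)))
Core-plus2 core p zero = core , p
Core-plus2 core p (suc m) with Core-plus2 core p m
... | core′ , p′ = Core-K2 core′ p′ , addClique {F = K 2} K2-clique p′

-- The two alternatives serve the deletion of the centre of P₃: both leaves go to A, or they become
-- two cliques. Deleting a leaf leaves an edge, which is a clique beside the partition `inf`.
Core⇒MinObs : ∀ {t H} → Core t H →
  Pol H All (fin 1) (fin (suc t)) ⊎ (Σ[ t′ ∈ ℕ ] t ≡ suc t′ × Pol H All ∞ (fin t′)) →
  MinObs ∞ (fin (suc t)) (P 3 +ᴳ H)
Core⇒MinObs {t} {H} (mkCore noP4 ¬m ¬c del inf) centre =
  minObs (NoP4-+ {P 3} {H} P3-NoP4 noP4) ([ ¬m , ¬c ]′ ∘ P3-split {H} (λ _ → tt)) off′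
  where
  edge-off-0 : Compatible (P 3) (λ x → x ↑ˡ n H ≢ 0F) (λ _ → B 0)
  edge-off-0 0F _  u≢ _ _ = ⊥-elim (u≢ refl)
  edge-off-0 _  0F _ v≢ _ = ⊥-elim (v≢ refl)
  edge-off-0 1F 1F _ _ u≢v = ⊥-elim (u≢v refl)
  edge-off-0 1F 2F _ _ _ = (λ _ → refl) , λ ()
  edge-off-0 2F 1F _ _ _ = (λ _ → refl) , λ ()
  edge-off-0 2F 2F _ _ u≢v = ⊥-elim (u≢v refl)
  edge-off-2 : Compatible (P 3) (λ x → x ↑ˡ n H ≢ 2F) (λ _ → B 0)
  edge-off-2 2F _  u≢ _ _ = ⊥-elim (u≢ refl)
  edge-off-2 _  2F _ v≢ _ = ⊥-elim (v≢ refl)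
  edge-off-2 0F 0F _ _ u≢v = ⊥-elim (u≢v refl)
  edge-off-2 0F 1F _ _ _ = (λ _ → refl) , λ ()
  edge-off-2 1F 0F _ _ _ = (λ _ → refl) , λ ()
  edge-off-2 1F 1F _ _ u≢v = ⊥-elim (u≢v refl)
  indep-off-1 : Compatible (P 3) (λ x → x ↑ˡ n H ≢ 1F) (λ _ → A 0)
  indep-off-1 1F _  u≢ _ _ = ⊥-elim (u≢ refl)
  indep-off-1 _  1F _ v≢ _ = ⊥-elim (v≢ refl)
  indep-off-1 0F 0F _ _ u≢v = ⊥-elim (u≢v refl)
  indep-off-1 0F 2F _ _ _ = (λ ()) , λ _ → refl
  indep-off-1 2F 0F _ _ _ = (λ ()) , λ _ → refl
  indep-off-1 2F 2F _ _ u≢v = ⊥-elim (u≢v refl)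
  two : Fin 3 → State
  two 0F = B 0
  two _  = B 1
  two-off-1 : Compatible (P 3) (λ x → x ↑ˡ n H ≢ 1F) two
  two-off-1 1F _  u≢ _ _ = ⊥-elim (u≢ refl)
  two-off-1 _  1F _ v≢ _ = ⊥-elim (v≢ refl)
  two-off-1 0F 0F _ _ u≢v = ⊥-elim (u≢v refl)
  two-off-1 0F 2F _ _ _ = (λ ()) , λ _ ()
  two-off-1 2F 0F _ _ _ = (λ ()) , λ _ ()
  two-off-1 2F 2F _ _ u≢v = ⊥-elim (u≢v refl)
  two-bound : ∀ {t′} x → Bounded ∞ (fin (suc (suc t′))) (two x)
  two-bound 0F = s≤s z≤n
  two-bound 1F = s≤s (s≤s z≤n)
  two-bound 2F = s≤s (s≤s z≤n)
  two-cross : ∀ x s → Compat (two x) (shift (shift s)) false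
  two-cross 0F s = B0-shift (shift s)
  two-cross 1F s = compat-shift (B 0) (shift s) (B0-shift s)
  two-cross 2F s = compat-shift (B 0) (shift s) (B0-shift s)
  off-centre : ∀ {t} → Pol H All (fin 1) (fin (suc t)) ⊎ (Σ[ t′ ∈ ℕ ] t ≡ suc t′ × Pol H All ∞ (fin t′)) →
               Pol (P 3 +ᴳ H) (Off 1F) ∞ (fin (suc t))
  off-centre (inj₁ p) = addIndep {F = P 3} tt indep-off-1 (restrict (λ _ _ → tt) p)
  off-centre (inj₂ (t′ , refl , p)) = Pol-+ {F = P 3} two (shift ∘ shift ∘ st p) (λ x _ → two-bound x)
    (λ y _ → bounded-shift (shift (st p y)) (bounded-shift (st p y) (bnd p y tt))) two-off-1
    (λ u v _ _ u≢v → compat-shift (shift (st p u)) (shift (st p v)) (compat-shift (st p u) (st p v) (cmp p u v tt tt u≢v)))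
    (λ x y _ _ → two-cross x (st p y))
  off′ : ∀ v → Pol (P 3 +ᴳ H) (Off v) ∞ (fin (suc t))
  off′ v with sumView 3 v
  ... | left 0F = addClique {F = P 3} edge-off-0 (restrict (λ _ _ → tt) inf)
  ... | left 1F = off-centre centre
  ... | left 2F = addClique {F = P 3} edge-off-2 (restrict (λ _ _ → tt) inf)
  ... | right y with del y
  ...   | inj₁ q = P3-mono (restrict (λ u ne → ne ∘ cong (3 ↑ʳ_)) q)
  ...   | inj₂ q = P3-cluster (restrict (λ u ne → ne ∘ cong (3 ↑ʳ_)) q)

-- Rearranging disjoint unions and splitting off components

+-congʳ : ∀ {F H H′} → H ≅ H′ → (F +ᴳ H) ≅ (F +ᴳ H′)
+-congʳ {F} {H} {H′} i = ↪-card⇒≅ (+-emb inl (↪-trans (≅⇒↪ i) inr) (λ x y → ↑ˡ≢↑ʳ x _)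
  (λ x y → CombinedAdj.lr (+-adj {F} {H′}) x _)) (ℕ.≤-reflexive (cong (n F +_) (≡-sym (≅-card i))))

+-comm : ∀ F H → (F +ᴳ H) ≅ (H +ᴳ F)
+-comm F H = ↪-card⇒≅ (+-emb inr inl (λ x y e → ↑ˡ≢↑ʳ y x (≡-sym e)) (λ x y → CombinedAdj.rl (+-adj {H} {F}) x y))
  (ℕ.≤-reflexive (ℕ.+-comm (n H) (n F)))

+-assoc : ∀ F G H → ((F +ᴳ G) +ᴳ H) ≅ (F +ᴳ (G +ᴳ H))
+-assoc F G H = ↪-card⇒≅ (+-emb (+-emb eF eG (λ x y → ↑ˡ≢↑ʳ x (y ↑ˡ n H)) (λ x y → FGH.lr x (y ↑ˡ n H))) eH
    (λ u y → copair-elim eF eG (_≢ fn eH y) (λ x → ↑ˡ≢↑ʳ x (n G ↑ʳ y))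
      (λ x e → ↑ˡ≢↑ʳ x y (Fin.↑ʳ-injective (n F) (x ↑ˡ n H) (n G ↑ʳ y) e)) u)
    (λ u y → copair-elim eF eG (λ z → adj (F +ᴳ (G +ᴳ H)) z (fn eH y) ≡ false)
      (λ x → FGH.lr x (n G ↑ʳ y)) (λ x → trans (FGH.rr (x ↑ˡ n H) (n G ↑ʳ y)) (CombinedAdj.lr (+-adj {G} {H}) x y)) u))
  (ℕ.≤-reflexive (≡-sym (ℕ.+-assoc (n F) (n G) (n H))))
  where
  module FGH = CombinedAdj (+-adj {F} {G +ᴳ H})
  eF : F ↪ F +ᴳ (G +ᴳ H)
  eF = inl {F} {G +ᴳ H}
  eG : G ↪ F +ᴳ (G +ᴳ H)
  eG = ↪-trans (inl {G} {H}) (inr {F} {G +ᴳ H})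
  eH : H ↪ F +ᴳ (G +ᴳ H)
  eH = ↪-trans (inr {G} {H}) (inr {F} {G +ᴳ H})

copies+≅plus2 : ∀ m C → (copies m (K 2) +ᴳ C) ≅ plus2 m C
copies+≅plus2 zero    C = record { to = id ; from = id ; to-from = λ _ → refl ; from-to = λ _ → refl ; pres = λ _ _ → refl }
copies+≅plus2 (suc m) C = ≅-trans (+-assoc (K 2) (copies m (K 2)) C) (+-congʳ (copies+≅plus2 m C))

edge-emb : ∀ {G u v} → adj G u v ≡ true → K 2 ↪ G
edge-emb {G} {u} {v} uv = emb f f-inj f-pres
  where
  f : Fin 2 → V G
  f 0F = u
  f 1F = v
  f-inj : ∀ {i j} → f i ≡ f j → i ≡ j
  f-inj {0F} {0F} _ = refl
  f-inj {0F} {1F} e = ⊥-elim (adj⇒≢ G uv e)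
  f-inj {1F} {0F} e = ⊥-elim (adj⇒≢ G uv (≡-sym e))
  f-inj {1F} {1F} _ = refl
  f-pres : ∀ i j → adj G (f i) (f j) ≡ adj (K 2) i j
  f-pres 0F 0F = irrefl G u
  f-pres 0F 1F = uv
  f-pres 1F 0F = trans (sym G v u) uv
  f-pres 1F 1F = irrefl G v

module _ {G C : Graph} (e : C ↪ G) where

  record EdgesApart {m} (r : Fin m → Fin 2 → V G) : Set where
    field
      edge   : ∀ i → adj G (r i 0F) (r i 1F) ≡ true
      apart  : ∀ {i j} → i ≢ j → ∀ a b → r i a ≢ r j b × adj G (r i a) (r j b) ≡ false
      apartᶜ : ∀ i a z → r i a ≢ fn e z × adj G (r i a) (fn e z) ≡ false

  open EdgesApart

  -- The elimination principle transfers properties to the whole image without any reference to the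
  -- numbering of the vertices of `plus2 m C`.
  plus2-emb : ∀ {m} {r : Fin m → Fin 2 → V G} → EdgesApart r →
    Σ[ f ∈ plus2 m C ↪ G ] (∀ (Q : V G → Set) → (∀ i a → Q (r i a)) → (∀ z → Q (fn e z)) → ∀ u → Q (fn f u))
  plus2-emb {zero} _ = e , λ Q _ q → q
  plus2-emb {suc m} {r} E with plus2-emb {m} {r ∘ suc}
    (record { edge = edge E ∘ suc ; apart = λ i≢j → apart E (i≢j ∘ Fin.suc-injective) ; apartᶜ = apartᶜ E ∘ suc })
  ... | f , f-elim = +-emb e₀ f (λ x → proj₁ ∘ sep x) (λ x → proj₂ ∘ sep x) ,
        λ Q qr qz → copair-elim e₀ f Q (λ x → subst Q (≡-sym (e₀-fn x)) (qr zero x)) (f-elim Q (λ i → qr (suc i)) qz)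
    where
    e₀ : K 2 ↪ G
    e₀ = edge-emb (edge E zero)
    e₀-fn : ∀ x → fn e₀ x ≡ r zero x
    e₀-fn 0F = refl
    e₀-fn 1F = refl
    sep : ∀ x y → fn e₀ x ≢ fn f y × adj G (fn e₀ x) (fn f y) ≡ false
    sep x rewrite e₀-fn x = f-elim (λ z → r zero x ≢ z × adj G (r zero x) z ≡ false)
      (λ i a → apart E (λ ()) x a) (apartᶜ E zero x)

-- Enumerates what an injection misses. It serves for the vertices outside a component and for the
-- cliques outside a chosen few.
record Complement {m l} (f : Fin m → Fin l) : Set where
  field
    size     : ℕ
    size-eq  : size + m ≡ l
    g        : Fin size → Fin l
    g-inj    : Injective _≡_ _≡_ g
    disjoint : ∀ i j → f i ≢ g j
    cover    : ∀ x → (∃ λ i → f i ≡ x) ⊎ (∃ λ j → g j ≡ x)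

complement : ∀ {m l} (f : Fin m → Fin l) → Injective _≡_ _≡_ f → Complement f
complement {zero} {l} f _ = record { size = l ; size-eq = ℕ.+-identityʳ l ; g = id ; g-inj = id
  ; disjoint = λ () ; cover = λ x → inj₂ (x , refl) }
complement {suc m} {zero} f _ with f zero
... | ()
complement {suc m} {suc l} f f-inj = record { size = C.size ; size-eq = trans (ℕ.+-suc _ m) (cong suc C.size-eq)
  ; g = punchIn (f zero) ∘ C.g ; g-inj = C.g-inj ∘ Fin.punchIn-injective (f zero) _ _ ; disjoint = disj ; cover = cov }
  where
  f₀≢ : ∀ i → f zero ≢ f (suc i)
  f₀≢ i e with f-inj e
  ... | ()
  f′ : Fin m → Fin l
  f′ i = punchOut (f₀≢ i)
  f′-in : ∀ i → punchIn (f zero) (f′ i) ≡ f (suc i)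
  f′-in i = Fin.punchIn-punchOut (f₀≢ i)
  module C = Complement (complement f′ (λ {i} {j} e → Fin.suc-injective (f-inj (Fin.punchOut-injective (f₀≢ i) (f₀≢ j) e))))
  disj : ∀ i j → f i ≢ punchIn (f zero) (C.g j)
  disj zero    j e = Fin.punchInᵢ≢i (f zero) _ (≡-sym e)
  disj (suc i) j e = C.disjoint i j (Fin.punchIn-injective (f zero) _ _ (trans (f′-in i) e))
  cov : ∀ x → (∃ λ i → f i ≡ x) ⊎ (∃ λ j → punchIn (f zero) (C.g j) ≡ x)
  cov x with f zero Fin.≟ x
  ... | yes e = inj₁ (zero , e)
  ... | no f₀≢x with C.cover (punchOut f₀≢x)
  ...   | inj₁ (i , e) = inj₁ (suc i , trans (≡-sym (f′-in i)) (trans (cong (punchIn (f zero)) e) (Fin.punchIn-punchOut f₀≢x)))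
  ...   | inj₂ (j , e) = inj₂ (j , trans (cong (punchIn (f zero)) e) (Fin.punchIn-punchOut f₀≢x))

split-component : ∀ {F G} (e : F ↪ G) → (∀ v i → (∀ j → fn e j ≢ v) → adj G v (fn e i) ≡ false) →
                  Σ[ H ∈ Graph ] (G ≅ (F +ᴳ H))
split-component {F} {G} e closed = induce G g , ≅-sym (↪-onto⇒≅ h onto)
  where
  open Complement (complement (fn e) (inj e))
  rest : induce G g ↪ G
  rest = emb g g-inj (λ _ _ → refl)
  h : F +ᴳ induce G g ↪ G
  h = +-emb e rest disjoint (λ x y → trans (sym G _ _) (closed (g y) x (λ j → disjoint j y)))
  onto : ∀ v → ∃ λ i → fn h i ≡ v
  onto v with cover v
  ... | inj₁ (i , p) = i ↑ˡ _ , trans (copair-ˡ e rest i) p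
  ... | inj₂ (j , p) = n F ↑ʳ j , trans (copair-ʳ e rest j) p

-- Cotrees

module _ (G : Graph) where

  -- `true` stands for a join, `false` for a disjoint union. Labels need not alternate, and a tree
  -- may cover only some of the vertices.
  data Tree : Set where
    leaf : V G → Tree
    node : Bool → Tree → Tree → Tree

module _ {G : Graph} where

  infix 4 _∈_

  _∈_ : V G → Tree G → Set
  u ∈ leaf v     = u ≡ v
  u ∈ node _ l r = u ∈ l ⊎ u ∈ r

  _∈?_ : ∀ u t → Dec (u ∈ t)
  u ∈? leaf v     = u Fin.≟ v
  u ∈? node _ l r = (u ∈? l) ⊎-dec (u ∈? r)

  Cross : Bool → Tree G → Tree G → Set
  Cross b l r = ∀ {u v} → u ∈ l → v ∈ r → u ≢ v × adj G u v ≡ b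

  Valid : Tree G → Set
  Valid (leaf _)     = ⊤
  Valid (node b l r) = Valid l × Valid r × Cross b l r

  cross-sym : ∀ {b l r} → Cross b l r → Cross b r l
  cross-sym c u∈r v∈l = (λ e → proj₁ (c v∈l u∈r) (≡-sym e)) , trans (sym G _ _) (proj₂ (c v∈l u∈r))

  root : Tree G → V G
  root (leaf v)     = v
  root (node _ l _) = root l

  root∈ : ∀ t → root t ∈ t
  root∈ (leaf v)     = refl
  root∈ (node _ l _) = inj₁ (root∈ l)

  -- Trees are non-empty, so an empty restriction needs its own case.
  data Filtered (p : V G → Bool) (t : Tree G) : Set where
    none : (∀ {u} → u ∈ t → p u ≡ false) → Filtered p t
    some : ∀ t′ → Valid t′ → (∀ {u} → u ∈ t′ → u ∈ t × p u ≡ true) →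
           (∀ {u} → u ∈ t → p u ≡ true → u ∈ t′) → Filtered p t

  filter : ∀ p t → Valid t → Filtered p t
  filter p (leaf v) _ with p v in eq
  ... | true  = some (leaf v) tt (λ { refl → refl , eq }) (λ u∈ _ → u∈)
  ... | false = none λ { refl → eq }
  filter p (node b l r) (vl , vr , c) with filter p l vl | filter p r vr
  ... | none nl | none nr = none [ nl , nr ]′
  ... | none nl | some r′ v′ sub sup = some r′ v′ (λ u∈ → inj₂ (proj₁ (sub u∈)) , proj₂ (sub u∈))
        λ { (inj₁ u∈l) e → ⊥-elim (true≢false e (nl u∈l)) ; (inj₂ u∈r) e → sup u∈r e }
  ... | some l′ v′ sub sup | none nr = some l′ v′ (λ u∈ → inj₁ (proj₁ (sub u∈)) , proj₂ (sub u∈))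
        λ { (inj₁ u∈l) e → sup u∈l e ; (inj₂ u∈r) e → ⊥-elim (true≢false e (nr u∈r)) }
  ... | some l′ vl′ subl supl | some r′ vr′ subr supr = some (node b l′ r′)
        (vl′ , vr′ , λ u∈ v∈ → c (proj₁ (subl u∈)) (proj₁ (subr v∈)))
        (λ { (inj₁ u∈) → inj₁ (proj₁ (subl u∈)) , proj₂ (subl u∈) ; (inj₂ u∈) → inj₂ (proj₁ (subr u∈)) , proj₂ (subr u∈) })
        λ { (inj₁ u∈) e → inj₁ (supl u∈ e) ; (inj₂ u∈) e → inj₂ (supr u∈ e) }

  attach : ∀ b {p l} → Filtered p l → ∀ t → Valid t → (∀ {z u} → z ∈ l → p z ≡ true → u ∈ t → z ≢ u × adj G z u ≡ b) →
    Σ[ t′ ∈ Tree G ] Valid t′ × (∀ {u} → u ∈ t → u ∈ t′) × (∀ {u} → u ∈ l → p u ≡ true → u ∈ t′)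
      × (∀ {u} → u ∈ t′ → u ∈ t ⊎ u ∈ l)
  attach b (none nl) t v _ = t , v , id , (λ u∈l e → ⊥-elim (true≢false e (nl u∈l))) , inj₁
  attach b (some l′ v′ sub sup) t v c = node b l′ t , (v′ , v , λ z∈ u∈ → c (proj₁ (sub z∈)) (proj₂ (sub z∈)) u∈) ,
    inj₂ , (λ u∈ e → inj₁ (sup u∈ e)) , λ { (inj₁ u∈) → inj₂ (proj₁ (sub u∈)) ; (inj₂ u∈) → inj₁ u∈ }

  module _ (noP4 : NoP4 G) where

    -- P₄ is self-complementary, so G and its complement are treated alike.
    no-alternating-P4 : ∀ b z x v y → adj G z x ≡ not b → adj G x v ≡ not b → adj G v y ≡ not b →
      adj G z v ≡ b → adj G x y ≡ b → adj G z y ≡ b → ⊥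
    no-alternating-P4 false z x v y zx xv vy zv xy zy = noP4 z x v y zx xv vy zv zy xy
    -- The complement of the path z - x - v - y is the path v - z - y - x.
    no-alternating-P4 true z x v y zx xv vy zv xy zy =
      noP4 v z y x (trans (sym G v z) zv) zy (trans (sym G y x) xy) vy (trans (sym G v x) xv) zx

    Inserted : V G → Tree G → Set
    Inserted v t = Σ[ t′ ∈ Tree G ] Valid t′ × v ∈ t′ × (∀ {u} → u ∈ t → u ∈ t′) × (∀ {u} → u ∈ t′ → u ≡ v ⊎ u ∈ t)

    -- If v is not uniform to either child of a b-node, the vertices joined to v by ¬b stay together with v, and
    -- P₄-freeness joins all the others to them by b.
    insert : ∀ v t → Valid t → ¬ v ∈ t → Inserted v t
    insert v (leaf w) _ v∉ = node (adj G v w) (leaf v) (leaf w) , (tt , tt , λ { refl refl → v∉ , refl }) , inj₁ refl , inj₂ , id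
    insert v (node b l r) (vl , vr , c) v∉ = go (filter p l vl) (filter p r vr)
      where
      p p̄ : V G → Bool
      p u = does (adj G v u Bool.≟ not b)
      p̄ u = not (p u)
      p-true : ∀ {u} → p u ≡ true → adj G v u ≡ not b
      p-true {u} e with adj G v u Bool.≟ not b
      ... | yes q = q
      ... | no _  = contradiction e λ ()
      p-false : ∀ {u} → p u ≡ false → adj G v u ≡ b
      p-false {u} e with adj G v u Bool.≟ not b
      ... | yes _ = contradiction e λ ()
      ... | no ¬q = trans (Bool.¬-not ¬q) (Bool.not-involutive b)
      p̄-true : ∀ {u} → p̄ u ≡ true → adj G u v ≡ b
      p̄-true {u} e = trans (sym G u v) (p-false (not-true e))
      go : Filtered p l → Filtered p r → Inserted v (node b l r)
      -- Here `v` is joined by `b` to all of `l`, so it can be inserted below `r`.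
      go (none nl) _ with insert v r vr (v∉ ∘ inj₂)
      ... | r′ , vr′ , v∈ , sup , sub = node b l r′ , (vl , vr′ , cross) , inj₂ v∈ , Data.Sum.map₂ sup ,
            λ { (inj₁ u∈) → inj₂ (inj₁ u∈) ; (inj₂ u∈) → Data.Sum.map₂ inj₂ (sub u∈) }
        where
        cross : Cross b l r′
        cross u∈l w∈ with sub w∈
        ... | inj₁ refl = (λ { refl → v∉ (inj₁ u∈l) }) , trans (sym G _ _) (p-false (nl u∈l))
        ... | inj₂ w∈r  = c u∈l w∈r
      go (some _ _ _ _) (none nr) with insert v l vl (v∉ ∘ inj₁)
      ... | l′ , vl′ , v∈ , sup , sub = node b l′ r , (vl′ , vr , cross) , inj₁ v∈ , Data.Sum.map₁ sup ,
            λ { (inj₂ u∈) → inj₂ (inj₂ u∈) ; (inj₁ u∈) → Data.Sum.map₂ inj₁ (sub u∈) }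
        where
        cross : Cross b l′ r
        cross w∈ u∈r with sub w∈
        ... | inj₁ refl = (λ { refl → v∉ (inj₂ u∈r) }) , p-false (nr u∈r)
        ... | inj₂ w∈l  = c w∈l u∈r
      go (some l₂ vl₂ subl supl) (some r₂ vr₂ subr supr) = t₂ , valid₂ , sup₂ (sup₁ (inj₁ refl)) , sup , sub
        where
        cr = cross-sym {b} {l} {r} c
        t₀ : Tree G
        t₀ = node (not b) (leaf v) (node b l₂ r₂)
        lr₂⊆ : ∀ {u} → u ∈ node b l₂ r₂ → u ∈ node b l r × p u ≡ true
        lr₂⊆ (inj₁ u∈) = inj₁ (proj₁ (subl u∈)) , proj₂ (subl u∈)
        lr₂⊆ (inj₂ u∈) = inj₂ (proj₁ (subr u∈)) , proj₂ (subr u∈)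
        valid₀ : Valid t₀
        valid₀ = tt , (vl₂ , vr₂ , λ u∈ w∈ → c (proj₁ (subl u∈)) (proj₁ (subr w∈))) ,
          λ { refl u∈ → (λ { refl → v∉ (proj₁ (lr₂⊆ u∈)) }) , p-true (proj₂ (lr₂⊆ u∈)) }
        -- Otherwise z, x, v, y is an alternating P₄. The vertex `y` is taken from the other child,
        -- so its relation to `x` and `z` is `b`; this is where both restrictions must be non-empty.
        separated : ∀ {z x y} → p̄ z ≡ true → p x ≡ true → p y ≡ true → adj G x y ≡ b → adj G z y ≡ b →
                    z ≢ x × adj G z x ≡ b
        separated {z} {x} {y} p̄z px py xy zy = (λ { refl → true≢false px (not-true p̄z) }) , adj-b
          where
          adj-b : adj G z x ≡ b
          adj-b with adj G z x Bool.≟ b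
          ... | yes e = e
          ... | no ¬e = ⊥-elim (no-alternating-P4 b z x v y (Bool.¬-not ¬e) (trans (sym G x v) (p-true px)) (p-true py)
                  (p̄-true p̄z) xy zy)
        crossl : ∀ {z u} → z ∈ l → p̄ z ≡ true → u ∈ t₀ → z ≢ u × adj G z u ≡ b
        crossl z∈ p̄z (inj₁ refl) = (λ { refl → v∉ (inj₁ z∈) }) , p̄-true p̄z
        crossl z∈ p̄z (inj₂ (inj₁ u∈)) with subl u∈ | subr (root∈ r₂)
        ... | u∈l , pu | y∈r , py = separated p̄z pu py (proj₂ (c u∈l y∈r)) (proj₂ (c z∈ y∈r))
        crossl z∈ p̄z (inj₂ (inj₂ u∈)) = c z∈ (proj₁ (subr u∈))
        a₁ = attach b (filter p̄ l vl) t₀ valid₀ crossl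
        t₁ = proj₁ a₁
        valid₁ = proj₁ (proj₂ a₁)
        sup₁ : ∀ {u} → u ∈ t₀ → u ∈ t₁
        sup₁ = proj₁ (proj₂ (proj₂ a₁))
        supl₁ : ∀ {u} → u ∈ l → p̄ u ≡ true → u ∈ t₁
        supl₁ = proj₁ (proj₂ (proj₂ (proj₂ a₁)))
        sub₁ : ∀ {u} → u ∈ t₁ → u ∈ t₀ ⊎ u ∈ l
        sub₁ = proj₂ (proj₂ (proj₂ (proj₂ a₁)))
        crossr : ∀ {z u} → z ∈ r → p̄ z ≡ true → u ∈ t₁ → z ≢ u × adj G z u ≡ b
        crossr z∈ p̄z u∈ with sub₁ u∈
        ... | inj₂ u∈l = cr z∈ u∈l
        ... | inj₁ (inj₁ refl) = (λ { refl → v∉ (inj₂ z∈) }) , p̄-true p̄z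
        ... | inj₁ (inj₂ (inj₁ u∈)) = cr z∈ (proj₁ (subl u∈))
        ... | inj₁ (inj₂ (inj₂ u∈)) with subr u∈ | subl (root∈ l₂)
        ...   | u∈r , pu | y∈l , py = separated p̄z pu py (proj₂ (cr u∈r y∈l)) (proj₂ (cr z∈ y∈l))
        a₂ = attach b (filter p̄ r vr) t₁ valid₁ crossr
        t₂ = proj₁ a₂
        valid₂ = proj₁ (proj₂ a₂)
        sup₂ : ∀ {u} → u ∈ t₁ → u ∈ t₂
        sup₂ = proj₁ (proj₂ (proj₂ a₂))
        supr₂ : ∀ {u} → u ∈ r → p̄ u ≡ true → u ∈ t₂
        supr₂ = proj₁ (proj₂ (proj₂ (proj₂ a₂)))
        sub₂ : ∀ {u} → u ∈ t₂ → u ∈ t₁ ⊎ u ∈ r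
        sub₂ = proj₂ (proj₂ (proj₂ (proj₂ a₂)))
        sup : ∀ {u} → u ∈ node b l r → u ∈ t₂
        sup {u} u∈ with bool-cases (p u)
        sup (inj₁ u∈) | inj₁ e = sup₂ (sup₁ (inj₂ (inj₁ (supl u∈ e))))
        sup (inj₂ u∈) | inj₁ e = sup₂ (sup₁ (inj₂ (inj₂ (supr u∈ e))))
        sup (inj₁ u∈) | inj₂ e = sup₂ (supl₁ u∈ (cong not e))
        sup (inj₂ u∈) | inj₂ e = supr₂ u∈ (cong not e)
        sub : ∀ {u} → u ∈ t₂ → u ≡ v ⊎ u ∈ node b l r
        sub u∈ with sub₂ u∈
        ... | inj₂ u∈r = inj₂ (inj₂ u∈r)
        ... | inj₁ u∈₁ with sub₁ u∈₁
        ...   | inj₂ u∈l = inj₂ (inj₁ u∈l)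
        ...   | inj₁ (inj₁ e) = inj₁ e
        ...   | inj₁ (inj₂ u∈₂) = inj₂ (proj₁ (lr₂⊆ u∈₂))

    cover-tree : ∀ {m} (f : Fin (suc m) → V G) → Σ[ t ∈ Tree G ] Valid t × (∀ i → f i ∈ t)
    cover-tree {zero}  f = leaf (f zero) , tt , λ { zero → refl }
    cover-tree {suc m} f with cover-tree (f ∘ suc)
    ... | t , vt , cov with f zero ∈? t
    ...   | yes f₀∈ = t , vt , λ { zero → f₀∈ ; (suc i) → cov i }
    ...   | no f₀∉ with insert (f zero) t vt f₀∉
    ...     | t′ , vt′ , f₀∈ , sup , _ = t′ , vt′ , λ { zero → f₀∈ ; (suc i) → sup (cov i) }

cotree : ∀ {G} → NoP4 G → V G → Σ[ t ∈ Tree G ] Valid t × (∀ v → v ∈ t)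
cotree {record { n = suc m }} noP4 _ = cover-tree noP4 id

-- Recognising clusters, split graphs and monopolar joins on a cotree

module _ {G : Graph} where

  record Contains (t : Tree G) (F : Graph) : Set where
    constructor _at_
    field
      copy   : F ↪ G
      inside : ∀ i → fn copy i ∈ t

  Indep Clique : Tree G → Set
  Indep t  = ∀ {u v} → u ∈ t → v ∈ t → adj G u v ≡ false
  Clique t = ∀ {u v} → u ∈ t → v ∈ t → u ≢ v → adj G u v ≡ true

  Cluster Split : Tree G → Set
  Cluster t = Pol G (_∈ t) (fin 0) ∞
  Split t   = Pol G (_∈ t) (fin 1) (fin 1)

  containsˡ : ∀ {b l r F} → Contains l F → Contains (node b l r) F
  containsˡ (e at e∈) = e at (inj₁ ∘ e∈)

  containsʳ : ∀ {b l r F} → Contains r F → Contains (node b l r) F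
  containsʳ (e at e∈) = e at (inj₂ ∘ e∈)

  contains-K1 : ∀ t → Contains t (K 1)
  contains-K1 t = emb (λ _ → root t) (λ { {0F} {0F} _ → refl }) (λ { 0F 0F → irrefl G (root t) }) at λ _ → root∈ t

  contains-+ : ∀ {l r F H} → Cross false l r → Contains l F → Contains r H → Contains (node false l r) (F +ᴳ H)
  contains-+ {l} {r} c (e at e∈) (f at f∈) = +-emb e f (λ x y → proj₁ (c (e∈ x) (f∈ y))) (λ x y → proj₂ (c (e∈ x) (f∈ y))) at
    copair-elim e f (_∈ node false l r) (inj₁ ∘ e∈) (inj₂ ∘ f∈)

  contains-⊕ : ∀ {l r F H} → Cross true l r → Contains l F → Contains r H → Contains (node true l r) (F ⊕ H)
  contains-⊕ {l} {r} c (e at e∈) (f at f∈) = ⊕-emb e f (λ x y → proj₂ (c (e∈ x) (f∈ y))) at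
    copair-elim e f (_∈ node true l r) (inj₁ ∘ e∈) (inj₂ ∘ f∈)

  swap-node : ∀ {b l r F} → Contains (node b r l) F → Contains (node b l r) F
  swap-node (e at e∈) = e at (Data.Sum.swap ∘ e∈)

  indep-node : ∀ {l r} → Cross false l r → Indep l → Indep r → Indep (node false l r)
  indep-node {l} {r} c il ir (inj₁ u∈) (inj₁ v∈) = il u∈ v∈
  indep-node {l} {r} c il ir (inj₂ u∈) (inj₂ v∈) = ir u∈ v∈
  indep-node {l} {r} c il ir (inj₁ u∈) (inj₂ v∈) = proj₂ (c u∈ v∈)
  indep-node {l} {r} c il ir (inj₂ u∈) (inj₁ v∈) = proj₂ (cross-sym {G} {false} {l} {r} c u∈ v∈)

  edge? : ∀ t → Valid t → Indep t ⊎ Contains t K2′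
  edge? (leaf v) _ = inj₁ λ { refl refl → irrefl G v }
  edge? (node true l r) (_ , _ , c) = inj₂ (contains-⊕ c (contains-K1 l) (contains-K1 r))
  edge? (node false l r) (vl , vr , c) with edge? l vl | edge? r vr
  ... | inj₂ e  | _       = inj₂ (containsˡ e)
  ... | inj₁ _  | inj₂ e  = inj₂ (containsʳ e)
  ... | inj₁ il | inj₁ ir = inj₁ (indep-node c il ir)

  clique-node : ∀ {l r} → Cross true l r → Clique l → Clique r → Clique (node true l r)
  clique-node {l} {r} c kl kr (inj₁ u∈) (inj₁ v∈) = kl u∈ v∈
  clique-node {l} {r} c kl kr (inj₂ u∈) (inj₂ v∈) = kr u∈ v∈
  clique-node {l} {r} c kl kr (inj₁ u∈) (inj₂ v∈) _ = proj₂ (c u∈ v∈)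
  clique-node {l} {r} c kl kr (inj₂ u∈) (inj₁ v∈) _ = proj₂ (cross-sym {G} {true} {l} {r} c u∈ v∈)

  nonedge? : ∀ t → Valid t → Clique t ⊎ Contains t 2K1
  nonedge? (leaf v) _ = inj₁ λ { refl refl u≢v → ⊥-elim (u≢v refl) }
  nonedge? (node false l r) (_ , _ , c) = inj₂ (contains-+ c (contains-K1 l) (contains-K1 r))
  nonedge? (node true l r) (vl , vr , c) with nonedge? l vl | nonedge? r vr
  ... | inj₂ e  | _       = inj₂ (containsˡ e)
  ... | inj₁ _  | inj₂ e  = inj₂ (containsʳ e)
  ... | inj₁ kl | inj₁ kr = inj₁ (clique-node c kl kr)

  ¬clique∧2K1 : ∀ {t} → Clique t → ¬ Contains t 2K1
  ¬clique∧2K1 k (e at e∈) = true≢false (k (e∈ 0F) (e∈ 1F) λ eq → contradiction (inj e eq) λ ()) (adj-pres e 0F 1F)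

  ¬indep∧K2 : ∀ {t} → Indep t → ¬ Contains t K2′
  ¬indep∧K2 i (e at e∈) = true≢false (adj-pres e 0F 1F) (i (e∈ 0F) (e∈ 1F))

  -- Only the root matters. In a join the non-edge lies within one child and any vertex of the other
  -- child completes P₃; in a disjoint union an edge and a vertex of the other child give K₁ + K₂.
  mixed : ∀ t → Valid t → Contains t K2′ → Contains t 2K1 → Contains t P3′ ⊎ Contains t (K 1 +ᴳ K2′)
  mixed (leaf v) vt e _ = ⊥-elim (¬indep∧K2 {leaf v} (λ { refl refl → irrefl G v }) e)
  mixed t@(node true l r) vt@(vl , vr , c) _ ne with nonedge? l vl | nonedge? r vr
  ... | inj₂ e  | _       = inj₁ (swap-node (contains-⊕ (cross-sym {G} {true} {l} {r} c) (contains-K1 r) e))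
  ... | inj₁ _  | inj₂ e  = inj₁ (contains-⊕ c (contains-K1 l) e)
  ... | inj₁ kl | inj₁ kr = ⊥-elim (¬clique∧2K1 (clique-node c kl kr) ne)
  mixed t@(node false l r) vt@(vl , vr , c) ed _ with edge? l vl | edge? r vr
  ... | inj₂ e  | _       = inj₂ (swap-node (contains-+ (cross-sym {G} {false} {l} {r} c) (contains-K1 r) e))
  ... | inj₁ _  | inj₂ e  = inj₂ (contains-+ c (contains-K1 l) e)
  ... | inj₁ il | inj₁ ir = ⊥-elim (¬indep∧K2 {t} (indep-node c il ir) ed)

  Pol-node : ∀ {b s k} {l r : Tree G} → Cross b l r → (stl str : V G → State) →
    (∀ {u} → u ∈ l → Bounded s k (stl u)) → (∀ {u} → u ∈ r → Bounded s k (str u)) →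
    Compatible G (_∈ l) stl → Compatible G (_∈ r) str → (∀ {u v} → u ∈ l → v ∈ r → Compat (stl u) (str v) b) →
    Pol G (_∈ node b l r) s k
  Pol-node {b} {s} {k} {l} {r} c stl str bl br cl cr cross = pol state bound compat
    where
    state : V G → State
    state u with u ∈? l
    ... | yes _ = stl u
    ... | no _  = str u
    state-l : ∀ {u} → u ∈ l → state u ≡ stl u
    state-l {u} u∈ with u ∈? l
    ... | yes _ = refl
    ... | no u∉ = ⊥-elim (u∉ u∈)
    state-r : ∀ {u} → u ∈ r → state u ≡ str u
    state-r {u} u∈r with u ∈? l
    ... | yes u∈l = ⊥-elim (proj₁ (c u∈l u∈r) refl)
    ... | no _    = refl
    bound : ∀ u → u ∈ node b l r → Bounded s k (state u)
    bound u (inj₁ u∈) = subst (Bounded s k) (≡-sym (state-l u∈)) (bl u∈)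
    bound u (inj₂ u∈) = subst (Bounded s k) (≡-sym (state-r u∈)) (br u∈)
    compat : Compatible G (_∈ node b l r) state
    compat u v (inj₁ u∈) (inj₁ v∈) u≢v rewrite state-l u∈ | state-l v∈ = cl u v u∈ v∈ u≢v
    compat u v (inj₂ u∈) (inj₂ v∈) u≢v rewrite state-r u∈ | state-r v∈ = cr u v u∈ v∈ u≢v
    compat u v (inj₁ u∈) (inj₂ v∈) u≢v rewrite state-l u∈ | state-r v∈ | proj₂ (c u∈ v∈) = cross u∈ v∈
    compat u v (inj₂ u∈) (inj₁ v∈) u≢v rewrite state-r u∈ | state-l v∈ | sym G u v | proj₂ (c v∈ u∈) =
      compat-sym (stl v) (str u) (cross v∈ u∈)

  Pol-swap : ∀ {s k} b (l r : Tree G) → Pol G (_∈ node b r l) s k → Pol G (_∈ node b l r) s k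
  Pol-swap _ _ _ = restrict (λ _ → Data.Sum.swap)

  indep-A0 : ∀ {t} → Indep t → Compatible G (_∈ t) (λ _ → A 0)
  indep-A0 i u v u∈ v∈ _ = (λ e → ⊥-elim (true≢false e (i u∈ v∈))) , (λ _ → refl)

  clique-B0 : ∀ {t} → Clique t → Compatible G (_∈ t) (λ _ → B 0)
  clique-B0 k u v u∈ v∈ u≢v = (λ _ → refl) , (λ e → ⊥-elim (true≢false (k u∈ v∈ u≢v) e))

  clique⇒cluster : ∀ {t} → Clique t → Cluster t
  clique⇒cluster k = pol (λ _ → B 0) (λ _ _ → tt) (clique-B0 k)

  indep⇒cluster : ∀ {t} → Indep t → Cluster t
  indep⇒cluster i = pol (λ u → B (toℕ u)) (λ _ _ → tt)
    (λ u v u∈ v∈ u≢v → (λ e → ⊥-elim (true≢false e (i u∈ v∈))) , (λ _ e → u≢v (Fin.toℕ-injective e)))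

  -- Unbounded colours are kept apart by parity. Thinness puts the A-vertices of both sides into one
  -- common part.
  ∞-+ : ∀ {s} {l r : Tree G} → Thin s → Cross false l r →
        Pol G (_∈ l) s ∞ → Pol G (_∈ r) s ∞ → Pol G (_∈ node false l r) s ∞
  ∞-+ {s} thin c p q = Pol-node c (even ∘ st p) (odd ∘ st q)
    (λ {u} u∈ → even-bound (st p u) (bnd p u u∈)) (λ {u} u∈ → odd-bound (st q u) (bnd q u u∈))
    (λ u v u∈ v∈ u≢v → even-compat (st p u) (st p v) (cmp p u v u∈ v∈ u≢v))
    (λ u v u∈ v∈ u≢v → odd-compat (st q u) (st q v) (cmp q u v u∈ v∈ u≢v))
    (λ {u} {v} u∈ v∈ → even-odd (st p u) (st q v) (bnd p u u∈) (bnd q v v∈))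
    where
    even odd : State → State
    even (A c) = A c
    even (B d) = B (2 * d)
    odd (A c) = A c
    odd (B d) = B (suc (2 * d))
    even-bound : ∀ x → Bounded s ∞ x → Bounded s ∞ (even x)
    even-bound (A _) b = b
    even-bound (B _) _ = tt
    odd-bound : ∀ x → Bounded s ∞ x → Bounded s ∞ (odd x)
    odd-bound (A _) b = b
    odd-bound (B _) _ = tt
    even-compat : ∀ x y {b} → Compat x y b → Compat (even x) (even y) b
    even-compat (A _) (A _) p = p
    even-compat (A _) (B _) p = tt
    even-compat (B _) (A _) p = tt
    even-compat (B d) (B d′) (p , q) = (λ e → cong (2 *_) (p e)) , (λ e f → q e (ℕ.*-cancelˡ-≡ d d′ 2 f))
    odd-compat : ∀ x y {b} → Compat x y b → Compat (odd x) (odd y) b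
    odd-compat (A _) (A _) p = p
    odd-compat (A _) (B _) p = tt
    odd-compat (B _) (A _) p = tt
    odd-compat (B d) (B d′) (p , q) = (λ e → cong (λ m → suc (2 * m)) (p e)) ,
      (λ e f → q e (ℕ.*-cancelˡ-≡ d d′ 2 (ℕ.suc-injective f)))
    even-odd : ∀ x y → Bounded s ∞ x → Bounded s ∞ y → Compat (even x) (odd y) false
    even-odd (A _) (A _) b b′ = (λ ()) , (λ _ → thin b b′)
    even-odd (A _) (B _) _ _ = tt
    even-odd (B _) (A _) _ _ = tt
    even-odd (B d) (B d′) _ _ = (λ ()) , (λ _ → ℕ.even≢odd d d′)

  clique⊕split : ∀ {l r} → Cross true l r → Clique l → Split r → Split (node true l r)
  clique⊕split c k q = Pol-node c (λ _ → B 0) (st q) (λ _ → s≤s z≤n) (bnd q _) (clique-B0 k) (cmp q)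
    (λ {u} {v} _ v∈ → B0-compat (st q v) (bnd q v v∈))
    where
    B0-compat : ∀ x → Bounded (fin 1) (fin 1) x → Compat (B 0) x true
    B0-compat (A _) _ = tt
    B0-compat (B zero) _ = (λ _ → refl) , λ ()
    B0-compat (B (suc _)) (s≤s ())

  indep+split : ∀ {l r} → Cross false l r → Indep l → Split r → Split (node false l r)
  indep+split c i q = Pol-node c (λ _ → A 0) (st q) (λ _ → s≤s z≤n) (bnd q _) (indep-A0 i) (cmp q)
    (λ {u} {v} _ v∈ → A0-thin (st q v) (bnd q v v∈))

  cluster? : ∀ t → Valid t → Cluster t ⊎ Contains t P3′
  cluster? (leaf v) _ = inj₁ (indep⇒cluster λ { refl refl → irrefl G v })
  cluster? (node false l r) (vl , vr , c) with cluster? l vl | cluster? r vr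
  ... | inj₂ e | _      = inj₂ (containsˡ e)
  ... | inj₁ _ | inj₂ e = inj₂ (containsʳ e)
  ... | inj₁ p | inj₁ q = inj₁ (∞-+ thin0 c p q)
  cluster? t@(node true l r) (vl , vr , c) with nonedge? l vl | nonedge? r vr
  ... | inj₂ e  | _       = inj₂ (swap-node (contains-⊕ (cross-sym {G} {true} {l} {r} c) (contains-K1 r) e))
  ... | inj₁ _  | inj₂ e  = inj₂ (contains-⊕ c (contains-K1 l) e)
  ... | inj₁ kl | inj₁ kr = inj₁ (clique⇒cluster {t} (clique-node c kl kr))

  -- The Földes-Hammer theorem for cographs, where C₅ cannot occur because it contains P₄. Edges on
  -- both sides of a union form 2K₂; non-edges on both sides of a join form C₄.
  split? : ∀ t → Valid t → Split t ⊎ (Contains t C4 ⊎ Contains t 2K2′)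
  split? (leaf v) _ = inj₁ (pol (λ _ → A 0) (λ _ _ → s≤s z≤n) (indep-A0 {leaf v} λ { refl refl → irrefl G v }))
  split? (node false l r) (vl , vr , c) with edge? l vl | edge? r vr
  ... | inj₂ e | inj₂ f = inj₂ (inj₂ (contains-+ c e f))
  ... | inj₁ i | _ with split? r vr
  ...   | inj₁ q        = inj₁ (indep+split c i q)
  ...   | inj₂ (inj₁ e) = inj₂ (inj₁ (containsʳ e))
  ...   | inj₂ (inj₂ e) = inj₂ (inj₂ (containsʳ e))
  split? (node false l r) (vl , vr , c) | inj₂ _ | inj₁ i with split? l vl
  ...   | inj₁ q        = inj₁ (Pol-swap false l r (indep+split (cross-sym {G} {false} {l} {r} c) i q))
  ...   | inj₂ (inj₁ e) = inj₂ (inj₁ (containsˡ e))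
  ...   | inj₂ (inj₂ e) = inj₂ (inj₂ (containsˡ e))
  split? (node true l r) (vl , vr , c) with nonedge? l vl | nonedge? r vr
  ... | inj₂ e | inj₂ f = inj₂ (inj₁ (contains-⊕ c e f))
  ... | inj₁ k | _ with split? r vr
  ...   | inj₁ q        = inj₁ (clique⊕split c k q)
  ...   | inj₂ (inj₁ e) = inj₂ (inj₁ (containsʳ e))
  ...   | inj₂ (inj₂ e) = inj₂ (inj₂ (containsʳ e))
  split? (node true l r) (vl , vr , c) | inj₂ _ | inj₁ k with split? l vl
  ...   | inj₁ q        = inj₁ (Pol-swap true l r (clique⊕split (cross-sym {G} {true} {l} {r} c) k q))
  ...   | inj₂ (inj₁ e) = inj₂ (inj₁ (containsˡ e))
  ...   | inj₂ (inj₂ e) = inj₂ (inj₂ (containsˡ e))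

  -- Why K₁ ⊕ t is monopolar, or what makes it non-monopolar.
  data ConeStatus (t : Tree G) : Set where
    isCluster : Cluster t → ConeStatus t
    isSplit   : Split t → ConeStatus t
    hasC4     : Contains t C4 → ConeStatus t
    hasCone   : Contains t (K 1 ⊕ 2K2′) → ConeStatus t
    hasP3+K2  : Contains t (P3′ +ᴳ K2′) → ConeStatus t

  swapCone : ∀ {b l r} → ConeStatus (node b r l) → ConeStatus (node b l r)
  swapCone {b} {l} {r} (isCluster p) = isCluster (Pol-swap b l r p)
  swapCone {b} {l} {r} (isSplit p)   = isSplit (Pol-swap b l r p)
  swapCone (hasC4 e)     = hasC4 (swap-node e)
  swapCone (hasCone e)   = hasCone (swap-node e)
  swapCone (hasP3+K2 e)  = hasP3+K2 (swap-node e)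

  indep+cone : ∀ {l r} → Cross false l r → Indep l → ConeStatus r → ConeStatus (node false l r)
  indep+cone c i (isCluster p) = isCluster (∞-+ thin0 c (indep⇒cluster i) p)
  indep+cone c i (isSplit p)   = isSplit (indep+split c i p)
  indep+cone c i (hasC4 e)     = hasC4 (containsʳ e)
  indep+cone c i (hasCone e)   = hasCone (containsʳ e)
  indep+cone c i (hasP3+K2 e)  = hasP3+K2 (containsʳ e)

  clique⊕cone : ∀ {l r} → Cross true l r → Clique l → Valid r → ConeStatus (node true l r)
  clique⊕cone {l} {r} c k vr with split? r vr
  ... | inj₁ q        = isSplit (clique⊕split c k q)
  ... | inj₂ (inj₁ e) = hasC4 (containsʳ e)
  ... | inj₂ (inj₂ e) = hasCone (contains-⊕ c (contains-K1 l) e)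

  -- An edgeless side of a union is harmless: it can be added to any outcome. If both sides have an
  -- edge, a P₃ on either side completes P₃ + K₂, and without one both sides are clusters.
  cone? : ∀ t → Valid t → ConeStatus t
  cone? (leaf v) _ = isCluster (indep⇒cluster λ { refl refl → irrefl G v })
  cone? (node true l r) (vl , vr , c) with nonedge? l vl | nonedge? r vr
  ... | inj₂ e | inj₂ f = hasC4 (contains-⊕ c e f)
  ... | inj₁ k | _      = clique⊕cone c k vr
  ... | inj₂ _ | inj₁ k = swapCone (clique⊕cone (cross-sym {G} {true} {l} {r} c) k vl)
  cone? (node false l r) (vl , vr , c) with edge? l vl | edge? r vr
  ... | inj₁ i | _      = indep+cone c i (cone? r vr)
  ... | inj₂ _ | inj₁ i = swapCone (indep+cone (cross-sym {G} {false} {l} {r} c) i (cone? l vl))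
  ... | inj₂ e | inj₂ f with cluster? l vl | cluster? r vr
  ...   | inj₂ p | _      = hasP3+K2 (contains-+ c p f)
  ...   | inj₁ _ | inj₂ q = hasP3+K2 (swap-node (contains-+ (cross-sym {G} {false} {l} {r} c) q e))
  ...   | inj₁ p | inj₁ q = isCluster (∞-+ thin0 c p q)

  -- An independent A lies on one side of a join, so B contains the other side. Either B meets the
  -- first side too and, being a join, is a single clique, or the first side equals A.
  data JoinStatus (l r : Tree G) : Set where
    split        : Split (node true l r) → JoinStatus l r
    indepCluster : Indep l → Cluster r → JoinStatus l r
    clusterIndep : Cluster l → Indep r → JoinStatus l r
    forbidden    : ∀ {F} → Forbidden F → Contains (node true l r) F → JoinStatus l r

  swapJoin : ∀ {l r} → JoinStatus r l → JoinStatus l r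
  swapJoin {l} {r} (split p)  = split (Pol-swap true l r p)
  swapJoin (indepCluster i p) = clusterIndep p i
  swapJoin (clusterIndep p i) = indepCluster i p
  swapJoin (forbidden f e)    = forbidden f (swap-node e)

  -- If `l` has two vertices, a P₃ in `r` completes `forb₁`. If `l` is a single vertex, the join is
  -- a cone and `cone?` decides.
  indep-join : ∀ {l r} → Cross true l r → Valid l → Valid r → Indep l → JoinStatus l r
  indep-join {l} {r} c vl vr i with nonedge? l vl
  ... | inj₂ e with cluster? r vr
  ...   | inj₁ p = indepCluster i p
  ...   | inj₂ f = forbidden forb₁ (contains-⊕ c e f)
  indep-join {l} {r} c vl vr i | inj₁ k with cone? r vr
  ... | isCluster p = indepCluster i p
  ... | isSplit p   = split (clique⊕split c k p)
  ... | hasC4 e     = forbidden forb₂ (contains-⊕ c (contains-K1 l) e)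
  ... | hasCone e   = forbidden forb₄ (contains-⊕ c (contains-K1 l) e)
  ... | hasP3+K2 e  = forbidden forb₆ (contains-⊕ c (contains-K1 l) e)

  clique-join : ∀ {l r} → Cross true l r → Valid r → Clique l → Contains l K2′ → JoinStatus l r
  clique-join {l} {r} c vr k e with split? r vr
  ... | inj₁ q        = split (clique⊕split c k q)
  ... | inj₂ (inj₁ f) = forbidden forb₂ (contains-⊕ c (contains-K1 l) f)
  ... | inj₂ (inj₂ f) = forbidden forb₃ (contains-⊕ c e f)

  -- The last case has an edge and a non-edge on both sides. A P₃ on one side meets a non-edge on
  -- the other and gives `forb₁`; otherwise both sides contain K₁ + K₂, which gives `forb₅`.
  join-status : ∀ l r → Cross true l r → Valid l → Valid r → JoinStatus l r
  join-status l r c vl vr with edge? l vl | edge? r vr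
  ... | inj₁ i | _      = indep-join c vl vr i
  ... | inj₂ _ | inj₁ i = swapJoin (indep-join (cross-sym {G} {true} {l} {r} c) vr vl i)
  ... | inj₂ e | inj₂ f with nonedge? l vl | nonedge? r vr
  ...   | inj₁ k | _      = clique-join c vr k e
  ...   | inj₂ _ | inj₁ k = swapJoin (clique-join (cross-sym {G} {true} {l} {r} c) vl k f)
  ...   | inj₂ e′ | inj₂ f′ with mixed l vl e e′ | mixed r vr f f′
  ...     | inj₁ p | _      = swapJoin (forbidden forb₁ (contains-⊕ (cross-sym {G} {true} {l} {r} c) f′ p))
  ...     | inj₂ _ | inj₁ q = forbidden forb₁ (contains-⊕ c e′ q)
  ...     | inj₂ p | inj₂ q = forbidden forb₅ (contains-⊕ c p q)

-- Colour classes of clusters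

A? : ∀ x → (∃ λ c → x ≡ A c) ⊎ (∃ λ d → x ≡ B d)
A? (A c) = inj₁ (c , refl)
A? (B d) = inj₂ (d , refl)

isA? : ∀ x → Dec (∃ λ c → x ≡ A c)
isA? (A c) = yes (c , refl)
isA? (B _) = no λ ()

B-injective : ∀ {d d′} → B d ≡ B d′ → d ≡ d′
B-injective refl = refl

≟-B : ∀ x d → Dec (x ≡ B d)
≟-B (A _) d = no λ ()
≟-B (B e) d with e ℕ.≟ d
... | yes refl = yes refl
... | no e≢d   = no (e≢d ∘ B-injective)

module _ {G : Graph} {S : V G → Set} {k : Bound} (p : Pol G S (fin 0) k) where

  cluster-B : ∀ {u} → S u → ∃ λ d → st p u ≡ B d
  cluster-B {u} su with A? (st p u)
  ... | inj₁ (c , e) = ⊥-elim (ℕ.n≮0 (bnd-A p su e))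
  ... | inj₂ b = b

  same-colour⇒adj : ∀ {u v d} → S u → S v → u ≢ v → st p u ≡ B d → st p v ≡ B d → adj G u v ≡ true
  same-colour⇒adj {u} {v} su sv u≢v eu ev with bool-cases (adj G u v)
  ... | inj₁ e = e
  ... | inj₂ e = ⊥-elim (proj₂ (cmp-BB p su sv u≢v eu ev) e refl)

  other-colour⇒apart : ∀ {u v d d′} → S u → S v → st p u ≡ B d → st p v ≡ B d′ → d ≢ d′ → u ≢ v × adj G u v ≡ false
  other-colour⇒apart {u} {v} su sv eu ev d≢d′ = u≢v , nonadj
    where
    u≢v : u ≢ v
    u≢v refl = d≢d′ (B-injective (trans (≡-sym eu) ev))
    nonadj : adj G u v ≡ false
    nonadj with bool-cases (adj G u v)
    ... | inj₁ e = ⊥-elim (d≢d′ (proj₁ (cmp-BB p su sv u≢v eu ev) e))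
    ... | inj₂ e = e

  cluster-trans : ∀ {u v w} → S u → S v → S w → adj G u v ≡ true → adj G v w ≡ true → u ≢ w → adj G u w ≡ true
  cluster-trans {u} {v} {w} su sv sw uv vw u≢w with bool-cases (adj G u w)
  ... | inj₁ e = e
  ... | inj₂ e = ⊥-elim (P3⇒¬cluster u v w su sv sw uv vw e u≢w p)

record TwoEach {G : Graph} {S : V G → Set} {s t} (p : Pol G S s (fin t)) : Set where
  field
    r      : Fin t → Fin 2 → V G
    r-in   : ∀ i a → S (r i a)
    r-col  : ∀ i a → st p (r i a) ≡ B (toℕ i)
    r-diff : ∀ i → r i 0F ≢ r i 1F

module _ {G : Graph} {S : V G → Set} {s : Bound} {t : ℕ} (S? : ∀ u → Dec (S u)) (p : Pol G S s (fin t)) where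

  private
    InClass : Fin t → V G → Set
    InClass i u = S u × st p u ≡ B (toℕ i)

    inClass? : ∀ i u → Dec (InClass i u)
    inClass? i u = S? u ×-dec ≟-B (st p u) (toℕ i)

    Two : Fin t → Set
    Two i = ∃ λ u → ∃ λ v → InClass i u × InClass i v × u ≢ v

    two? : ∀ i → Dec (Two i)
    two? i = Fin.any? λ u → Fin.any? λ v → inClass? i u ×-dec (inClass? i v ×-dec ¬? (u Fin.≟ v))

    two-each : (∀ i → Two i) → TwoEach p
    two-each two = record { r = r ; r-in = λ i a → proj₁ (r-class i a) ; r-col = λ i a → proj₂ (r-class i a)
      ; r-diff = λ i → proj₂ (proj₂ (proj₂ (proj₂ (two i)))) }
      where
      r : Fin t → Fin 2 → V G
      r i 0F = proj₁ (two i)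
      r i 1F = proj₁ (proj₂ (two i))
      r-class : ∀ i a → InClass i (r i a)
      r-class i 0F = proj₁ (proj₂ (proj₂ (two i)))
      r-class i 1F = proj₁ (proj₂ (proj₂ (proj₂ (two i))))

  -- The dichotomy behind every saving of a clique: a class with at most one vertex can be moved to
  -- A, whereas two vertices in each class of a cluster give an induced tK₂.
  small-class :
    (Σ[ i ∈ Fin t ] (∀ {u v} → S u → S v → st p u ≡ B (toℕ i) → st p v ≡ B (toℕ i) → u ≡ v)) ⊎ TwoEach p
  small-class with Fin.all? two?
  ... | yes two = inj₂ (two-each two)
  ... | no ¬two with Fin.¬∀⟶∃¬ t Two two? ¬two
  ...   | i , ¬twoᵢ = inj₁ (i , unique)
    where
    unique : ∀ {u v} → S u → S v → st p u ≡ B (toℕ i) → st p v ≡ B (toℕ i) → u ≡ v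
    unique {u} {v} su sv eu ev with u Fin.≟ v
    ... | yes e = e
    ... | no ne = ⊥-elim (¬twoᵢ (u , v , (su , eu) , (sv , ev) , ne))

module _ {G : Graph} {S : V G → Set} {t : ℕ} {p : Pol G S (fin 0) (fin t)} (two : TwoEach p) where
  open TwoEach two

  r-edge : ∀ i → adj G (r i 0F) (r i 1F) ≡ true
  r-edge i = same-colour⇒adj p (r-in i 0F) (r-in i 1F) (r-diff i) (r-col i 0F) (r-col i 1F)

  r-apart : ∀ {i j} → i ≢ j → ∀ a b → r i a ≢ r j b × adj G (r i a) (r j b) ≡ false
  r-apart i≢j a b = other-colour⇒apart p (r-in _ a) (r-in _ b) (r-col _ a) (r-col _ b) (i≢j ∘ Fin.toℕ-injective)

-- A single part contains at most one vertex of each K₂, so `j + 1` copies need `j + 1` cliques.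
¬Pol-plus2-suc : ∀ j C → ¬ Pol (plus2 (suc j) C) All (fin 1) (fin j)
¬Pol-plus2-suc (suc j) C p = ¬Pol-plus2-suc j C (peel thin1 p)
¬Pol-plus2-suc zero C p with A? (st p (0F ↑ˡ n C)) | A? (st p (1F ↑ˡ n C))
... | inj₂ (_ , e) | _ = ℕ.n≮0 (bnd-B p tt e)
... | inj₁ _ | inj₂ (_ , e) = ℕ.n≮0 (bnd-B p tt e)
... | inj₁ (_ , e) | inj₁ (_ , f) = proj₁ (cmp-AA p tt tt (λ ()) e f) refl (thin1 (bnd-A p tt e) (bnd-A p tt f))

empty-emb : ∀ {G} → emptyG ↪ G
empty-emb = emb (λ ()) (λ { {()} }) (λ ())

one-in-B : ∀ {G S k} (p : Pol G S (fin 1) k) {u v} → S u → S v → adj G u v ≡ true →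
           (∃ λ d → st p u ≡ B d) ⊎ (∃ λ d → st p v ≡ B d)
one-in-B {G} p {u} {v} su sv uv with A? (st p u) | A? (st p v)
... | inj₂ b | _ = inj₁ b
... | inj₁ _ | inj₂ b = inj₂ b
... | inj₁ (_ , e) | inj₁ (_ , f) = ⊥-elim (proj₁ (cmp-AA p su sv (adj⇒≢ G uv) e f) uv (thin1 (bnd-A p su e) (bnd-A p sv f)))

-- Minimal (1,j)-obstructions of the form independent set ⊕ cluster

module IndepJoinCluster {G : Graph} {j : ℕ} (1≤j : 1 ≤ j) (¬p : ¬ Pol G All (fin 1) (fin j))
  (off-pol : ∀ v → Pol G (Off v) (fin 1) (fin j)) {x y : Tree G} (vx : Valid x) (vy : Valid y) (c : Cross true x y)
  (cover : ∀ v → v ∈ x ⊎ v ∈ y) (ix : Indep x) (cy : Cluster y) where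

  private
    c′ : Cross true y x
    c′ = cross-sym {G} {true} {x} {y} c

    xy : ∀ {u v} → u ∈ x → v ∈ y → adj G u v ≡ true
    xy u∈ v∈ = proj₂ (c u∈ v∈)

    ¬split : ¬ Split (node true x y)
    ¬split q = ¬p (relaxʳ 1≤j (restrict (λ u _ → cover u) q))

    -- The closed neighbourhood of `a`; within the cluster `y` it is the clique of `a`.
    Near : V G → V G → Set
    Near a u = u ≡ a ⊎ adj G a u ≡ true

    near? : ∀ a u → Dec (Near a u)
    near? a u = (u Fin.≟ a) ⊎-dec (adj G a u Bool.≟ true)

    near-near : ∀ {a u v} → a ∈ y → u ∈ y → v ∈ y → Near a u → Near a v → u ≢ v → adj G u v ≡ true
    near-near a∈ u∈ v∈ (inj₁ refl) (inj₁ refl) u≢v = ⊥-elim (u≢v refl)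
    near-near a∈ u∈ v∈ (inj₁ refl) (inj₂ e) _ = e
    near-near a∈ u∈ v∈ (inj₂ e) (inj₁ refl) _ = trans (sym G _ _) e
    near-near a∈ u∈ v∈ (inj₂ e) (inj₂ f) u≢v = cluster-trans cy u∈ a∈ v∈ (trans (sym G _ _) e) f u≢v

    near-adj : ∀ {a u v} → a ∈ y → u ∈ y → v ∈ y → Near a u → adj G u v ≡ true → Near a v
    near-adj a∈ u∈ v∈ (inj₁ refl) e = inj₂ e
    near-adj {a} {u} {v} a∈ u∈ v∈ (inj₂ e) f with v Fin.≟ a
    ... | yes v≡a = inj₁ v≡a
    ... | no v≢a  = inj₂ (cluster-trans cy a∈ u∈ v∈ e f (v≢a ∘ ≡-sym))

    near-sym : ∀ {a u} → Near a u → Near u a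
    near-sym (inj₁ e) = inj₁ (≡-sym e)
    near-sym (inj₂ e) = inj₂ (trans (sym G _ _) e)

    near-trans : ∀ {a u v} → a ∈ y → u ∈ y → v ∈ y → Near a u → Near u v → Near a v
    near-trans a∈ u∈ v∈ a-u (inj₁ refl) = a-u
    near-trans a∈ u∈ v∈ a-u (inj₂ e) = near-adj a∈ u∈ v∈ a-u e

    extend : ∀ {v} → v ∈ y → (p : Pol G (Off v) (fin 1) (fin j)) → (∀ {u} → u ∈ y → u ≢ v → ∃ λ d → st p u ≡ B d) →
             Pol G (_∈ y) (fin 0) (fin (suc j))
    extend {v} v∈ p allB = pol state bound compat
      where
      Colour : ℕ → Set
      Colour d = d < suc j × (∀ {u e} → u ∈ y → u ≢ v → st p u ≡ B e → Compat (B d) (B e) (adj G v u))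
      colour : ∃ Colour
      colour with Fin.any? (λ w → (w ∈? y) ×-dec (¬? (w Fin.≟ v) ×-dec (adj G v w Bool.≟ true)))
      -- Without neighbours in `y`, the vertex `v` takes the fresh colour `j`; otherwise it copies
      -- the colour of a neighbour.
      ... | no absent = j , ℕ.≤-refl , λ {u} u∈ u≢v e → (λ vu → ⊥-elim (absent (u , u∈ , u≢v , vu))) ,
              (λ { _ refl → ℕ.<-irrefl refl (bnd-B p u≢v e) })
      ... | yes (w , w∈ , w≢v , vw) with allB w∈ w≢v
      ...   | d , ew = d , ℕ.m<n⇒m<1+n (bnd-B p w≢v ew) , compat-w
        where
        wv : adj G w v ≡ true
        wv = trans (sym G w v) vw
        compat-w : ∀ {u e} → u ∈ y → u ≢ v → st p u ≡ B e → Compat (B d) (B e) (adj G v u)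
        compat-w {u} u∈ u≢v eu with u Fin.≟ w
        ... | yes refl = (λ _ → B-injective (trans (≡-sym ew) eu)) , (λ nvw → ⊥-elim (true≢false vw nvw))
        ... | no u≢w = (λ vu → proj₁ cw (cluster-trans cy w∈ v∈ u∈ wv vu (u≢w ∘ ≡-sym))) , nonadj
          where
          cw = cmp-BB p w≢v u≢v (u≢w ∘ ≡-sym) ew eu
          nonadj : adj G v u ≡ false → d ≢ _
          nonadj nvu with bool-cases (adj G w u)
          ... | inj₁ wu = ⊥-elim (true≢false (cluster-trans cy v∈ w∈ u∈ vw wu (u≢v ∘ ≡-sym)) nvu)
          ... | inj₂ nwu = proj₂ cw nwu
      state : V G → State
      state u with u Fin.≟ v
      ... | yes _ = B (proj₁ colour)
      ... | no _  = st p u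
      bound : ∀ u → u ∈ y → Bounded (fin 0) (fin (suc j)) (state u)
      bound u u∈ with u Fin.≟ v
      ... | yes _ = proj₁ (proj₂ colour)
      ... | no u≢v with allB u∈ u≢v
      ...   | d , eu = subst (Bounded (fin 0) (fin (suc j))) (≡-sym eu) (ℕ.m<n⇒m<1+n (bnd-B p u≢v eu))
      compat : Compatible G (_∈ y) state
      compat u w u∈ w∈ u≢w with u Fin.≟ v | w Fin.≟ v
      ... | yes refl | yes refl = ⊥-elim (u≢w refl)
      ... | no u≢v | no w≢v = cmp p u w u≢v w≢v u≢w
      ... | yes refl | no w≢v with allB w∈ w≢v
      ...   | d , ew rewrite ew = proj₂ (proj₂ colour) w∈ w≢v ew
      compat u w u∈ w∈ u≢w | no u≢v | yes refl with allB u∈ u≢v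
      ...   | d , eu rewrite eu | sym G u v = compat-sym (B (proj₁ colour)) (B d) (proj₂ (proj₂ colour) u∈ u≢v eu)

    -- In a partition of `G - v`, an A-vertex in `y` is adjacent to all of `x` and forces `x` into
    -- B. If that is refuted, `y - v` lies in B, and `v` costs at most one more clique.
    bound-from : ∀ {v} → v ∈ y → ((p : Pol G (Off v) (fin 1) (fin j)) → (∀ {z} → z ∈ x → ∃ λ d → st p z ≡ B d) → ⊥) →
                 Pol G (_∈ y) (fin 0) (fin (suc j))
    bound-from {v} v∈ refuter
      with Fin.any? (λ u → (u ∈? y) ×-dec (¬? (u Fin.≟ v) ×-dec isA? (st (off-pol v) u)))
    ... | no absent = extend v∈ (off-pol v) allB
      where
      allB : ∀ {u} → u ∈ y → u ≢ v → ∃ λ d → st (off-pol v) u ≡ B d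
      allB {u} u∈ u≢v with A? (st (off-pol v) u)
      ... | inj₁ a = ⊥-elim (absent (u , u∈ , u≢v , a))
      ... | inj₂ b = b
    ... | yes (u , u∈ , u≢v , _ , eu) = ⊥-elim (refuter (off-pol v) xB)
      where
      xB : ∀ {z} → z ∈ x → ∃ λ d → st (off-pol v) z ≡ B d
      xB {z} z∈ with one-in-B (off-pol v) (proj₁ (c z∈ v∈)) u≢v (xy z∈ u∈)
      ... | inj₁ b = b
      ... | inj₂ (_ , eu′) = contradiction (trans (≡-sym eu) eu′) λ ()

    -- A vertex of y in B forces everything of x in B into its own clique.
    share : ∀ {v} → v ∈ y → (p : Pol G (Off v) (fin 1) (fin j)) → ∀ {z u d e} → z ∈ x → u ∈ y → u ≢ v →
            st p z ≡ B d → st p u ≡ B e → d ≡ e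
    share v∈ p z∈ u∈ u≢v ez eu = proj₁ (cmp-BB p (proj₁ (c z∈ v∈)) u≢v (proj₁ (c z∈ u∈)) ez eu) (xy z∈ u∈)

  -- It remains to choose `v` so that `x` cannot lie in B. If `y` is edgeless, any `v` will do,
  -- since moving `y` to A would give a partition of `G`. A clique of `y` with an edge keeps a
  -- vertex in B, whose clique then absorbs `x`; this fails if `x` has a non-edge or if a second
  -- such clique survives. In the other cases `G` is split, or `y` has only two cliques.
  few-cliques : Pol G (_∈ y) (fin 0) (fin (suc j))
  few-cliques with edge? y vy
  ... | inj₁ iy = bound-from (root∈ y) λ p xB → ¬p (restrict (λ u _ → cover u)
        (Pol-node c (st p) (λ _ → A 0) (λ z∈ → bnd p _ (off-v z∈)) (λ _ → s≤s z≤n)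
          (λ u v u∈ v∈ → cmp p u v (off-v u∈) (off-v v∈)) (indep-A0 iy) (λ z∈ _ → B-A0 (xB z∈))))
    where
    off-v : ∀ {z} → z ∈ x → z ≢ root y
    off-v z∈ = proj₁ (c z∈ (root∈ y))
    B-A0 : ∀ {s} → (∃ λ d → s ≡ B d) → Compat s (A 0) true
    B-A0 (_ , refl) = tt
  ... | inj₂ (e at e∈) with Fin.any? (λ w → (w ∈? y) ×-dec ¬? (near? (fn e 0F) w))
  ...   | no absent = ⊥-elim (¬split (Pol-swap true x y (clique⊕split c′ clique
            (pol (λ _ → A 0) (λ _ _ → s≤s z≤n) (indep-A0 ix)))))
    where
    near-e : ∀ {u} → u ∈ y → Near (fn e 0F) u
    near-e {u} u∈ with near? (fn e 0F) u
    ... | yes nr = nr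
    ... | no ¬nr = ⊥-elim (absent (u , u∈ , ¬nr))
    clique : Clique y
    clique u∈ v∈ = near-near (e∈ 0F) u∈ v∈ (near-e u∈) (near-e v∈)
  ...   | yes (w , w∈ , w-far) = go (nonedge? x vx)
    where
    a = fn e 0F
    a∈ = e∈ 0F
    edge-in-B : ∀ {v f g} (p : Pol G (Off v) (fin 1) (fin j)) → f ∈ y → g ∈ y → adj G f g ≡ true → ¬ Near f v →
                Σ[ h ∈ V G ] h ∈ y × h ≢ v × Near f h × ∃ λ d → st p h ≡ B d
    edge-in-B {v} {f} {g} p f∈ g∈ fg far
      with one-in-B p {f} {g} (λ { refl → far (inj₁ refl) }) (λ { refl → far (inj₂ fg) }) fg
    ... | inj₁ b = f , f∈ , (λ { refl → far (inj₁ refl) }) , inj₁ refl , b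
    ... | inj₂ b = g , g∈ , (λ { refl → far (inj₂ fg) }) , inj₂ fg , b
    go : Clique x ⊎ Contains x 2K1 → Pol G (_∈ y) (fin 0) (fin (suc j))
    go (inj₂ (f at f∈)) = bound-from w∈ refuter
      where
      refuter : (p : Pol G (Off w) (fin 1) (fin j)) → (∀ {z} → z ∈ x → ∃ λ d → st p z ≡ B d) → ⊥
      refuter p xB with edge-in-B p a∈ (e∈ 1F) (adj-pres e 0F 1F) w-far | xB (f∈ 0F) | xB (f∈ 1F)
      ... | h , h∈ , h≢w , _ , _ , eh | _ , e₀ | _ , e₁ =
        proj₂ (cmp-BB p (proj₁ (c (f∈ 0F) w∈)) (proj₁ (c (f∈ 1F) w∈)) (λ eq → contradiction (inj f eq) λ ()) e₀ e₁)
          (adj-pres f 0F 1F) (trans (share w∈ p (f∈ 0F) h∈ h≢w e₀ eh) (≡-sym (share w∈ p (f∈ 1F) h∈ h≢w e₁ eh)))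
    go (inj₁ kx) with Fin.any? (λ f → Fin.any? λ g → ((f ∈? y) ×-dec (g ∈? y)) ×-dec
                        ((adj G f g Bool.≟ true) ×-dec ¬? (near? a f)))
    -- All edges of `y` lie in the clique of `a`, so that clique and the rest form a split partition
    -- of `y`.
    ... | no absent = ⊥-elim (¬split (clique⊕split c kx (pol state bound compat)))
      where
      state : V G → State
      state u with near? a u
      ... | yes _ = B 0
      ... | no _  = A 0
      bound : ∀ u → u ∈ y → Bounded (fin 1) (fin 1) (state u)
      bound u _ with near? a u
      ... | yes _ = s≤s z≤n
      ... | no _  = s≤s z≤n
      compat : Compatible G (_∈ y) state
      compat u v u∈ v∈ u≢v with near? a u | near? a v
      ... | yes _ | no _  = tt
      ... | no _  | yes _ = tt
      ... | yes p | yes q = (λ _ → refl) , (λ e → ⊥-elim (true≢false (near-near a∈ u∈ v∈ p q u≢v) e))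
      ... | no ¬p | no _  = (λ uv → ⊥-elim (absent (u , v , (u∈ , v∈) , uv , ¬p))) , (λ _ → refl)
    ... | yes (f , g , (f∈ , g∈) , fg , f-far)
      with Fin.any? (λ h → (h ∈? y) ×-dec (¬? (near? a h) ×-dec ¬? (near? f h)))
    ...   | no absent = relaxʳ (s≤s 1≤j) (pol state bound compat)
      where
      near-f : ∀ {u} → u ∈ y → ¬ Near a u → Near f u
      near-f {u} u∈ ¬a with near? f u
      ... | yes nr = nr
      ... | no ¬f = ⊥-elim (absent (u , u∈ , ¬a , ¬f))
      state : V G → State
      state u with near? a u
      ... | yes _ = B 0
      ... | no _  = B 1
      bound : ∀ u → u ∈ y → Bounded (fin 0) (fin 2) (state u)
      bound u _ with near? a u
      ... | yes _ = s≤s z≤n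
      ... | no _  = s≤s (s≤s z≤n)
      compat : Compatible G (_∈ y) state
      compat u v u∈ v∈ u≢v with near? a u | near? a v
      ... | yes p | yes q = (λ _ → refl) , (λ e → ⊥-elim (true≢false (near-near a∈ u∈ v∈ p q u≢v) e))
      ... | no ¬p | no ¬q = (λ _ → refl) ,
            (λ e → ⊥-elim (true≢false (near-near f∈ u∈ v∈ (near-f u∈ ¬p) (near-f v∈ ¬q) u≢v) e))
      ... | yes p | no ¬q = (λ uv → ⊥-elim (¬q (near-adj a∈ u∈ v∈ p uv))) , λ _ ()
      ... | no ¬p | yes q = (λ uv → ⊥-elim (¬p (near-adj a∈ v∈ u∈ q (trans (sym G v u) uv)))) , λ _ ()
    ...   | yes (h , h∈ , h-far-a , h-far-f) = bound-from h∈ refuter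
      where
      -- The single vertex of `x` would share its clique with vertices from two different cliques of
      -- `y`.
      refuter : (p : Pol G (Off h) (fin 1) (fin j)) → (∀ {z} → z ∈ x → ∃ λ d → st p z ≡ B d) → ⊥
      refuter p xB with edge-in-B p a∈ (e∈ 1F) (adj-pres e 0F 1F) h-far-a | edge-in-B p f∈ g∈ fg h-far-f | xB (root∈ x)
      ... | u , u∈ , u≢h , a-u , _ , eu | v , v∈ , v≢h , f-v , _ , ev | _ , ez = clash
        where
        far : ¬ Near u v
        far u-v = f-far (near-trans a∈ v∈ f∈ (near-trans a∈ u∈ v∈ a-u u-v) (near-sym f-v))
        nonadj : adj G u v ≡ false
        nonadj with bool-cases (adj G u v)
        ... | inj₁ uv = ⊥-elim (far (inj₂ uv))
        ... | inj₂ e′ = e′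
        clash : ⊥
        clash = proj₂ (cmp-BB p u≢h v≢h (λ { refl → far (inj₁ refl) }) eu ev) nonadj
          (trans (≡-sym (share h∈ p (root∈ x) u∈ u≢h ez eu)) (share h∈ p (root∈ x) v∈ v≢h ez ev))

  mono-suc : Pol G All (fin 1) (fin (suc j))
  mono-suc = restrict (λ u _ → cover u) (Pol-node c (λ _ → A 0) (st q) (λ _ → s≤s z≤n) (λ {u} u∈ → widen (st q u) (bnd q u u∈))
    (indep-A0 ix) (cmp q) (λ _ v∈ → A0-B (cluster-B q v∈)))
    where
    q = few-cliques
    widen : ∀ s → Bounded (fin 0) (fin (suc j)) s → Bounded (fin 1) (fin (suc j)) s
    widen (B _) b = b
    A0-B : ∀ {s} → (∃ λ d → s ≡ B d) → Compat (A 0) s true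
    A0-B (_ , refl) = tt

  -- A = x together with one vertex of each clique of y; some clique of y is a single vertex, for otherwise
  -- y would contain (j+1)K₂, which survives the deletion of a vertex of x.
  multipartite : Pol G All ∞ (fin j)
  multipartite with small-class (_∈? y) few-cliques
  ... | inj₂ two = ⊥-elim (¬Pol-plus2-suc j emptyG (pull f
          (λ u _ → f-elim (_≢ root x) (λ i a → proj₁ (c′ (r-in i a) (root∈ x))) (λ ()) u) (off-pol (root x))))
    where
    open TwoEach two
    f,elim = plus2-emb empty-emb (record { edge = r-edge two ; apart = r-apart two ; apartᶜ = λ _ _ () })
    f = proj₁ f,elim
    f-elim = proj₂ f,elim
  ... | inj₁ (i , unique) = dropColour big (Fin.toℕ<n i) avoids
    where
    q = few-cliques
    Later : V G → Set
    -- The representatives moved to A are the lowest-numbered vertices of their cliques. They get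
    -- part 1, as `x` occupies part 0.
    Later u = ∃ λ w → w ∈ y × toℕ w < toℕ u × st q w ≡ st q u
    later? : ∀ u → Dec (Later u)
    later? u = Fin.any? λ w → (w ∈? y) ×-dec ((toℕ w ℕ.<? toℕ u) ×-dec same? (st q w) (st q u))
      where
      same? : ∀ s s′ → Dec (s ≡ s′)
      same? (A m) (A m′) with m ℕ.≟ m′
      ... | yes refl = yes refl
      ... | no ne = no λ { refl → ne refl }
      same? (A _) (B _) = no λ ()
      same? (B _) (A _) = no λ ()
      same? (B m) (B m′) with m ℕ.≟ m′
      ... | yes refl = yes refl
      ... | no ne = no λ { refl → ne refl }
    state : V G → State
    state u with later? u
    ... | yes _ = st q u
    ... | no _  = A 1
    bound : ∀ {u} → u ∈ y → Bounded ∞ (fin (suc j)) (state u)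
    bound {u} u∈ with later? u
    ... | no _ = tt
    ... | yes _ with cluster-B q u∈
    ...   | d , eu = subst (Bounded ∞ (fin (suc j))) (≡-sym eu) (bnd-B q u∈ eu)
    first-apart : ∀ {u v} → u ∈ y → v ∈ y → u ≢ v → ¬ Later u → ¬ Later v → adj G u v ≡ false
    first-apart {u} {v} u∈ v∈ u≢v ¬u ¬v with bool-cases (adj G u v)
    ... | inj₂ e = e
    ... | inj₁ uv with cluster-B q u∈ | cluster-B q v∈
    ...   | d , eu | d′ , ev with proj₁ (cmp-BB q u∈ v∈ u≢v eu ev) uv
    ...     | refl with ℕ.<-cmp (toℕ u) (toℕ v)
    ...       | tri< lt _ _ = ⊥-elim (¬v (u , u∈ , lt , trans eu (≡-sym ev)))
    ...       | tri≈ _ eq _ = ⊥-elim (u≢v (Fin.toℕ-injective eq))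
    ...       | tri> _ _ gt = ⊥-elim (¬u (v , v∈ , gt , trans ev (≡-sym eu)))
    compat : Compatible G (_∈ y) state
    compat u v u∈ v∈ u≢v with later? u | later? v
    ... | yes _ | yes _ = cmp q u v u∈ v∈ u≢v
    ... | no ¬u | no ¬v = (λ uv → ⊥-elim (true≢false uv (first-apart u∈ v∈ u≢v ¬u ¬v))) , (λ _ → refl)
    ... | yes _ | no _ with cluster-B q u∈
    ...   | _ , eu rewrite eu = tt
    compat u v u∈ v∈ u≢v | no _ | yes _ with cluster-B q v∈
    ...   | _ , ev rewrite ev = tt
    cross : ∀ {u v} → u ∈ x → v ∈ y → Compat (A 0) (state v) true
    cross {v = v} _ v∈ with later? v
    ... | no _ = (λ _ ()) , λ ()
    ... | yes _ with cluster-B q v∈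
    ...   | _ , ev rewrite ev = tt
    joined : Pol G (_∈ node true x y) ∞ (fin (suc j))
    joined = Pol-node c (λ _ → A 0) state (λ _ → tt) bound (indep-A0 ix) compat cross
    big : Pol G All ∞ (fin (suc j))
    big = restrict (λ u _ → cover u) joined
    avoids : ∀ u d → ⊤ → st big u ≡ B d → d ≢ toℕ i
    avoids u d _ eu refl with u ∈? x
    ... | no u∉x with cover u
    ...   | inj₁ u∈x = u∉x u∈x
    ...   | inj₂ u∈y with later? u
    ...     | yes (w , w∈ , lt , eq) = ℕ.<-irrefl (cong toℕ (unique w∈ u∈y (trans eq eu) eu)) lt

-- The root of a cotree, and the classification of connected graphs

Pol-indep : ∀ {G} {S : V G → Set} {k} → (∀ {u v} → S u → S v → adj G u v ≡ false) → Pol G S (fin 1) k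
Pol-indep indep = pol (λ _ → A 0) (λ _ _ → s≤s z≤n)
  (λ u v su sv _ → (λ e → ⊥-elim (true≢false e (indep su sv))) , (λ _ → refl))

record Root (b : Bool) (H : Graph) : Set where
  field
    l r     : Tree H
    l-valid : Valid l
    r-valid : Valid r
    cross   : Cross b l r
    cover   : ∀ v → v ∈ l ⊎ v ∈ r

swapRoot : ∀ {b H} → Root b H → Root b H
swapRoot {b} {H} R = record { l = r ; r = l ; l-valid = r-valid ; r-valid = l-valid
  ; cross = cross-sym {H} {b} {l} {r} cross ; cover = Data.Sum.swap ∘ cover }
  where open Root R

-- A graph with fewer than two vertices is edgeless and hence polar, so the cotree has an inner
-- node.
find-root : ∀ {H k} → NoP4 H → ¬ Pol H All (fin 1) k → ∃ λ b → Root b H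
find-root {H@(record { n = zero })} noP4 ¬p = ⊥-elim (¬p (Pol-indep λ { {()} }))
find-root {H@(record { n = suc _ })} noP4 ¬p with cotree {H} noP4 0F
... | leaf w , _ , cov = ⊥-elim (¬p (Pol-indep λ {u} {v} _ _ →
        trans (cong (adj H u) (trans (cov v) (≡-sym (cov u)))) (irrefl H u)))
... | node b l r , (vl , vr , c) , cov = b , record { l = l ; r = r ; l-valid = vl ; r-valid = vr ; cross = c ; cover = cov }

module _ {H : Graph} (R : Root true H) where
  open Root R

  join-connected : Connected H
  join-connected u v with cover u | cover v
  ... | inj₁ u∈ | inj₂ v∈ = step (proj₂ (cross u∈ v∈)) here
  ... | inj₂ u∈ | inj₁ v∈ = step (trans (sym H u v) (proj₂ (cross v∈ u∈))) here
  ... | inj₁ u∈ | inj₁ v∈ = step (proj₂ (cross u∈ (root∈ r))) (step (trans (sym H _ _) (proj₂ (cross v∈ (root∈ r)))) here)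
  ... | inj₂ u∈ | inj₂ v∈ = step (trans (sym H _ _) (proj₂ (cross (root∈ l) u∈))) (step (proj₂ (cross (root∈ l) v∈)) here)

  join-cluster⇒clique : ∀ {k} → Pol H All (fin 0) k → Pol H All (fin 1) (fin 1)
  join-cluster⇒clique p = pol (λ _ → B 0) (λ _ _ → s≤s z≤n) λ u v _ _ u≢v →
      (λ _ → refl) , (λ e → ⊥-elim (true≢false (same-colour⇒adj p tt tt u≢v (colour u) (colour v)) e))
    where
    joined : ∀ {u v d d′} → adj H u v ≡ true → st p u ≡ B d → st p v ≡ B d′ → d ≡ d′
    joined uv eu ev = proj₁ (cmp-BB p tt tt (adj⇒≢ H uv) eu ev) uv
    colour : ∀ u → st p u ≡ B (proj₁ (cluster-B p {root l} tt))
    colour u with cluster-B p {root l} tt | cluster-B p {root r} tt | cluster-B p {u} tt | cover u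
    ... | _ , el | _ , er | _ , eu | inj₁ u∈ = trans eu (cong B
            (trans (joined (proj₂ (cross u∈ (root∈ r))) eu er) (≡-sym (joined (proj₂ (cross (root∈ l) (root∈ r))) el er))))
    ... | _ , el | _ , er | _ , eu | inj₂ u∈ = trans eu (cong B (≡-sym (joined (proj₂ (cross (root∈ l) u∈)) el eu)))

  indepCluster⇒mono : Indep l → Cluster r → Pol H All (fin 1) ∞
  indepCluster⇒mono il q = restrict (λ u _ → cover u) (Pol-node cross (λ _ → A 0) (st q) (λ _ → s≤s z≤n)
    (λ {u} u∈ → subst (Bounded (fin 1) ∞) (≡-sym (proj₂ (cluster-B q u∈))) tt) (indep-A0 il) (cmp q)
    (λ _ v∈ → subst (λ s → Compat (A 0) s true) (≡-sym (proj₂ (cluster-B q v∈))) tt))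

¬union-connected : ∀ {H} → Root false H → ¬ Connected H
¬union-connected {H} R conn = proj₁ (cross (stay (conn (root l) (root r)) (root∈ l)) (root∈ r)) refl
  where
  open Root R
  stay : ∀ {u v} → Reach H u v → u ∈ l → v ∈ l
  stay here u∈ = u∈
  stay (step {w = w} uw path) u∈ with cover w
  ... | inj₁ w∈ = stay path w∈
  ... | inj₂ w∈ = ⊥-elim (true≢false uw (proj₂ (cross u∈ w∈)))

↪-minimal⇒≅ : ∀ {F H s k} → F ↪ H → ¬ Pol F All s k → (∀ v → Pol H (Off v) s k) → F ≅ H
↪-minimal⇒≅ e ¬p off with onto-or-missed (fn e)
... | inj₁ onto = ↪-onto⇒≅ e onto
... | inj₂ (v , missed) = ⊥-elim (¬p (pull e (λ i _ → missed i) (off v)))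

Off-≅ : ∀ {F H s k} (i : F ≅ H) → (∀ v → Pol F (Off v) s k) → ∀ v → Pol H (Off v) s k
Off-≅ i off v = pull h (λ u u≢v → u≢v ∘ inj h) (off (fn h v))
  where h = ≅⇒↪ (≅-sym i)

data ConnectedStatus (H : Graph) : Set where
  isSplit      : Pol H All (fin 1) (fin 1) → ConnectedStatus H
  isIndepClust : (R : Root true H) → Indep (Root.l R) → Cluster (Root.r R) → ConnectedStatus H
  hasForbidden : ∀ {F} → Forbidden F → F ↪ H → ConnectedStatus H

connected-status : ∀ {H} → Root true H → ConnectedStatus H
connected-status R with join-status (Root.l R) (Root.r R) (Root.cross R) (Root.l-valid R) (Root.r-valid R)
... | split p = isSplit (restrict (λ u _ → Root.cover R u) p)
... | indepCluster il q = isIndepClust R il q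
... | clusterIndep q ir = isIndepClust (swapRoot R) ir q
... | forbidden f (e at _) = hasForbidden f e

-- At a union root each side avoids a vertex of the other, so both are monopolar, and unboundedly
-- many cliques can be combined. At a join root a forbidden graph occurs, and minimality makes it
-- all of `H`.
MinObs-1∞⇒Forbidden : ∀ {H} → MinObs (fin 1) ∞ H → Σ[ F ∈ Graph ] Forbidden F × F ≅ H
MinObs-1∞⇒Forbidden {H} (minObs noP4 ¬p off) with find-root {H} noP4 ¬p
... | false , R = ⊥-elim (¬p (restrict (λ u _ → cover u) (∞-+ thin1 cross
        (restrict (λ u u∈ → proj₁ (cross u∈ (root∈ r))) (off (root r)))
        (restrict (λ u u∈ e → proj₁ (cross (root∈ l) u∈) (≡-sym e)) (off (root l))))))
  where open Root R
... | true , R with connected-status R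
...   | isSplit p = ⊥-elim (¬p (relax∞ p))
...   | isIndepClust R′ il q = ⊥-elim (¬p (indepCluster⇒mono R′ il q))
...   | hasForbidden {F} f e = F , f , ↪-minimal⇒≅ e (ForbiddenFacts.¬monopolar (forbidden-facts f)) off

0⇒1 : ∀ {G S k} → Pol G S (fin 0) k → Pol G S (fin 1) k
0⇒1 = relax (λ ()) id

-- The deletions are (1,2)-polar, hence (1,t)-polar. As `H` is not monopolar, the centre of P₃ is
-- handled by making its leaves two cliques.
MinObs-1∞⇒MinObs : ∀ {t H} → 2 ≤ t → MinObs (fin 1) ∞ H → MinObs ∞ (fin (suc t)) (P 3 +ᴳ H)
MinObs-1∞⇒MinObs {suc (suc t)} {H} (s≤s (s≤s z≤n)) m@(minObs noP4 ¬p off) with MinObs-1∞⇒Forbidden m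
... | F , f , i = Core⇒MinObs
    (mkCore noP4 (¬p ∘ relax∞) (¬p ∘ relax∞ ∘ 0⇒1) (λ v → inj₁ (relaxʳ (s≤s (s≤s z≤n)) (Off-≅ i del₂ v))) (pol∞ (s≤s z≤n)))
    (inj₂ (suc t , refl , pol∞ (s≤s z≤n)))
  where
  open ForbiddenFacts (forbidden-facts f)
  pol∞ : ∀ {k} → 1 ≤ k → Pol H All ∞ (fin k)
  pol∞ 1≤k = relaxʳ 1≤k (pull (≅⇒↪ (≅-sym i)) (λ _ _ → tt) multi₁)

-- A forbidden subgraph would make `H` a minimal (1,∞)-polar obstruction, since its deletions are
-- (1,j)-polar. As `H` is not split either, it is an independent set joined to a cluster.
Core-connected : ∀ {j H} → 1 ≤ j → Connected H → MinObs (fin 1) (fin j) H → ¬ MinObs (fin 1) ∞ H →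
                 Core j H × Pol H All (fin 1) (fin (suc j))
Core-connected {j} {H} 1≤j conn (minObs noP4 ¬p off) ¬m with find-root {H} noP4 ¬p
... | false , R = ⊥-elim (¬union-connected R conn)
... | true , R with connected-status R
...   | isSplit p = ⊥-elim (¬p (relaxʳ 1≤j p))
...   | hasForbidden f e = ⊥-elim (¬m (minObs noP4 (¬monopolar ∘ pull e (λ _ _ → tt)) (relax∞ ∘ off)))
  where open ForbiddenFacts (forbidden-facts f)
...   | isIndepClust R′ il q = mkCore noP4 ¬p (¬p ∘ relaxʳ 1≤j ∘ join-cluster⇒clique R′) (inj₁ ∘ off) multipartite , mono-suc
  where open Root R′
        open IndepJoinCluster 1≤j ¬p off l-valid r-valid cross cover il q

all-or-some : ∀ {m} {X Y : Fin m → Set} → (∀ i → X i ⊎ Y i) → (∀ i → X i) ⊎ ∃ Y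
all-or-some {zero}  f = inj₁ λ ()
all-or-some {suc m} f with f zero | all-or-some (f ∘ suc)
... | inj₂ y | _ = inj₂ (zero , y)
... | inj₁ _ | inj₂ (i , y) = inj₂ (suc i , y)
... | inj₁ x | inj₁ xs = inj₁ λ { zero → x ; (suc i) → xs i }

absorb-small-class : ∀ {G} {S : V G → Set} {t} (p : Pol G S (fin 0) (fin (suc t))) (i : Fin (suc t)) →
  (∀ {u v} → S u → S v → st p u ≡ B (toℕ i) → st p v ≡ B (toℕ i) → u ≡ v) → Pol G S (fin 1) (fin t)
absorb-small-class {G} {S} {t} p i unique = dropColour (pol state bound compat) (Fin.toℕ<n i) avoids
  where
  state : V G → State
  state u with ≟-B (st p u) (toℕ i)
  ... | yes _ = A 0
  ... | no _  = st p u
  bound : ∀ u → S u → Bounded (fin 1) (fin (suc t)) (state u)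
  bound u su with ≟-B (st p u) (toℕ i)
  ... | yes _ = s≤s z≤n
  ... | no _ with cluster-B p su
  ...   | _ , eu = subst (Bounded (fin 1) (fin (suc t))) (≡-sym eu) (bnd-B p su eu)
  compat : Compatible G S state
  compat u v su sv u≢v with ≟-B (st p u) (toℕ i) | ≟-B (st p v) (toℕ i)
  ... | yes eu | yes ev = ⊥-elim (u≢v (unique su sv eu ev))
  ... | no _ | no _ = cmp p u v su sv u≢v
  ... | yes _ | no _ with cluster-B p sv
  ...   | _ , ev rewrite ev = tt
  compat u v su sv u≢v | no _ | yes _ with cluster-B p su
  ...   | _ , eu rewrite eu = tt
  avoids : ∀ u d → S u → state u ≡ B d → d ≢ toℕ i
  avoids u d su eu refl with ≟-B (st p u) (toℕ i)
  ... | no ne = ne eu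

override : ∀ {m} → Fin m → State → (Fin m → State) → Fin m → State
override z s f u with u Fin.≟ z
... | yes _ = s
... | no _  = f u

Pol-override : ∀ {G s k z x} (p : Pol G (Off z) s k) → Bounded s k x →
  (∀ u → u ≢ z → Compat x (st p u) (adj G z u)) → Pol G All s k
Pol-override {G} {s} {k} {z} {x} p bx cx = pol (override z x (st p)) bound compat
  where
  bound : ∀ u → ⊤ → Bounded s k (override z x (st p) u)
  bound u _ with u Fin.≟ z
  ... | yes _  = bx
  ... | no u≢z = bnd p u u≢z
  compat : Compatible G All (override z x (st p))
  compat u v _ _ u≢v with u Fin.≟ z | v Fin.≟ z
  ... | yes refl | yes refl = ⊥-elim (u≢v refl)
  ... | yes refl | no v≢z = cx v v≢z
  ... | no u≢z | yes refl rewrite sym G u z = compat-sym x (st p u) (cx u u≢z)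
  ... | no u≢z | no v≢z = cmp p u v u≢z v≢z u≢v

-- Peeling off K₂ components

record K2Component (H : Graph) : Set where
  field
    w w′   : V H
    ww′    : adj H w w′ ≡ true
    closed : ∀ z → z ≢ w → z ≢ w′ → adj H z w ≡ false × adj H z w′ ≡ false

K2-split : ∀ {H} → K2Component H → Σ[ H′ ∈ Graph ] H ≅ (K 2 +ᴳ H′)
K2-split {H} C = split-component (edge-emb {H} ww′) λ
  { v 0F miss → proj₁ (closed v (miss 0F ∘ ≡-sym) (miss 1F ∘ ≡-sym))
  ; v 1F miss → proj₂ (closed v (miss 0F ∘ ≡-sym) (miss 1F ∘ ≡-sym)) }
  where open K2Component C

module _ {t : ℕ} {H : Graph} (¬m : ¬ Pol H All (fin 1) (fin t)) (off : ∀ v → Pol H (Off v) (fin 1) (fin t))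
         (p : Pol H All ∞ (fin t)) where

  private
    isolated : ∀ w → ¬ (∀ u → adj H w u ≡ false)
    isolated w iso = ¬m (Pol-override (off w) (s≤s z≤n)
      (λ u u≢w → subst (Compat _ _) (≡-sym (iso u)) (A0-thin (st (off w) u) (bnd (off w) u u≢w))))

    -- An adjacent twin `h` in B would allow `z` to be put back with the state of `h`, completing a
    -- partition of `H`.
    twin : ∀ {z h} → adj H z h ≡ true → (∀ u → u ≢ z → u ≢ h → adj H z u ≡ adj H h u) →
           ¬ (∃ λ d → st (off z) h ≡ B d)
    twin {z} {h} zh same (d , eh) = ¬m (Pol-override (off z) (bnd-B (off z) h≢z eh) compat)
      where
      h≢z : h ≢ z
      h≢z e = adj⇒≢ H zh (≡-sym e)
      compat : ∀ u → u ≢ z → Compat (B d) (st (off z) u) (adj H z u)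
      compat u u≢z with u Fin.≟ h
      ... | yes refl rewrite eh = (λ _ → refl) , (λ nzh → ⊥-elim (true≢false zh nzh))
      ... | no u≢h rewrite same u u≢z u≢h = subst (λ s → Compat s (st (off z) u) (adj H h u)) eh
              (cmp (off z) h u h≢z u≢z (u≢h ∘ ≡-sym))

    -- The cliques on this side are components of `H`, and none is a single vertex. A third vertex
    -- `z` besides `w` and `w′` is excluded by deleting it: one end of the edge is then in B and is
    -- a twin of `z`.
    component-in-B : (R : Root false H) → (∀ {u} → u ∈ Root.r R → ∃ λ d → st p u ≡ B d) → K2Component H
    component-in-B R rB with Fin.any? (λ u → adj H (root (Root.r R)) u Bool.≟ true)
    ... | no absent = ⊥-elim (isolated (root r) λ u → nonadj u (bool-cases _))
      where
      open Root R
      nonadj : ∀ u → adj H (root r) u ≡ true ⊎ adj H (root r) u ≡ false → adj H (root r) u ≡ false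
      nonadj u (inj₁ e) = ⊥-elim (absent (u , e))
      nonadj u (inj₂ e) = e
    ... | yes (w′ , ww′) = record { w = w ; w′ = w′ ; ww′ = ww′ ; closed = closed }
      where
      open Root R
      w = root r
      adj-in-r : ∀ {u v} → u ∈ r → adj H u v ≡ true → v ∈ r
      adj-in-r {u} {v} u∈ uv with cover v
      ... | inj₂ v∈ = v∈
      ... | inj₁ v∈ = ⊥-elim (true≢false uv (trans (sym H u v) (proj₂ (cross v∈ u∈))))
      w′∈ : w′ ∈ r
      w′∈ = adj-in-r (root∈ r) ww′
      r-trans : ∀ {a b c} → a ∈ r → adj H a b ≡ true → adj H b c ≡ true → a ≢ c → adj H a c ≡ true
      r-trans {a} {b} {c} a∈ ab bc a≢c with bool-cases (adj H a c)
      ... | inj₁ e = e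
      ... | inj₂ e with rB a∈ | rB (adj-in-r a∈ ab) | rB (adj-in-r (adj-in-r a∈ ab) bc)
      ...   | _ , ea | _ , eb | _ , ec = ⊥-elim (proj₂ (cmp-BB p tt tt a≢c ea ec) e
              (trans (proj₁ (cmp-BB p tt tt (adj⇒≢ H ab) ea eb) ab) (proj₁ (cmp-BB p tt tt (adj⇒≢ H bc) eb ec) bc)))
      same-nbrs : ∀ {z h} → z ∈ r → adj H z h ≡ true → ∀ u → u ≢ z → u ≢ h → adj H z u ≡ adj H h u
      same-nbrs {z} {h} z∈ zh u u≢z u≢h with bool-cases (adj H z u) | bool-cases (adj H h u)
      ... | inj₁ e | inj₁ f = trans e (≡-sym f)
      ... | inj₂ e | inj₂ f = trans e (≡-sym f)
      ... | inj₁ e | inj₂ f = ⊥-elim (true≢false (r-trans (adj-in-r z∈ zh) (trans (sym H h z) zh) e (u≢h ∘ ≡-sym)) f)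
      ... | inj₂ e | inj₁ f = ⊥-elim (true≢false (r-trans z∈ zh f (u≢z ∘ ≡-sym)) e)
      third : ∀ z → z ≢ w → z ≢ w′ → z ∈ r → adj H z w ≡ true → adj H z w′ ≡ true → ⊥
      third z z≢w z≢w′ z∈ zw zw′ with one-in-B (off z) (z≢w ∘ ≡-sym) (z≢w′ ∘ ≡-sym) ww′
      ... | inj₁ b = twin zw (same-nbrs z∈ zw) b
      ... | inj₂ b = twin zw′ (same-nbrs z∈ zw′) b
      closed : ∀ z → z ≢ w → z ≢ w′ → adj H z w ≡ false × adj H z w′ ≡ false
      closed z z≢w z≢w′ with bool-cases (adj H z w) | bool-cases (adj H z w′)
      ... | inj₂ e | inj₂ f = e , f
      ... | inj₁ zw | _ = ⊥-elim (third z z≢w z≢w′ z∈ zw (r-trans z∈ zw ww′ z≢w′))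
        where z∈ = adj-in-r (root∈ r) (trans (sym H w z) zw)
      ... | inj₂ _ | inj₁ zw′ = ⊥-elim (third z z≢w z≢w′ z∈ (r-trans z∈ zw′ (trans (sym H w′ w) ww′) z≢w) zw′)
        where z∈ = adj-in-r w′∈ (trans (sym H w′ z) zw′)

    -- A contains an edge, so it lies on one side of a disconnection.
    other-side-in-B : (R : Root false H) → ∀ {a a′ c c′} → a ∈ Root.l R → st p a ≡ A c → st p a′ ≡ A c′ →
      adj H a a′ ≡ true → ∀ {u} → u ∈ Root.r R → ∃ λ d → st p u ≡ B d
    other-side-in-B R {a} {a′} a∈ ea ea′ aa′ {u} u∈ with A? (st p u)
    ... | inj₂ b = b
    ... | inj₁ (_ , eu) = ⊥-elim (proj₁ (cmp-AA p tt tt (adj⇒≢ H aa′) ea ea′) aa′ (trans (colour a∈ ea) (≡-sym (colour a′∈ ea′))))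
      where
      open Root R
      colour : ∀ {b c} → b ∈ l → st p b ≡ A c → c ≡ _
      colour b∈ eb = proj₂ (cmp-AA p tt tt (proj₁ (cross b∈ u∈)) eb eu) (proj₂ (cross b∈ u∈))
      a′∈ : a′ ∈ l
      a′∈ with cover a′
      ... | inj₁ e = e
      ... | inj₂ e = ⊥-elim (true≢false aa′ (proj₂ (cross a∈ e)))

  -- If A had no edge, it could be merged into one part, against `¬m`. An edge of A confines A to
  -- one side of the root.
  K2-component : Root false H → K2Component H
  K2-component R with Fin.any? (λ a → Fin.any? λ a′ → isA? (st p a) ×-dec (isA? (st p a′) ×-dec (adj H a a′ Bool.≟ true)))
  ... | no absent = ⊥-elim (¬m (merge-A p λ {u} {v} _ _ eu ev → nonadj u v eu ev (bool-cases _)))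
    where
    nonadj : ∀ u v {c c′} → st p u ≡ A c → st p v ≡ A c′ → adj H u v ≡ true ⊎ adj H u v ≡ false → adj H u v ≡ false
    nonadj u v eu ev (inj₁ e) = ⊥-elim (absent (u , v , (_ , eu) , (_ , ev) , e))
    nonadj u v eu ev (inj₂ e) = e
  ... | yes (a , a′ , (_ , ea) , (_ , ea′) , aa′) with Root.cover R a
  ...   | inj₁ a∈ = component-in-B R (other-side-in-B R a∈ ea ea′ aa′)
  ...   | inj₂ a∈ = component-in-B (swapRoot R) (other-side-in-B (swapRoot R) a∈ ea ea′ aa′)

record Peeled (t : ℕ) (H : Graph) : Set where
  field
    m j    : ℕ
    C      : Graph
    m+j    : m + j ≡ t
    1≤j    : 1 ≤ j
    iso    : H ≅ plus2 m C
    joined : Root true C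
    min    : MinObs (fin 1) (fin j) C

-- Each K₂ costs one clique. The budget cannot reach 0: there `H` would have an edge but all its
-- deletions would not, so `H` would be K₂, against `¬c`. Hence the recursion ends at a join.
peel-K2s : ∀ t H → NoP4 H → ¬ Pol H All (fin 1) (fin t) → ¬ Pol H All (fin 0) (fin (suc t)) →
  (∀ v → Pol H (Off v) (fin 1) (fin t)) → Pol H All ∞ (fin t) → Peeled t H
peel-K2s zero H noP4 ¬m ¬c off p with Fin.any? (λ u → Fin.any? λ v → adj H u v Bool.≟ true)
... | no absent = ⊥-elim (¬m (Pol-indep λ {u} {v} _ _ → nonadj u v (bool-cases _)))
  where
  nonadj : ∀ u v → adj H u v ≡ true ⊎ adj H u v ≡ false → adj H u v ≡ false
  nonadj u v (inj₁ e) = ⊥-elim (absent (u , v , e))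
  nonadj u v (inj₂ e) = e
... | yes (a , a′ , aa′) = ⊥-elim (¬c (pol (λ _ → B 0) (λ _ _ → s≤s z≤n)
        λ u v _ _ u≢v → (λ _ → refl) , (λ e → ⊥-elim (true≢false (adjacent (only u) (only v) u≢v) e))))
  where
  only : ∀ u → u ≡ a ⊎ u ≡ a′
  only u with u Fin.≟ a | u Fin.≟ a′
  ... | yes e | _ = inj₁ e
  ... | no _ | yes e = inj₂ e
  ... | no u≢a | no u≢a′ with one-in-B (off u) (u≢a ∘ ≡-sym) (u≢a′ ∘ ≡-sym) aa′
  ...   | inj₁ (_ , e) = ⊥-elim (ℕ.n≮0 (bnd-B (off u) (u≢a ∘ ≡-sym) e))
  ...   | inj₂ (_ , e) = ⊥-elim (ℕ.n≮0 (bnd-B (off u) (u≢a′ ∘ ≡-sym) e))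
  adjacent : ∀ {u v} → u ≡ a ⊎ u ≡ a′ → v ≡ a ⊎ v ≡ a′ → u ≢ v → adj H u v ≡ true
  adjacent (inj₁ refl) (inj₁ refl) u≢v = ⊥-elim (u≢v refl)
  adjacent (inj₁ refl) (inj₂ refl) _ = aa′
  adjacent (inj₂ refl) (inj₁ refl) _ = trans (sym H a′ a) aa′
  adjacent (inj₂ refl) (inj₂ refl) u≢v = ⊥-elim (u≢v refl)
peel-K2s (suc t) H noP4 ¬m ¬c off p with find-root {H} noP4 ¬m
... | true , R = record { m = 0 ; j = suc t ; C = H ; m+j = refl ; 1≤j = s≤s z≤n ; iso = ≅-refl ; joined = R
      ; min = minObs noP4 ¬m off }
... | false , R with K2-split (K2-component ¬m off p R)
...   | H′ , i = record { m = suc Q.m ; j = Q.j ; C = Q.C ; m+j = cong suc Q.m+j ; 1≤j = Q.1≤j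
        ; iso = ≅-trans i (+-congʳ {K 2} Q.iso) ; joined = Q.joined ; min = Q.min }
  where
  K2+H′↪H : K 2 +ᴳ H′ ↪ H
  K2+H′↪H = ≅⇒↪ (≅-sym i)
  H↪K2+H′ : H ↪ K 2 +ᴳ H′
  H↪K2+H′ = ≅⇒↪ i
  ¬m′ : ¬ Pol H′ All (fin 1) (fin t)
  ¬m′ q = ¬m (pull H↪K2+H′ (λ _ _ → tt) (addClique {K 2} {H′} {All} K2-clique q))
  ¬c′ : ¬ Pol H′ All (fin 0) (fin (suc t))
  ¬c′ q = ¬c (pull H↪K2+H′ (λ _ _ → tt) (addClique {K 2} {H′} {All} K2-clique q))
  off′ : ∀ v → Pol H′ (Off v) (fin 1) (fin t)
  off′ v = restrict (λ u u≢v → u≢v ∘ Fin.↑ʳ-injective 2 _ _)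
    (edge-split-thin {K 2} {H′} {Off (2 ↑ʳ v)} {x = 0F} {y = 1F} refl (↑ˡ≢↑ʳ 0F v) (↑ˡ≢↑ʳ 1F v)
      (Off-≅ i off (2 ↑ʳ v)) thin1)
  p′ : Pol H′ All ∞ (fin t)
  p′ with edge-split {K 2} {H′} {All} {x = 0F} {y = 1F} refl tt tt (pull K2+H′↪H (λ _ _ → tt) p)
  ... | inj₁ q = ⊥-elim (¬m′ q)
  ... | inj₂ (inj₁ q) = ⊥-elim (¬c′ q)
  ... | inj₂ (inj₂ q) = q
  module Q = Peeled (peel-K2s t H′ (NoP4-↪ {H′} {H} (↪-trans inr K2+H′↪H) noP4) ¬m′ ¬c′ off′ p′)

-- If A has an edge, that edge is one of the K₂'s, and the other `m` together with the isolated
-- vertex need `m + 1` cliques. If A is independent, each of the `m + 1` edges needs a clique.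
¬Pol-K2s+K1 : ∀ m → ¬ Pol (plus2 (suc m) (K 1)) All ∞ (fin m)
¬Pol-K2s+K1 zero p with A? (st p 0F) | A? (st p 1F) | A? (st p 2F)
... | inj₂ (_ , e) | _ | _ = ℕ.n≮0 (bnd-B p tt e)
... | inj₁ _ | inj₂ (_ , e) | _ = ℕ.n≮0 (bnd-B p tt e)
... | inj₁ _ | inj₁ _ | inj₂ (_ , e) = ℕ.n≮0 (bnd-B p tt e)
... | inj₁ (_ , e₀) | inj₁ (_ , e₁) | inj₁ (_ , e₂) = proj₁ (cmp-AA p tt tt (λ ()) e₀ e₁) refl
  (trans (proj₂ (cmp-AA p tt tt (λ ()) e₀ e₂) refl) (≡-sym (proj₂ (cmp-AA p tt tt (λ ()) e₁ e₂) refl)))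
¬Pol-K2s+K1 (suc m) p
  with edge-split {K 2} {plus2 (suc m) (K 1)} {All} {x = 0F} {y = 1F} refl tt tt p
... | inj₁ q = ¬Pol-plus2-suc m (K 1) q
... | inj₂ (inj₁ q) = ¬Pol-plus2 {K 1} thin0 ¬K1 (suc m) (relaxʳ (s≤s (ℕ.m≤m+n m 0)) q)
  where
  ¬K1 : ¬ Pol (K 1) All (fin 0) (fin 0)
  ¬K1 q with A? (st q 0F)
  ... | inj₁ (_ , e) = ℕ.n≮0 (bnd-A q tt e)
  ... | inj₂ (_ , e) = ℕ.n≮0 (bnd-B q tt e)
... | inj₂ (inj₂ q) = ¬Pol-K2s+K1 m q

path-emb : ∀ {G u v w} → adj G u v ≡ true → adj G v w ≡ true → adj G u w ≡ false → u ≢ w → P 3 ↪ G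
path-emb {G} {u} {v} {w} uv vw uw u≢w = emb f f-inj f-pres
  where
  f : Fin 3 → V G
  f 0F = u
  f 1F = v
  f 2F = w
  f-inj : ∀ {i j} → f i ≡ f j → i ≡ j
  f-inj {0F} {0F} _ = refl
  f-inj {1F} {1F} _ = refl
  f-inj {2F} {2F} _ = refl
  f-inj {0F} {1F} e = ⊥-elim (adj⇒≢ G uv e)
  f-inj {1F} {0F} e = ⊥-elim (adj⇒≢ G uv (≡-sym e))
  f-inj {1F} {2F} e = ⊥-elim (adj⇒≢ G vw e)
  f-inj {2F} {1F} e = ⊥-elim (adj⇒≢ G vw (≡-sym e))
  f-inj {0F} {2F} e = ⊥-elim (u≢w e)
  f-inj {2F} {0F} e = ⊥-elim (u≢w (≡-sym e))
  f-pres : ∀ i j → adj G (f i) (f j) ≡ adj (P 3) i j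
  f-pres 0F 0F = irrefl G u
  f-pres 0F 1F = uv
  f-pres 0F 2F = uw
  f-pres 1F 0F = trans (sym G v u) uv
  f-pres 1F 1F = irrefl G v
  f-pres 1F 2F = vw
  f-pres 2F 0F = trans (sym G w u) uw
  f-pres 2F 1F = trans (sym G w v) vw
  f-pres 2F 2F = irrefl G w

vertex-emb : ∀ {G} → V G → K 1 ↪ G
vertex-emb {G} v = emb (λ _ → v) (λ { {0F} {0F} _ → refl }) (λ { 0F 0F → irrefl G v })

-- If a vertex of `H` were missed, its deletion would give `F` one of the two partitions that a core
-- excludes.
↪-core⇒≅ : ∀ {F H t} → Core t F → Core t H → F ↪ H → F ≅ H
↪-core⇒≅ F-core H-core e with onto-or-missed (fn e)
... | inj₁ onto = ↪-onto⇒≅ e onto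
... | inj₂ (v , missed) with del H-core v
...   | inj₁ p = ⊥-elim (¬mono F-core (pull e (λ i _ → missed i) p))
...   | inj₂ p = ⊥-elim (¬cluster F-core (pull e (λ i _ → missed i) p))

-- H is a cluster with t + 1 non-trivial cliques, plus the vertex v.
module ClusterPlusVertex {t : ℕ} {H : Graph} (core : Core t H) {v : V H} {q : Pol H (Off v) (fin 0) (fin (suc t))}
  (two : TwoEach q) where

  open TwoEach two

  private
    Shape : Set
    Shape = H ≅ plus2 t (P 3) ⊎ (Σ[ m ∈ ℕ ] m + 1 ≡ t × H ≅ plus2 m butterfly)

    class : ∀ {u} → u ≢ v → Σ[ i ∈ Fin (suc t) ] st q u ≡ B (toℕ i)
    class u≢v with cluster-B q u≢v
    ... | d , eu = fromℕ< d< , trans eu (cong B (≡-sym (Fin.toℕ-fromℕ< d<)))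
      where d< = bnd-B q u≢v eu

    rest-apart : ∀ {C : Graph} (e : C ↪ H) {m} (f : Fin m → Fin (suc t)) (f-inj : Injective _≡_ _≡_ f) →
      let open Complement (complement f f-inj) in
      (∀ j a z → r (g j) a ≢ fn e z × adj H (r (g j) a) (fn e z) ≡ false) → EdgesApart e (r ∘ g)
    rest-apart e f f-inj sep = record { edge = r-edge two ∘ g ; apart = λ i≢j → r-apart two (i≢j ∘ g-inj) ; apartᶜ = sep }
      where open Complement (complement f f-inj)

    -- v is adjacent to u but not to w in the same clique: P₄-freeness makes v-u-w a component.
    mixed-case : ∀ {u w i} → u ≢ v → w ≢ v → st q u ≡ B (toℕ i) → st q w ≡ B (toℕ i) →
                 adj H v u ≡ true → adj H v w ≡ false → Shape
    mixed-case {u} {w} {i} u≢v w≢v eu ew vu vw = inj₁ (≅-sym iso)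
      where
      u≢w : u ≢ w
      u≢w refl = true≢false vu vw
      uw : adj H u w ≡ true
      uw = same-colour⇒adj q u≢v w≢v u≢w eu ew
      path : P 3 ↪ H
      path = path-emb vu uw vw (w≢v ∘ ≡-sym)
      f : Fin 1 → Fin (suc t)
      f _ = i
      f-inj : Injective _≡_ _≡_ f
      f-inj {0F} {0F} _ = refl
      open Complement (complement f f-inj)
      size≡t : size ≡ t
      size≡t = ℕ.suc-injective (trans (ℕ.+-comm 1 size) size-eq)
      other : ∀ j a {z} → z ≢ v → st q z ≡ B (toℕ i) → r (g j) a ≢ z × adj H (r (g j) a) z ≡ false
      other j a z≢v ez = other-colour⇒apart q (r-in _ a) z≢v (r-col _ a) ez
        (λ e → disjoint 0F j (≡-sym (Fin.toℕ-injective e)))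
      off-v : ∀ j a → adj H (r (g j) a) v ≡ false
      off-v j a with bool-cases (adj H (r (g j) a) v)
      ... | inj₂ e = e
      -- A neighbour of `v` in another clique would extend w - u - v to an induced P₄.
      ... | inj₁ e = ⊥-elim (coreNoP4 core w u v (r (g j) a) (trans (sym H w u) uw) (trans (sym H u v) vu)
              (trans (sym H v _) e) (trans (sym H w v) vw) (trans (sym H w _) (proj₂ (other j a w≢v ew)))
              (trans (sym H u _) (proj₂ (other j a u≢v eu))))
      sep : ∀ j a z → r (g j) a ≢ fn path z × adj H (r (g j) a) (fn path z) ≡ false
      sep j a 0F = r-in (g j) a , off-v j a
      sep j a 1F = other j a u≢v eu
      sep j a 2F = other j a w≢v ew
      F-core : Core (size + 0) (plus2 size (P 3))
      F-core = proj₁ (Core-plus2 Core-P3 (Pol-All (P 3) (A 0 ∷ B 0 ∷ B 0 ∷ []) refl) size)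
      iso : plus2 t (P 3) ≅ H
      iso = subst (λ m → plus2 m (P 3) ≅ H) size≡t (↪-core⇒≅
        (subst (λ m → Core m (plus2 size (P 3))) (trans (ℕ.+-identityʳ size) size≡t) F-core) core
        (proj₁ (plus2-emb path (rest-apart path f f-inj sep))))

    module Uniform (uniform : ∀ {u w} {i : Fin (suc t)} → u ≢ v → w ≢ v → st q u ≡ B (toℕ i) → st q w ≡ B (toℕ i) →
                              adj H v u ≡ adj H v w) where

      Touches : Fin (suc t) → Set
      Touches i = adj H v (r i 0F) ≡ true

      touches? : ∀ i → Dec (Touches i)
      touches? i = adj H v (r i 0F) Bool.≟ true

      touch : ∀ {i} → Touches i → ∀ a → adj H v (r i a) ≡ true
      touch {i} e a = trans (uniform (r-in i a) (r-in i 0F) (r-col i a) (r-col i 0F)) e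

      no-touch : ∀ {i} → ¬ Touches i → ∀ a → adj H (r i a) v ≡ false
      no-touch {i} ne a = trans (sym H _ v) (trans (uniform (r-in i a) (r-in i 0F) (r-col i a) (r-col i 0F)) (Bool.¬-not ne))

      -- With one edge from each clique, `v` would form (t+1)K₂ + K₁, which the (∞,t)-partition of
      -- `H` excludes.
      touch-none : ¬ (∀ i → ¬ Touches i)
      touch-none none′ = ¬Pol-K2s+K1 t (pull (proj₁ (plus2-emb (vertex-emb v) apart-v)) (λ _ _ → tt) (multi core))
        where
        apart-v : EdgesApart (vertex-emb v) r
        apart-v = record { edge = r-edge two ; apart = r-apart two ; apartᶜ = λ i a _ → r-in i a , no-touch (none′ i) a }

      -- `v` would extend the one clique that it touches, making `H` a cluster with `t + 1` cliques.
      touch-one : ∀ i₀ → Touches i₀ → ¬ (∀ i → i ≢ i₀ → ¬ Touches i)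
      touch-one i₀ t₀ others = ¬cluster core (Pol-override q (Fin.toℕ<n i₀) compat)
        where
        compat : ∀ u → u ≢ v → Compat (B (toℕ i₀)) (st q u) (adj H v u)
        compat u u≢v with class u≢v
        ... | i , eu rewrite eu = adj⇒ , nonadj⇒
          where
          vu : adj H v u ≡ adj H v (r i 0F)
          vu = uniform u≢v (r-in i 0F) eu (r-col i 0F)
          adj⇒ : adj H v u ≡ true → toℕ i₀ ≡ toℕ i
          adj⇒ e with i Fin.≟ i₀
          ... | yes i≡i₀ = cong toℕ (≡-sym i≡i₀)
          ... | no i≢i₀ = ⊥-elim (others i i≢i₀ (trans (≡-sym vu) e))
          nonadj⇒ : adj H v u ≡ false → toℕ i₀ ≢ toℕ i
          nonadj⇒ e eq with Fin.toℕ-injective eq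
          ... | refl = true≢false t₀ (trans (≡-sym vu) e)

      pick₂ : Fin (suc t) → Fin (suc t) → Fin 2 → Fin (suc t)
      pick₂ i₀ i₁ 0F = i₀
      pick₂ i₀ i₁ 1F = i₁

      pick₂-inj : ∀ {i₀ i₁} → i₁ ≢ i₀ → Injective _≡_ _≡_ (pick₂ i₀ i₁)
      pick₂-inj ne {0F} {0F} _ = refl
      pick₂-inj ne {1F} {1F} _ = refl
      pick₂-inj ne {0F} {1F} e = ⊥-elim (ne (≡-sym e))
      pick₂-inj ne {1F} {0F} e = ⊥-elim (ne e)

      pick₂-touch : ∀ {i₀ i₁} → Touches i₀ → Touches i₁ → ∀ b → Touches (pick₂ i₀ i₁ b)
      pick₂-touch t₀ t₁ 0F = t₀
      pick₂-touch t₀ t₁ 1F = t₁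

      -- `v` and an edge from each touched clique form K₁ ⊕ 2K₂. Together with an edge from each
      -- other clique this is already a core, so it exhausts `H`.
      touch-two : ∀ i₀ i₁ → i₁ ≢ i₀ → Touches i₀ → Touches i₁ →
                  (∀ i → i ≢ i₀ → i ≢ i₁ → ¬ Touches i) → Shape
      touch-two i₀ i₁ ne t₀ t₁ others = inj₂ (size , size+1 , ≅-sym iso)
        where
        f = pick₂ i₀ i₁
        open Complement (complement f (pick₂-inj ne))
        size+1 : size + 1 ≡ t
        size+1 = ℕ.suc-injective (trans (≡-sym (ℕ.+-suc size 1)) size-eq)
        edges,elim = plus2-emb (empty-emb {H}) {r = r ∘ f}
          (record { edge = r-edge two ∘ f ; apart = λ i≢j → r-apart two (i≢j ∘ pick₂-inj ne) ; apartᶜ = λ _ _ () })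
        edges = proj₁ edges,elim
        vert : K 1 ↪ H
        vert = vertex-emb v
        cone : butterfly ↪ H
        cone = ⊕-emb vert edges (λ _ → proj₂ edges,elim (λ z → adj H v z ≡ true) (λ b → touch (pick₂-touch t₀ t₁ b)) (λ ()))
        sep : ∀ j a z → r (g j) a ≢ fn cone z × adj H (r (g j) a) (fn cone z) ≡ false
        sep j a = copair-elim vert edges (λ z → r (g j) a ≢ z × adj H (r (g j) a) z ≡ false)
          (λ _ → r-in (g j) a , no-touch (others (g j) (disjoint 0F j ∘ ≡-sym) (disjoint 1F j ∘ ≡-sym)) a)
          (proj₂ edges,elim (λ z → r (g j) a ≢ z × adj H (r (g j) a) z ≡ false)
            (λ b → r-apart two (disjoint b j ∘ ≡-sym) a) (λ ()))
        F-core : Core (size + 1) (plus2 size butterfly)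
        F-core = proj₁ (Core-plus2 Core-butterfly (Pol-All butterfly (A 0 ∷ B 0 ∷ B 0 ∷ B 1 ∷ B 1 ∷ []) refl) size)
        iso : plus2 size butterfly ≅ H
        iso = ↪-core⇒≅ (subst (λ m → Core m (plus2 size butterfly)) size+1 F-core) core
          (proj₁ (plus2-emb cone (rest-apart cone f (pick₂-inj ne) sep)))

      -- Deleting a vertex of a third touched clique still leaves v in A and t + 1 cliques in B.
      touch-three : ∀ i₀ i₁ i₂ → i₁ ≢ i₀ → i₂ ≢ i₀ → i₂ ≢ i₁ → Touches i₀ → Touches i₁ → Touches i₂ → ⊥
      touch-three i₀ i₁ i₂ ne₁₀ ne₂₀ ne₂₁ t₀ t₁ t₂ with del core (r i₂ 0F)
      -- The deletion is not a cluster: `v` and the two other touched cliques still contain a P₃.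
      ... | inj₂ p = P3⇒¬cluster (r i₀ 0F) v (r i₁ 0F) (apart₂ ne₂₀ 0F) (r-in i₂ 0F ∘ ≡-sym) (apart₂ ne₂₁ 0F)
              (trans (sym H _ v) t₀) t₁ (proj₂ i₀-i₁) (proj₁ i₀-i₁) p
        where
        apart₂ : ∀ {i} → i₂ ≢ i → ∀ a → r i a ≢ r i₂ 0F
        apart₂ ne a = proj₁ (r-apart two (ne ∘ ≡-sym) a 0F)
        i₀-i₁ = r-apart two (ne₁₀ ∘ ≡-sym) 0F 0F
      ... | inj₁ p = ℕ.<-irrefl refl (Fin.injective⇒≤ {f = colour} colour-inj)
        where
        apart₂ : ∀ {i} → i ≢ i₂ → ∀ a → r i a ≢ r i₂ 0F
        apart₂ ne a = proj₁ (r-apart two ne a 0F)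
        v-off : v ≢ r i₂ 0F
        v-off = r-in i₂ 0F ∘ ≡-sym
        InB : Fin (suc t) → Set
        InB i = Σ[ a ∈ Fin 2 ] r i a ≢ r i₂ 0F × ∃ λ d → st p (r i a) ≡ B d
        edge-in-B : ∀ {i} → i ≢ i₂ → InB i
        edge-in-B {i} ne with one-in-B p (apart₂ ne 0F) (apart₂ ne 1F) (r-edge two i)
        ... | inj₁ b = 0F , apart₂ ne 0F , b
        ... | inj₂ b = 1F , apart₂ ne 1F , b
        v-in-A : ¬ (∃ λ d → st p v ≡ B d)
        v-in-A (_ , ev) with edge-in-B (ne₂₀ ∘ ≡-sym) | edge-in-B (ne₂₁ ∘ ≡-sym)
        ... | a₀ , off₀ , _ , e₀ | a₁ , off₁ , _ , e₁ =
          proj₂ (cmp-BB p off₀ off₁ (proj₁ sep) e₀ e₁) (proj₂ sep) (trans (≡-sym (v-colour off₀ (touch t₀ a₀) e₀)) (v-colour off₁ (touch t₁ a₁) e₁))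
          where
          sep = r-apart two (ne₁₀ ∘ ≡-sym) a₀ a₁
          v-colour : ∀ {u d} → u ≢ r i₂ 0F → adj H v u ≡ true → st p u ≡ B d → _ ≡ d
          v-colour off vu eu = proj₁ (cmp-BB p v-off off (adj⇒≢ H vu) ev eu) vu
        in-B : ∀ i → InB i
        in-B i with i Fin.≟ i₂
        ... | no ne = edge-in-B ne
        -- The partner of the deleted vertex survives, and it is in B because its neighbour `v` is
        -- in A.
        ... | yes refl with one-in-B p v-off (r-diff i ∘ ≡-sym) (touch t₂ 1F)
        ...   | inj₁ b = ⊥-elim (v-in-A b)
        ...   | inj₂ b = 1F , r-diff i ∘ ≡-sym , b
        col : Fin (suc t) → ℕ
        col i = proj₁ (proj₂ (proj₂ (in-B i)))
        col-st : ∀ i → st p (r i (proj₁ (in-B i))) ≡ B (col i)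
        col-st i = proj₂ (proj₂ (proj₂ (in-B i)))
        col-off : ∀ i → r i (proj₁ (in-B i)) ≢ r i₂ 0F
        col-off i = proj₁ (proj₂ (in-B i))
        col< : ∀ i → col i < t
        col< i = bnd-B p (col-off i) (col-st i)
        colour : Fin (suc t) → Fin t
        colour i = fromℕ< (col< i)
        colour-inj : ∀ {i j} → colour i ≡ colour j → i ≡ j
        colour-inj {i} {j} eq with i Fin.≟ j
        ... | yes i≡j = i≡j
        ... | no i≢j = ⊥-elim (proj₂ (cmp-BB p (col-off i) (col-off j) (proj₁ sep) (col-st i) (col-st j)) (proj₂ sep)
                (trans (≡-sym (Fin.toℕ-fromℕ< (col< i))) (trans (cong toℕ eq) (Fin.toℕ-fromℕ< (col< j)))))
          where sep = r-apart two i≢j (proj₁ (in-B i)) (proj₁ (in-B j))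

  shape : Shape
  shape with Fin.any? (λ u → Fin.any? λ w → Fin.any? λ i → (¬? (u Fin.≟ v) ×-dec ¬? (w Fin.≟ v)) ×-dec
               ((≟-B (st q u) (toℕ i) ×-dec ≟-B (st q w) (toℕ i)) ×-dec
               ((adj H v u Bool.≟ true) ×-dec (adj H v w Bool.≟ false))))
  ... | yes (u , w , i , (u≢v , w≢v) , (eu , ew) , vu , vw) = mixed-case u≢v w≢v eu ew vu vw
  ... | no ¬mixed = go
    where
    uniform : ∀ {u w i} → u ≢ v → w ≢ v → st q u ≡ B (toℕ i) → st q w ≡ B (toℕ i) → adj H v u ≡ adj H v w
    uniform {u} {w} {i} u≢v w≢v eu ew with bool-cases (adj H v u) | bool-cases (adj H v w)
    ... | inj₁ e | inj₁ f = trans e (≡-sym f)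
    ... | inj₂ e | inj₂ f = trans e (≡-sym f)
    ... | inj₁ e | inj₂ f = ⊥-elim (¬mixed (u , w , i , (u≢v , w≢v) , (eu , ew) , e , f))
    ... | inj₂ e | inj₁ f = ⊥-elim (¬mixed (w , u , i , (w≢v , u≢v) , (ew , eu) , f , e))
    open Uniform uniform
    go : Shape
    go with Fin.any? touches?
    ... | no absent = ⊥-elim (touch-none λ i e → absent (i , e))
    ... | yes (i₀ , t₀) with Fin.any? (λ i → ¬? (i Fin.≟ i₀) ×-dec touches? i)
    ...   | no absent = ⊥-elim (touch-one i₀ t₀ λ i ne e → absent (i , ne , e))
    ...   | yes (i₁ , ne , t₁) with Fin.any? (λ i → ¬? (i Fin.≟ i₀) ×-dec (¬? (i Fin.≟ i₁) ×-dec touches? i))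
    ...     | no absent = touch-two i₀ i₁ ne t₀ t₁ λ i ne₀ ne₁ e → absent (i , ne₀ , ne₁ , e)
    ...     | yes (i₂ , ne₂₀ , ne₂₁ , t₂) = ⊥-elim (touch-three i₀ i₁ i₂ ne ne₂₀ ne₂₁ t₀ t₁ t₂)

-- The two directions of the equivalence

Conclusion : ℕ → Graph → Set
Conclusion k H =
  (H ≅ (P 3 +ᴳ copies (k ∸ 1) (K 2)))
  ⊎ (H ≅ (copies (k ∸ 2) (K 2) +ᴳ (K 1 ⊕ copies 2 (K 2))))
  ⊎ (Σ[ j ∈ ℕ ] (1 ≤ j × j ≤ k ∸ 1 ×
       Σ[ Hj ∈ Graph ] (Connected Hj × CographMinObs (fin 1) (fin j) Hj ×
         ¬ CographMinObs (fin 1) ∞ Hj ×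
         (H ≅ (copies (k ∸ j ∸ 1) (K 2) +ᴳ Hj)))))
  ⊎ (3 ≤ k × CographMinObs (fin 1) ∞ H)

suc-∸-∸ : ∀ t j → suc t ∸ j ∸ 1 ≡ t ∸ j
suc-∸-∸ t j = trans (ℕ.∸-+-assoc (suc t) j 1) (cong (suc t ∸_) (ℕ.+-comm j 1))

plus2-MinObs : ∀ {t j C H} m → m + j ≡ t → Core j C × Pol C All (fin 1) (fin (suc j)) → H ≅ plus2 m C →
               MinObs ∞ (fin (suc t)) (P 3 +ᴳ H)
plus2-MinObs {C = C} m refl (core , p) i with Core-plus2 core p m
... | core′ , p′ = MinObs-≅ (+-congʳ {P 3} (≅-sym i)) (Core⇒MinObs core′ (inj₁ p′))

sufficient : ∀ {t H} → 1 ≤ t → Conclusion (suc t) H → MinObs ∞ (fin (suc t)) (P 3 +ᴳ H)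
sufficient {t} _ (inj₁ i) = plus2-MinObs t (ℕ.+-identityʳ t)
  (Core-P3 , Pol-All (P 3) (A 0 ∷ B 0 ∷ B 0 ∷ []) refl)
  (≅-trans i (≅-trans (+-comm (P 3) (copies t (K 2))) (copies+≅plus2 t (P 3))))
sufficient {t} 1≤t (inj₂ (inj₁ i)) = plus2-MinObs (t ∸ 1) (ℕ.m∸n+n≡m 1≤t)
  (Core-butterfly , Pol-All butterfly (A 0 ∷ B 0 ∷ B 0 ∷ B 1 ∷ B 1 ∷ []) refl)
  (≅-trans i (copies+≅plus2 (t ∸ 1) butterfly))
sufficient {t} _ (inj₂ (inj₂ (inj₁ (j , 1≤j , j≤t , C , conn , minC , ¬min∞ , i)))) =
  plus2-MinObs (suc t ∸ j ∸ 1) (trans (cong (_+ j) (suc-∸-∸ t j)) (ℕ.m∸n+n≡m j≤t))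
    (Core-connected 1≤j conn (to-MinObs minC) (¬min∞ ∘ from-MinObs)) (≅-trans i (copies+≅plus2 (suc t ∸ j ∸ 1) C))
sufficient _ (inj₂ (inj₂ (inj₂ (s≤s 2≤t , m)))) = MinObs-1∞⇒MinObs 2≤t (to-MinObs m)

base-emb : ∀ m {C} → C ↪ plus2 m C
base-emb zero    = emb id id (λ _ _ → refl)
base-emb (suc m) {C} = ↪-trans (base-emb m) (inr {K 2} {plus2 m C})

peeled⇒conclusion : ∀ {t H} → Peeled t H → (∀ v → Pol H (Off v) (fin 1) (fin t)) → Conclusion (suc t) H
peeled⇒conclusion {t} {H} Q off = inj₂ (inj₂ (go (connected-status joined)))
  where
  open Peeled Q
  case₃ : Pol C All (fin 1) ∞ → _ ⊎ _
  case₃ p = inj₁ (j , 1≤j , subst (j ≤_) m+j (ℕ.m≤n+m j m) , C , join-connected joined , from-MinObs min ,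
    (λ m∞ → ¬pol (to-MinObs m∞) p) ,
    subst (λ m → H ≅ (copies m (K 2) +ᴳ C)) m≡ (≅-trans iso (≅-sym (copies+≅plus2 m C))))
    where
    m≡ : m ≡ suc t ∸ j ∸ 1
    m≡ = trans (≡-sym (ℕ.m+n∸n≡m m j)) (trans (cong (_∸ j) m+j) (≡-sym (suc-∸-∸ t j)))
  case₄ : ∀ {F} → Forbidden F → F ↪ C → ∀ m → m + j ≡ t → H ≅ plus2 m C → 3 ≤ suc t × CographMinObs (fin 1) ∞ H
  -- Deleting a vertex of a K₂ component leaves the copy of `F` intact, although that deletion is
  -- (1,t)-polar.
  case₄ f e (suc m) _ i = ⊥-elim (¬monopolar (relax∞ (pull (↪-trans e C↪) (λ u _ eq → ↑ˡ≢↑ʳ {2} 0F (fn (base-emb m) (fn e u)) (≡-sym eq))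
      (Off-≅ i off (0F ↑ˡ n (plus2 m C))))))
    where
    open ForbiddenFacts (forbidden-facts f)
    C↪ : C ↪ plus2 (suc m) C
    C↪ = base-emb (suc m)
  case₄ {F} f e zero refl i = s≤s (2≤t 1≤j off-C) , from-MinObs (MinObs-≅ (≅-sym i)
      (minObs (noP4 min) (¬monopolar ∘ pull e (λ _ _ → tt)) (relax∞ ∘ offᵛ min)))
    where
    open ForbiddenFacts (forbidden-facts f)
    F≅C : F ≅ C
    F≅C = ↪-minimal⇒≅ e (¬monopolar ∘ relax∞) (offᵛ min)
    off-C : ∀ v → Pol F (Off v) (fin 1) (fin j)
    off-C = Off-≅ (≅-sym F≅C) (offᵛ min)
    2≤t : ∀ {j} → 1 ≤ j → (∀ v → Pol F (Off v) (fin 1) (fin j)) → 2 ≤ j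
    -- For `j = 1` every deletion of `F` would be split, against `nonsplit`.
    2≤t {suc zero} _ off₁ = ⊥-elim (proj₂ nonsplit (off₁ (proj₁ nonsplit)))
    2≤t {suc (suc _)} _ _ = s≤s (s≤s z≤n)
  go : ConnectedStatus C → _ ⊎ _
  go (isSplit p) = ⊥-elim (¬pol min (relaxʳ 1≤j p))
  go (isIndepClust R il q) = case₃ (indepCluster⇒mono R il q)
  go (hasForbidden f e) = inj₂ (case₄ f e m m+j iso)

-- Before the case distinction, any deletion that is a cluster with a clique of at most one vertex
-- is turned into a (1,t)-polar one by moving that clique to A.
necessary : ∀ {t H} → Core t H → Conclusion (suc t) H
necessary {t} {H} core with all-or-some refined
  where
  refined : ∀ v → Pol H (Off v) (fin 1) (fin t) ⊎ Σ (Pol H (Off v) (fin 0) (fin (suc t))) TwoEach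
  refined v with del core v
  ... | inj₁ p = inj₁ p
  ... | inj₂ p with small-class (λ u → ¬? (u Fin.≟ v)) p
  ...   | inj₁ (i , unique) = inj₁ (absorb-small-class p i unique)
  ...   | inj₂ two = inj₂ (p , two)
... | inj₁ off = peeled⇒conclusion (peel-K2s t H (coreNoP4 core) (¬mono core) (¬cluster core) off (multi core)) off
... | inj₂ (v , q , two) with ClusterPlusVertex.shape core two
...   | inj₁ i = inj₁ (≅-trans i (≅-trans (≅-sym (copies+≅plus2 t (P 3))) (+-comm (copies t (K 2)) (P 3))))
...   | inj₂ (m , m+1 , i) = inj₂ (inj₁ (subst (λ m → H ≅ (copies m (K 2) +ᴳ butterfly))
          (trans (≡-sym (ℕ.m+n∸n≡m m 1)) (cong (_∸ 1) m+1)) (≅-trans i (≅-sym (copies+≅plus2 m butterfly)))))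

P3-component : ∀ {G} → HasComponentIso G (P 3) → Σ[ H ∈ Graph ] G ≅ (P 3 +ᴳ H)
P3-component {G} (f , f-inj , i , closed) = split-component e λ v a miss →
    closed v (from a) (λ b eq → miss (to b) (trans (cong f (from-to b)) eq))
  where
  open _≅_ i
  e : P 3 ↪ G
  e = ↪-trans (≅⇒↪ (≅-sym i)) (emb f f-inj (λ _ _ → refl))

theorem6 : (k : ℕ) → 2 ≤ k → (G : Graph) → HasComponentIso G (P 3) →
    (CographMinObs ∞ (fin k) G ⇔
    (Σ[ H ∈ Graph ] ((G ≅ (P 3 +ᴳ H)) ×
    ((H ≅ (P 3 +ᴳ copies (k ∸ 1) (K 2)))
    ⊎ (H ≅ (copies (k ∸ 2) (K 2) +ᴳ (K 1 ⊕ copies 2 (K 2))))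
    ⊎ (Σ[ j ∈ ℕ ] (1 ≤ j × j ≤ k ∸ 1 ×
    Σ[ Hj ∈ Graph ] (Connected Hj × CographMinObs (fin 1) (fin j) Hj ×
    ¬ CographMinObs (fin 1) ∞ Hj ×
    (H ≅ (copies (k ∸ j ∸ 1) (K 2) +ᴳ Hj)))))
    ⊎ (3 ≤ k × CographMinObs (fin 1) ∞ H)))))
theorem6 (suc t) (s≤s 1≤t) G comp = mk⇔
  (λ m → let H , i = P3-component comp in H , i , necessary (MinObs⇒Core (MinObs-≅ i (to-MinObs m))))
  (λ { (H , i , c) → from-MinObs (MinObs-≅ (≅-sym i) (sufficient 1≤t c)) })
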